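{- Let $q$ be a prime power, let $L$ be a line in $\mathrm{PG}(5,q)$, and let $i\in\{0,1,2,3,q+1\}$. Then $L$ intersects the secant variety of the Veronese surface $\mathcal V(\mathbb F_q)$ in exactly $i$ points if and only if the cubic surface associated with $L$ has exactly $q^2+iq+1$ points (in $\mathrm{PG}(3,q)$).
   Context: A point $(y_0,\dots,y_5)$ of $\mathrm{PG}(5,q)$ is identified with the nonzero symmetric matrix $\begin{bmatrix} y_0&y_1&y_2\\ y_1&y_3&y_4\\ y_2&y_4&y_5\end{bmatrix}$ up to scalar, and its rank is the rank of this matrix. The Veronese surface $\mathcal V(\mathbb F_q)$ is the set of points of rank 1, and the points of its secant variety are the points of rank at most 2. A quadratic form $f=\sum_{0\le i\le j\le 2}a_{ij}X_iX_j$ corresponds to the hyperplane $a_{00}Y_0+a_{01}Y_1+a_{02}Y_2+a_{11}Y_3+a_{12}Y_4+a_{22}Y_5=0$ of $\mathrm{PG}(5,q)$. The quadratic forms whose hyperplanes contain a given line $L$ form (with $0$) a 4-dimensional vector space; let $f_1,f_2,f_3,f_4$ be a basis of it (so $\mathcal W=(f_1,f_2,f_3,f_4)$ is the web of conics associated with $L$). The discriminant of $f$ is $\Delta_f=4a_{00}a_{11}a_{22}+a_{01}a_{02}a_{12}-a_{00}a_{12}^2-a_{11}a_{02}^2-a_{22}a_{01}^2$. The cubic surface associated with $L$ is the zero locus in $\mathrm{PG}(3,q)$ of the cubic form $\Delta_f\in\mathbb F_q[A,B,C,D]$, where $f=Af_1+Bf_2+Cf_3+Df_4$; it is well defined up to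 projectivity. -}

module Defs where

open import Algebra.Apartness.Bundles using (HeytingField; HeytingCommutativeRing)
import Algebra.Apartness.Properties.HeytingCommutativeRing as HCRProperties
open import Algebra.Bundles using (CommutativeRing)
import Algebra.Definitions.RawMonoid as RawMonoidDefinitions
import Data.Vec.Functional.Relation.Binary.Equality.Setoid as VectorEquality
open import Data.Fin.Base using (Fin)
open import Data.Fin.Patterns using (0F; 1F; 2F; 3F; 4F; 5F)
open import Data.Nat.Base as ℕ using (ℕ; suc)
open import Data.Nat.Primality using (Prime)
open import Data.Product.Base using (Σ-syntax; ∃; ∃-syntax; _×_; _,_; proj₁)
open import Data.Vec.Functional using (Vector; []; _∷_; replicate)
open import Function.Bundles using (Inverse; _⇔_)
open import Level using (Level; _⊔_)
open import Relation.Binary.Bundles using (Setoid)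
open import Relation.Binary.PropositionalEquality using (_≡_)
import Relation.Binary.PropositionalEquality.Properties as ≡
import Relation.Binary.Reasoning.Setoid as ≈-Reasoning
open import Relation.Nullary.Negation using (¬_)
open import Relation.Unary using (Pred)

IsPrimePower : ℕ → Set
IsPrimePower q = ∃[ p ] ∃[ k ] Prime p × q ≡ p ℕ.^ suc k

HasSize : ∀ {a ℓ} → Setoid a ℓ → ℕ → Set (a ⊔ ℓ)
HasSize S n = Inverse S (≡.setoid (Fin n))

-- For a Heyting field of finite size, equality is decidable and `x # y` is
-- equivalent to `¬ x ≈ y`, so a finite Heyting field is a finite field in the
-- usual sense.  In particular `0# ≉ 1#` holds in every Heyting field.
module ProjectiveGeometry {c ℓ₁ ℓ₂} (F : HeytingField c ℓ₁ ℓ₂) where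

  private
    module F = HeytingField F
    module R = CommutativeRing (HeytingCommutativeRing.commutativeRing F.heytingCommutativeRing)

  open F using (Carrier; _≈_; _#_; _+_; _*_; _-_; 0#; 1#)
  open RawMonoidDefinitions R.+-rawMonoid using (sum) renaming (_×_ to _×ℕ_)
  open VectorEquality R.setoid using (_≋_)
  open HCRProperties F.heytingCommutativeRing using (1#0; x-0≈x; x#0y#0→xy#0; invertibleˡ⇒#)

  private variable
    p : Level
    d k m n : ℕ

  scalars : Setoid c ℓ₁
  scalars = R.setoid

  infixr 7 _*ᵥ_

  _*ᵥ_ : Carrier → Vector Carrier n → Vector Carrier n
  (a *ᵥ v) j = a * v j

  0ᵥ : Vector Carrier n
  0ᵥ = replicate _ 0#

  linearCombination : Vector Carrier k → Vector (Vector Carrier n) k → Vector Carrier n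
  linearCombination a b j = sum (λ i → a i * b i j)

  Span : Vector (Vector Carrier n) k → Pred (Vector Carrier n) (c ⊔ ℓ₁)
  Span b v = ∃[ a ] v ≋ linearCombination a b

  LinearlyIndependent : Vector (Vector Carrier n) k → Set (c ⊔ ℓ₁)
  LinearlyIndependent b = ∀ a → linearCombination a b ≋ 0ᵥ → a ≋ 0ᵥ

  IsBasis : Vector (Vector Carrier n) k → Pred (Vector Carrier n) p → Set (c ⊔ ℓ₁ ⊔ p)
  IsBasis b W = LinearlyIndependent b × (∀ v → W v ⇔ Span b v)

  -- `W` is a linear subspace of dimension `k`.  (That `W` is closed under the
  -- vector space operations follows from its being equal to a span.)
  HasDimension : Pred (Vector Carrier n) p → ℕ → Set (c ⊔ ℓ₁ ⊔ p)
  HasDimension {n = n} W k = Σ[ b ∈ Vector (Vector Carrier n) k ] IsBasis b W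

  -- The rank of a matrix, given as the family of its rows, is the dimension of
  -- its row space.
  HasRank : Vector (Vector Carrier n) m → ℕ → Set (c ⊔ ℓ₁)
  HasRank M r = HasDimension (Span M) r

  Proportional : Vector Carrier n → Vector Carrier n → Set (c ⊔ ℓ₁ ⊔ ℓ₂)
  Proportional v w = ∃[ a ] a # 0# × v ≋ (a *ᵥ w)

  private
    prop-refl : {v : Vector Carrier n} → Proportional v v
    prop-refl = 1# , 1#0 , λ j → R.sym (R.*-identityˡ _)

    prop-sym : {v w : Vector Carrier n} → Proportional v w → Proportional w v
    prop-sym {v = v} {w = w} (a , a#0 , v≋aw) with F.#⇒invertible a#0
    ... | a⁻¹ , a⁻¹[a-0]≈1 , [a-0]a⁻¹≈1 = a⁻¹ , invertibleˡ⇒# (a , aa⁻¹-0≈1) , w≋a⁻¹v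
      where
      open ≈-Reasoning R.setoid
      aa⁻¹-0≈1 : a * (a⁻¹ - 0#) ≈ 1#
      aa⁻¹-0≈1 = begin
        a * (a⁻¹ - 0#)  ≈⟨ R.*-congˡ (x-0≈x a⁻¹) ⟩
        a * a⁻¹         ≈⟨ R.*-congʳ (x-0≈x a) ⟨
        (a - 0#) * a⁻¹  ≈⟨ [a-0]a⁻¹≈1 ⟩
        1#              ∎
      w≋a⁻¹v : w ≋ (a⁻¹ *ᵥ v)
      w≋a⁻¹v j = begin
        w j                     ≈⟨ R.*-identityˡ (w j) ⟨
        1# * w j                ≈⟨ R.*-congʳ a⁻¹[a-0]≈1 ⟨
        a⁻¹ * (a - 0#) * w j    ≈⟨ R.*-assoc a⁻¹ (a - 0#) (w j) ⟩
        a⁻¹ * ((a - 0#) * w j)  ≈⟨ R.*-congˡ (R.*-congʳ (x-0≈x a)) ⟩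
        a⁻¹ * (a * w j)         ≈⟨ R.*-congˡ (v≋aw j) ⟨
        a⁻¹ * v j               ∎

    prop-trans : {u v w : Vector Carrier n} → Proportional u v → Proportional v w → Proportional u w
    prop-trans (a , a#0 , u≋av) (b , b#0 , v≋bw) =
      a * b , x#0y#0→xy#0 a#0 b#0 ,
      λ j → R.trans (u≋av j) (R.trans (R.*-congˡ (v≋bw j)) (R.sym (R.*-assoc a b _)))

  -- The points of PG(d,F) whose coordinate vectors satisfy `P`, for a predicate
  -- `P` that is invariant under nonzero scaling.
  PG : (d : ℕ) → Pred (Vector Carrier (suc d)) p → Setoid (c ⊔ ℓ₁ ⊔ p) (c ⊔ ℓ₁ ⊔ ℓ₂)
  PG d P = record
    { Carrier       = Σ[ v ∈ Vector Carrier (suc d) ] (¬ v ≋ 0ᵥ) × P v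
    ; _≈_           = λ x y → Proportional (proj₁ x) (proj₁ y)
    ; isEquivalence = record { refl = prop-refl ; sym = prop-sym ; trans = prop-trans }
    }

  -- A line of PG(d,F), as a set of coordinate vectors together with 0.
  IsLine : Pred (Vector Carrier (suc d)) p → Set (c ⊔ ℓ₁ ⊔ p)
  IsLine L = HasDimension L 2

  symmetricMatrix : Vector Carrier 6 → Vector (Vector Carrier 3) 3
  symmetricMatrix y =
    (y 0F ∷ y 1F ∷ y 2F ∷ []) ∷
    (y 1F ∷ y 3F ∷ y 4F ∷ []) ∷
    (y 2F ∷ y 4F ∷ y 5F ∷ []) ∷ []

  SecantVariety : Pred (Vector Carrier 6) (c ⊔ ℓ₁)
  SecantVariety y = ∃[ r ] r ℕ.≤ 2 × HasRank (symmetricMatrix y) r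

  -- The ternary quadratic form Σ_{i≤j} aᵢⱼXᵢXⱼ is represented by its vector of
  -- coefficients (a₀₀ , a₀₁ , a₀₂ , a₁₁ , a₁₂ , a₂₂).
  QuadraticForm : Set c
  QuadraticForm = Vector Carrier 6

  -- With this order of the coefficients, the hyperplane of `f` is Σₖ fₖYₖ = 0.
  Hyperplane : QuadraticForm → Pred (Vector Carrier 6) ℓ₁
  Hyperplane f y = sum (λ k → f k * y k) ≈ 0#

  Web : Pred (Vector Carrier 6) p → Pred QuadraticForm (c ⊔ ℓ₁ ⊔ p)
  Web L f = ∀ y → L y → Hyperplane f y

  discriminant : QuadraticForm → Carrier
  discriminant f =
    4 ×ℕ (a₀₀ * a₁₁ * a₂₂) + a₀₁ * a₀₂ * a₁₂
      - a₀₀ * (a₁₂ * a₁₂) - a₁₁ * (a₀₂ * a₀₂) - a₂₂ * (a₀₁ * a₀₁)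
    where
    a₀₀ = f 0F
    a₀₁ = f 1F
    a₀₂ = f 2F
    a₁₁ = f 3F
    a₁₂ = f 4F
    a₂₂ = f 5F

  CubicSurface : Vector QuadraticForm 4 → Pred (Vector Carrier 4) ℓ₁
  CubicSurface f x = discriminant (linearCombination x f) ≈ 0#

{-# OPTIONS --safe #-}

-- Choose a basis M of L and a basis w of the web W; write M_m and w_x for the matrix and the
-- form with coordinates m ∈ F² and x ∈ F⁴, and count vectors instead of points.  With
--
--   C = #{ x : Δ(w_x) = 0 },  I = #{ m : det M_m = 0 },
--
-- the theorem says C + q² = q³ + q I, because n points of a projective set amount to
-- (q − 1) n + 1 vectors and a matrix has rank at most 2 exactly when it is singular.
--
-- Double count the pairs (f , P) with f ∈ W singular at P ∈ F³.  The number σ f of singular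
-- points of f is 1 if Δ(f) ≠ 0, and otherwise q, q² or q³ according to whether f is not of
-- the form a ℓ², is a nonzero a ℓ², or is zero.  For fixed P the conditions on f are linear,
-- and a linear map between spaces of equal dimension has a kernel as large as that of its
-- transpose, so the f are equinumerous with the presentations of the matrices M_m as tangent
-- matrices P λᵗ + λ Pᵗ + μ P Pᵗ of the Veronese surface at P Pᵗ.
--
-- Let Φ M be the number of such presentations of M over all P, and ζ M the number of ℓ with
-- ℓᵗ M ℓ = 0.  If M is nonsingular then Φ M = 0 and ζ M = q².  If M ≠ 0 has a kernel vector k
-- then ζ M = Φ M + q: an isotropic ℓ off the line of k makes M vanish on the span of k and ℓ,
-- so M is tangent at P = k × ℓ.  Summing over m trades Φ for ζ, and Σ ζ M_m counts
-- the ℓ with ℓ² ∈ W, that is, the squares occurring in Σ σ f, which cancel.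
-- Characteristic 2 needs separate treatment only for ζ M = q² and for finding a singular point.

module Submission where

open import Defs
open import Algebra.Apartness.Bundles using (HeytingField; HeytingCommutativeRing)
import Algebra.Apartness.Properties.HeytingCommutativeRing as HCRProperties
open import Algebra.Bundles using (CommutativeRing)
import Algebra.Properties.AbelianGroup as AbelianGroupProperties
import Algebra.Properties.Group as GroupProperties
import Algebra.Properties.Ring as RingProperties
import Algebra.Properties.Semiring.Mult.TCOptimised as Mult
import Algebra.Properties.Semiring.Sum as SemiringSum
import Algebra.Solver.Ring as Solver
open import Algebra.Solver.Ring.AlmostCommutativeRing using (fromCommutativeRing; _-Raw-AlmostCommutative⟶_; Induced-equivalence)
open import Algebra.Structures using (IsCommutativeRing)
import Data.Bool.Base as Bool
open import Data.Fin using (#_)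
open import Data.Fin.Base as Fin using (Fin)
open import Data.Fin.Patterns using (0F; 1F; 2F; 3F; 4F; 5F; 6F; 9F)
import Data.Fin.Properties as Fin
open import Data.Integer.Base as Int using (ℤ; 0ℤ; 1ℤ)
import Data.Integer.Properties as Int
open import Data.List.Base as List using (List; map; cartesianProductWith)
open import Data.List.Membership.Propositional using (_∈_)
open import Data.List.Relation.Unary.Any as Any using (Any; here; there)
open import Data.Maybe.Base using (just; nothing; is-just)
open import Data.Nat.Base as ℕ using (ℕ; zero; suc)
import Data.Nat.Properties as ℕ
open import Data.Product.Base using (∃; ∃-syntax; Σ-syntax; _×_; _,_; proj₁; proj₂)
open import Data.Sum.Base using (_⊎_; inj₁; inj₂)
open import Data.Unit.Base using (⊤; tt)
open import Data.Vec.Base as Vec using (Vec) renaming ([] to []ᵥ; _∷_ to _∷ᵥ_)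
open import Data.Vec.Functional as Vector using (Vector; removeAt; insertAt)
import Data.Vec.Functional.Properties as Vector
import Data.Vec.Functional.Relation.Binary.Equality.Setoid as VectorEquality
import Data.Vec.Functional.Relation.Binary.Pointwise.Properties as Pointwise
open import Function.Base using (_∘_; id)
open import Function.Bundles using (Inverse; Equivalence; _⇔_; mk⇔)
open import Level using (Level; _⊔_)
open import Relation.Binary.Bundles using (Setoid; DecSetoid)
open import Relation.Binary.Definitions using (WeaklyDecidable)
open import Relation.Binary.PropositionalEquality as ≡ using (_≡_; cong; cong₂; module ≡-Reasoning)
import Relation.Binary.Reasoning.Setoid as ≈-Reasoning
open import Relation.Nullary.Decidable using (Dec; yes; no; _×-dec_; ¬?; map′)
open import Relation.Nullary.Negation using (¬_; contradiction)
open import Relation.Unary using (Pred; Decidable; _∩_)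

-- Ring identities with integer coefficients

-- Let B be the number of ℓ with ℓ² ∈ W, D the sum of σ f over W and E the sum of ζ M_m over the
-- line. The counts then read D = q⁴ + (q - 1) C + (q² - q) B + (q³ - q²), D + q I + q² (q² - I) = E
-- + 2 q⁴ - q³, E = q⁴ + (q² - q) B, and eliminating E and B leaves (q - 1)(C + q²) = (q - 1)(q³ + q
-- I). B counts vectors ℓ, whereas σ sees forms a ℓ². The two counts agree in every characteristic
-- because each such form, zero included, has exactly q - 1 presentations (a , ℓ) with a ≠ 0, and W
-- is closed under scaling. Characteristic 2 shapes the argument: there quadratic forms cannot be
-- replaced by their polar matrices. They are only paired with symmetric matrices, and under this
-- pairing the transpose of taking value and gradient at P is the parametrization of the tangent
-- matrices at P. All counts are sums of indicators in ℤ, where differences are available and the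
-- factors q and q - 1 can be cancelled.

module RingSolver {c ℓ} (R : CommutativeRing c ℓ) where

  open import Data.Integer.Base using (+_; -[1+_])
  open CommutativeRing R
  open RingProperties ring using (-‿distribˡ-*; -‿distribʳ-*; -‿involutive; -0#≈0#)
  open AbelianGroupProperties +-abelianGroup using () renaming (⁻¹-∙-comm to -‿+-comm)
  open Mult semiring using (×-homo-+; ×1-homo-*; 1+×) renaming (_×_ to _×′_)
  open ≈-Reasoning setoid

  ⟦_⟧ᶻ : ℤ → Carrier
  ⟦ + n ⟧ᶻ      = n ×′ 1#
  ⟦ -[1+ n ] ⟧ᶻ = - (suc n ×′ 1#)

  private
    neg-homo : ∀ i → ⟦ Int.- i ⟧ᶻ ≈ - ⟦ i ⟧ᶻ
    neg-homo (+ zero)  = sym -0#≈0#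
    neg-homo (+ suc n) = refl
    neg-homo -[1+ n ]  = sym (-‿involutive _)

    cancel : ∀ x y z → (x + y) + - (x + z) ≈ y + - z
    cancel x y z = begin
      (x + y) + - (x + z)      ≈⟨ +-cong (+-comm x y) (sym (-‿+-comm x z)) ⟩
      (y + x) + (- x + - z)    ≈⟨ +-assoc y x _ ⟩
      y + (x + (- x + - z))    ≈⟨ +-congˡ (sym (+-assoc x (- x) (- z))) ⟩
      y + ((x + - x) + - z)    ≈⟨ +-congˡ (+-congʳ (-‿inverseʳ x)) ⟩
      y + (0# + - z)           ≈⟨ +-congˡ (+-identityˡ _) ⟩
      y + - z                  ∎

    ⊖-homo : ∀ m n → ⟦ m Int.⊖ n ⟧ᶻ ≈ m ×′ 1# + - (n ×′ 1#)
    ⊖-homo m       zero    = sym (trans (+-congˡ -0#≈0#) (+-identityʳ _))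
    ⊖-homo zero    (suc n) = sym (+-identityˡ _)
    ⊖-homo (suc m) (suc n) = begin
      ⟦ suc m Int.⊖ suc n ⟧ᶻ                  ≡⟨ cong ⟦_⟧ᶻ (Int.[1+m]⊖[1+n]≡m⊖n m n) ⟩
      ⟦ m Int.⊖ n ⟧ᶻ                          ≈⟨ ⊖-homo m n ⟩
      m ×′ 1# + - (n ×′ 1#)                 ≈⟨ cancel 1# _ _ ⟨
      (1# + m ×′ 1#) + - (1# + n ×′ 1#)     ≈⟨ +-cong (1+× m 1#) (-‿cong (1+× n 1#)) ⟨
      suc m ×′ 1# + - (suc n ×′ 1#)         ∎

    +-homo : ∀ i j → ⟦ i Int.+ j ⟧ᶻ ≈ ⟦ i ⟧ᶻ + ⟦ j ⟧ᶻ
    +-homo (+ m)    (+ n)    = ×-homo-+ 1# m n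
    +-homo (+ m)    -[1+ n ] = ⊖-homo m (suc n)
    +-homo -[1+ m ] (+ n)    = trans (⊖-homo n (suc m)) (+-comm _ _)
    +-homo -[1+ m ] -[1+ n ] = begin
      - (suc (suc (m ℕ.+ n)) ×′ 1#)           ≡⟨ cong (λ k → - (k ×′ 1#)) (ℕ-suc m n) ⟨
      - ((suc m ℕ.+ suc n) ×′ 1#)             ≈⟨ -‿cong (×-homo-+ 1# (suc m) (suc n)) ⟩
      - (suc m ×′ 1# + suc n ×′ 1#)           ≈⟨ -‿+-comm _ _ ⟨
      - (suc m ×′ 1#) + - (suc n ×′ 1#)       ∎
      where
      ℕ-suc : ∀ m n → suc m ℕ.+ suc n ≡ suc (suc (m ℕ.+ n))
      ℕ-suc zero    n = _≡_.refl
      ℕ-suc (suc m) n = cong suc (ℕ-suc m n)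

    *-homo : ∀ i j → ⟦ i Int.* j ⟧ᶻ ≈ ⟦ i ⟧ᶻ * ⟦ j ⟧ᶻ
    *-homo (+ m) (+ n) = begin
      ⟦ (+ m) Int.* (+ n) ⟧ᶻ   ≡⟨ cong ⟦_⟧ᶻ (Int.pos-* m n) ⟨
      (m ℕ.* n) ×′ 1#        ≈⟨ ×1-homo-* m n ⟩
      m ×′ 1# * n ×′ 1#      ∎
    *-homo (+ m) -[1+ n ] = begin
      ⟦ (+ m) Int.* -[1+ n ] ⟧ᶻ          ≡⟨ cong ⟦_⟧ᶻ (Int.neg-distribʳ-* (+ m) (+ suc n)) ⟨
      ⟦ Int.- ((+ m) Int.* (+ suc n)) ⟧ᶻ   ≈⟨ neg-homo ((+ m) Int.* (+ suc n)) ⟩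
      - ⟦ (+ m) Int.* (+ suc n) ⟧ᶻ       ≈⟨ -‿cong (*-homo (+ m) (+ suc n)) ⟩
      - (m ×′ 1# * suc n ×′ 1#)        ≈⟨ -‿distribʳ-* _ _ ⟩
      m ×′ 1# * - (suc n ×′ 1#)        ∎
    *-homo -[1+ m ] (+ n) = begin
      ⟦ -[1+ m ] Int.* (+ n) ⟧ᶻ          ≡⟨ cong ⟦_⟧ᶻ (Int.neg-distribˡ-* (+ suc m) (+ n)) ⟨
      ⟦ Int.- ((+ suc m) Int.* (+ n)) ⟧ᶻ   ≈⟨ neg-homo ((+ suc m) Int.* (+ n)) ⟩
      - ⟦ (+ suc m) Int.* (+ n) ⟧ᶻ       ≈⟨ -‿cong (*-homo (+ suc m) (+ n)) ⟩
      - (suc m ×′ 1# * n ×′ 1#)        ≈⟨ -‿distribˡ-* _ _ ⟩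
      - (suc m ×′ 1#) * n ×′ 1#        ∎
    *-homo -[1+ m ] -[1+ n ] = begin
      (suc m ℕ.* suc n) ×′ 1#                ≈⟨ ×1-homo-* (suc m) (suc n) ⟩
      suc m ×′ 1# * suc n ×′ 1#              ≈⟨ -‿involutive _ ⟨
      - - (suc m ×′ 1# * suc n ×′ 1#)        ≈⟨ -‿cong (-‿distribˡ-* _ _) ⟩
      - (- (suc m ×′ 1#) * suc n ×′ 1#)      ≈⟨ -‿distribʳ-* _ _ ⟩
      - (suc m ×′ 1#) * - (suc n ×′ 1#)      ∎

  private
    morphism : Int.+-*-rawRing -Raw-AlmostCommutative⟶ fromCommutativeRing R
    morphism = record
      { ⟦_⟧    = ⟦_⟧ᶻ
      ; +-homo = +-homo
      ; *-homo = *-homo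
      ; -‿homo = neg-homo
      ; 0-homo = refl
      ; 1-homo = refl
      }

    -- Only a positive answer carries information: in positive characteristic distinct integers may
    -- have equal images.
    _coeff≟_ : WeaklyDecidable (Induced-equivalence morphism)
    i coeff≟ j with i Int.≟ j
    ... | yes i≡j = just (reflexive (cong ⟦_⟧ᶻ i≡j))
    ... | no  _   = nothing

  module S = Solver Int.+-*-rawRing (fromCommutativeRing R) morphism _coeff≟_

  open S public using (Polynomial; con; var; _:+_; _:*_; _:-_; :-_; ⟦_⟧)

  -- Deciding the equality of the normal forms, rather than comparing their
  -- values by `refl`, keeps the conversion checker away from abstract terms.
  identity : ∀ {n} (ρ : Vec Carrier n) (e₁ e₂ : Polynomial n) →
             {_ : Bool.T (is-just (S.normalise e₁ S.≟N S.normalise e₂))} → ⟦ e₁ ⟧ ρ ≈ ⟦ e₂ ⟧ ρ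
  identity ρ e₁ e₂ with S.normalise e₁ S.≟N S.normalise e₂ | S.correct e₁ ρ | S.correct e₂ ρ
  ... | just eq | c₁ | c₂ = trans (sym c₁) (trans (S.⟦ eq ⟧N-cong ρ) c₂)

-- The ring of integers with operations that do not compute: otherwise
-- unification gets lost in signs and absolute values.
module Z where

  open import Data.Integer.Base using (+_)

  infixl 6 _+_ _-_
  infixl 7 _*_
  infix  8 -_

  opaque
    _+_ _*_ : ℤ → ℤ → ℤ
    _+_ = Int._+_
    _*_ = Int._*_

    -_ : ℤ → ℤ
    -_ = Int.-_

    isCommutativeRing : IsCommutativeRing _≡_ _+_ _*_ -_ 0ℤ 1ℤ
    isCommutativeRing = Int.+-*-isCommutativeRing

    +-mono-≤ : ∀ {i j k l} → i Int.≤ j → k Int.≤ l → i + k Int.≤ j + l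
    +-mono-≤ = Int.+-mono-≤

    1+i≰i : ∀ i → ¬ 1ℤ + i Int.≤ i
    1+i≰i i le = Int.<-irrefl ≡.refl (Int.suc[i]≤j⇒i<j le)

    pos-suc : ∀ n → 1ℤ + + n ≡ + suc n
    pos-suc n = ≡.refl

    pos-+ : ∀ m n → + (m ℕ.+ n) ≡ + m + + n
    pos-+ = Int.pos-+

    pos-* : ∀ m n → + (m ℕ.* n) ≡ + m * + n
    pos-* = Int.pos-*

    cancelˡ : ∀ {n} → 2 ℕ.≤ n → ∀ {i j} → + n * i ≡ + n * j → i ≡ j
    cancelˡ {suc n} _ {i} {j} = Int.*-cancelˡ-≡ (+ suc n) i j

    pred-cancelˡ : ∀ {n} → 2 ℕ.≤ n → ∀ {i j} → (+ n + - 1ℤ) * i ≡ (+ n + - 1ℤ) * j → i ≡ j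
    pred-cancelˡ {suc (suc n)} _ {i} {j} = Int.*-cancelˡ-≡ (+ suc n) i j
    pred-cancelˡ {suc zero} (ℕ.s≤s ())

  commutativeRing : CommutativeRing _ _
  commutativeRing = record { isCommutativeRing = isCommutativeRing }

  open CommutativeRing commutativeRing public
    using (+-assoc; +-comm; +-identityˡ; +-identityʳ; *-assoc; *-comm; *-identityˡ; *-identityʳ)
    renaming (distribˡ to *-distribˡ-+; zeroˡ to *-zeroˡ; zeroʳ to *-zeroʳ)
  open AbelianGroupProperties (CommutativeRing.+-abelianGroup commutativeRing) public using () renaming (∙-cancelʳ to +-cancelʳ)

  _-_ : ℤ → ℤ → ℤ
  i - j = i + - j

  infixr 8 _^_
  _^_ : ℤ → ℕ → ℤ
  i ^ zero  = 1ℤ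
  i ^ suc n = i * i ^ n

module ℤ-Solver = RingSolver Z.commutativeRing

-- Indicators and finite sums

module Summation where

  open import Data.List.Base using ([]; _∷_; _++_)
  open import Data.Integer.Base using (+_)

  module _ where
    private variable
      a b p r : Level
      A : Set a
      B : Set b
      P : Set p
      Q : Set r

    𝟙 : Dec P → ℤ
    𝟙 (yes _) = 1ℤ
    𝟙 (no  _) = 0ℤ

    𝟙-yes : (d : Dec P) → P → 𝟙 d ≡ 1ℤ
    𝟙-yes (yes _) _ = ≡.refl
    𝟙-yes (no ¬p) p = contradiction p ¬p

    𝟙-no : (d : Dec P) → ¬ P → 𝟙 d ≡ 0ℤ
    𝟙-no (yes p) ¬p = contradiction p ¬p
    𝟙-no (no  _) _  = ≡.refl

    𝟙-cong : (d : Dec P) (e : Dec Q) → (P → Q) → (Q → P) → 𝟙 d ≡ 𝟙 e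
    𝟙-cong (yes p) e f g = ≡.sym (𝟙-yes e (f p))
    𝟙-cong (no ¬p) e f g = ≡.sym (𝟙-no e (¬p ∘ g))

    𝟙-× : (d : Dec P) (e : Dec Q) → 𝟙 (d ×-dec e) ≡ 𝟙 d Z.* 𝟙 e
    𝟙-× (yes p) (yes q) = ≡.sym (Z.*-identityˡ 1ℤ)
    𝟙-× (yes p) (no ¬q) = ≡.sym (Z.*-identityˡ 0ℤ)
    𝟙-× (no ¬p) e       = ≡.sym (Z.*-zeroˡ (𝟙 e))

    𝟙-¬ : (d : Dec P) → 𝟙 (¬? d) ≡ 1ℤ Z.- 𝟙 d
    𝟙-¬ (yes _) = ℤ-Solver.identity []ᵥ (con 0ℤ) (con 1ℤ :- con 1ℤ)
      where open ℤ-Solver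
    𝟙-¬ (no  _) = ℤ-Solver.identity []ᵥ (con 1ℤ) (con 1ℤ :- con 0ℤ)
      where open ℤ-Solver

    𝟙-split : (d : Dec P) (e : Dec Q) → 𝟙 d ≡ 𝟙 (d ×-dec ¬? e) Z.+ 𝟙 (d ×-dec e)
    𝟙-split (yes _) (yes _) = ≡.sym (Z.+-identityˡ 1ℤ)
    𝟙-split (yes _) (no  _) = ≡.sym (Z.+-identityʳ 1ℤ)
    𝟙-split (no  _) e       = ≡.sym (Z.+-identityˡ 0ℤ)

    𝟙-exclusive : (d : Dec P) (e : Dec Q) → (P → ¬ Q) → 𝟙 d Z.+ 𝟙 e Int.≤ 1ℤ
    𝟙-exclusive (yes p) (yes q) ¬pq = contradiction q (¬pq p)
    𝟙-exclusive (yes p) (no ¬q) ¬pq = Int.≤-reflexive (Z.+-identityʳ 1ℤ)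
    𝟙-exclusive (no ¬p) (yes q) ¬pq = Int.≤-reflexive (Z.+-identityˡ 1ℤ)
    𝟙-exclusive (no ¬p) (no ¬q) ¬pq = Int.≤-trans (Int.≤-reflexive (Z.+-identityˡ 0ℤ)) (Int.+≤+ ℕ.z≤n)

    0≤𝟙 : (d : Dec P) → 0ℤ Int.≤ 𝟙 d
    0≤𝟙 (yes _) = Int.+≤+ ℕ.z≤n
    0≤𝟙 (no  _) = Int.≤-refl

    𝟙-⊎ : ∀ {s} {R : Set s} (d : Dec P) (e : Dec Q) (e′ : Dec R) → (P → Q ⊎ R) → 𝟙 d Int.≤ 𝟙 e Z.+ 𝟙 e′
    𝟙-⊎ (no _) e e′ f = Int.≤-trans (Int.≤-reflexive (≡.sym (Z.+-identityˡ 0ℤ))) (Z.+-mono-≤ (0≤𝟙 e) (0≤𝟙 e′))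
    𝟙-⊎ (yes p) e e′ f with f p
    ... | inj₁ x = Int.≤-trans (Int.≤-reflexive (≡.sym (Z.+-identityʳ 1ℤ))) (Z.+-mono-≤ (Int.≤-reflexive (≡.sym (𝟙-yes e x))) (0≤𝟙 e′))
    ... | inj₂ y = Int.≤-trans (Int.≤-reflexive (≡.sym (Z.+-identityˡ 1ℤ))) (Z.+-mono-≤ (0≤𝟙 e) (Int.≤-reflexive (≡.sym (𝟙-yes e′ y))))

    𝟙-*-cong : (d : Dec P) {x y : ℤ} → (P → x ≡ y) → 𝟙 d Z.* x ≡ 𝟙 d Z.* y
    𝟙-*-cong (yes p) f = cong (1ℤ Z.*_) (f p)
    𝟙-*-cong (no _)  {x} {y} f = ≡.trans (Z.*-zeroˡ x) (≡.sym (Z.*-zeroˡ y))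

    ∑ : List A → (A → ℤ) → ℤ
    ∑ []       g = 0ℤ
    ∑ (x ∷ xs) g = g x Z.+ ∑ xs g

    infix 5 ∑
    syntax ∑ xs (λ x → e) = ∑[ x ∈ xs ] e

    ∑-cong : (xs : List A) {g h : A → ℤ} → (∀ x → g x ≡ h x) → ∑ xs g ≡ ∑ xs h
    ∑-cong []       eq = ≡.refl
    ∑-cong (x ∷ xs) eq = cong₂ Z._+_ (eq x) (∑-cong xs eq)

    ∑-mono : (xs : List A) {g h : A → ℤ} → (∀ x → g x Int.≤ h x) → ∑ xs g Int.≤ ∑ xs h
    ∑-mono []       le = Int.≤-refl
    ∑-mono (x ∷ xs) le = Z.+-mono-≤ (le x) (∑-mono xs le)

    ∑-+ : (xs : List A) (g h : A → ℤ) → ∑[ x ∈ xs ] (g x Z.+ h x) ≡ ∑ xs g Z.+ ∑ xs h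
    ∑-+ []       g h = ≡.sym (Z.+-identityˡ 0ℤ)
    ∑-+ (x ∷ xs) g h = ≡.trans (cong (Z._+_ (g x Z.+ h x)) (∑-+ xs g h)) (interchange (g x) (h x) _ _)
      where
      interchange : ∀ a b c d → (a Z.+ b) Z.+ (c Z.+ d) ≡ (a Z.+ c) Z.+ (b Z.+ d)
      interchange a b c d = identity (a ∷ᵥ b ∷ᵥ c ∷ᵥ d ∷ᵥ []ᵥ)
        ((var 0F :+ var 1F) :+ (var 2F :+ var 3F)) ((var 0F :+ var 2F) :+ (var 1F :+ var 3F))
        where open ℤ-Solver

    ∑-*ˡ : (xs : List A) (k : ℤ) (g : A → ℤ) → ∑[ x ∈ xs ] (k Z.* g x) ≡ k Z.* ∑ xs g
    ∑-*ˡ []       k g = ≡.sym (Z.*-zeroʳ k)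
    ∑-*ˡ (x ∷ xs) k g = ≡.trans (cong (Z._+_ (k Z.* g x)) (∑-*ˡ xs k g)) (≡.sym (Z.*-distribˡ-+ k (g x) _))

    ∑-*ʳ : (xs : List A) (k : ℤ) (g : A → ℤ) → ∑[ x ∈ xs ] (g x Z.* k) ≡ ∑ xs g Z.* k
    ∑-*ʳ xs k g = begin
      ∑[ x ∈ xs ] (g x Z.* k)   ≡⟨ ∑-cong xs (λ x → Z.*-comm (g x) k) ⟩
      ∑[ x ∈ xs ] (k Z.* g x)   ≡⟨ ∑-*ˡ xs k g ⟩
      k Z.* ∑ xs g              ≡⟨ Z.*-comm k _ ⟩
      ∑ xs g Z.* k              ∎
      where open ≡-Reasoning

    ∑-0 : (xs : List A) → ∑[ x ∈ xs ] 0ℤ ≡ 0ℤ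
    ∑-0 []       = ≡.refl
    ∑-0 (x ∷ xs) = ≡.trans (Z.+-identityˡ _) (∑-0 xs)

    ∑-¬ : (xs : List A) {S : A → Set p} (d : ∀ x → Dec (S x)) → ∑[ x ∈ xs ] 𝟙 (¬? (d x)) ≡ (∑[ _ ∈ xs ] 1ℤ) Z.- (∑[ x ∈ xs ] 𝟙 (d x))
    ∑-¬ []       d = ℤ-Solver.identity []ᵥ (con 0ℤ) (con 0ℤ :- con 0ℤ)
      where open ℤ-Solver
    ∑-¬ (x ∷ xs) d = ≡.trans (cong₂ Z._+_ (𝟙-¬ (d x)) (∑-¬ xs d)) (rearrange (𝟙 (d x)) _ _)
      where
      rearrange : ∀ a b c → (1ℤ Z.- a) Z.+ (b Z.- c) ≡ (1ℤ Z.+ b) Z.- (a Z.+ c)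
      rearrange a b c = identity (a ∷ᵥ b ∷ᵥ c ∷ᵥ []ᵥ)
        ((con 1ℤ :- var 0F) :+ (var 1F :- var 2F)) ((con 1ℤ :+ var 1F) :- (var 0F :+ var 2F))
        where open ℤ-Solver

    ∑-swap : (xs : List A) (ys : List B) (g : A → B → ℤ) →
             ∑[ x ∈ xs ] ∑[ y ∈ ys ] g x y ≡ ∑[ y ∈ ys ] ∑[ x ∈ xs ] g x y
    ∑-swap []       ys g = ≡.sym (∑-0 ys)
    ∑-swap (x ∷ xs) ys g = ≡.trans (cong (Z._+_ (∑ ys (g x))) (∑-swap xs ys g)) (≡.sym (∑-+ ys _ _))

    ∑-++ : (xs ys : List A) (g : A → ℤ) → ∑ (xs ++ ys) g ≡ ∑ xs g Z.+ ∑ ys g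
    ∑-++ []       ys g = ≡.sym (Z.+-identityˡ _)
    ∑-++ (x ∷ xs) ys g = ≡.trans (cong (Z._+_ (g x)) (∑-++ xs ys g)) (≡.sym (Z.+-assoc (g x) _ _))

    ∑-map : (xs : List A) (f : A → B) (g : B → ℤ) → ∑ (map f xs) g ≡ ∑ xs (g ∘ f)
    ∑-map []       f g = ≡.refl
    ∑-map (x ∷ xs) f g = cong (Z._+_ (g (f x))) (∑-map xs f g)

    ∑-cartesianProductWith : ∀ {c} {C : Set c} (f : A → B → C) (xs : List A) (ys : List B) (g : C → ℤ) →
      ∑ (cartesianProductWith f xs ys) g ≡ ∑[ x ∈ xs ] ∑[ y ∈ ys ] g (f x y)
    ∑-cartesianProductWith f []       ys g = ≡.refl
    ∑-cartesianProductWith f (x ∷ xs) ys g = ≡.trans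
      (∑-++ (map (f x) ys) _ g)
      (cong₂ Z._+_ (∑-map ys (f x) g) (∑-cartesianProductWith f xs ys g))

  -- Completeness and absence of repetitions are merged into one equation between sums, which can be
  -- used as a rewriting rule inside larger sums.
  record Enumeration {a ℓ} (S : DecSetoid a ℓ) : Set (a ⊔ ℓ) where
    open DecSetoid S
    field
      elements : List Carrier
      once     : ∀ a → ∑[ x ∈ elements ] 𝟙 (x ≟ a) ≡ 1ℤ

    ∑-pick : ∀ {g : Carrier → ℤ} → (∀ {x y} → x ≈ y → g x ≡ g y) →
             ∀ a → ∑[ x ∈ elements ] (𝟙 (x ≟ a) Z.* g x) ≡ g a
    ∑-pick {g} g-cong a = begin
      ∑[ x ∈ elements ] (𝟙 (x ≟ a) Z.* g x)   ≡⟨ ∑-cong elements (λ x → 𝟙-*-cong (x ≟ a) g-cong) ⟩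
      ∑[ x ∈ elements ] (𝟙 (x ≟ a) Z.* g a)   ≡⟨ ∑-*ʳ elements (g a) _ ⟩
      (∑[ x ∈ elements ] 𝟙 (x ≟ a)) Z.* g a   ≡⟨ cong (Z._* g a) (once a) ⟩
      1ℤ Z.* g a                              ≡⟨ Z.*-identityˡ (g a) ⟩
      g a                                     ∎
      where open ≡-Reasoning

    private
      find : ∀ xs a → ¬ (∑[ x ∈ xs ] 𝟙 (x ≟ a) ≡ 0ℤ) → Any (_≈ a) xs
      find []       a ≢0 = contradiction ≡.refl ≢0
      find (x ∷ xs) a ≢0 with x ≟ a
      ... | yes x≈a = here x≈a
      ... | no  _   = there (find xs a (λ eq → ≢0 (≡.trans (Z.+-identityˡ _) eq)))

    complete : ∀ a → Any (_≈ a) elements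
    complete a = find elements a (λ eq → contradiction (≡.trans (≡.sym (once a)) eq) λ ())

    any? : ∀ {p} {P : Pred Carrier p} → (∀ {x y} → x ≈ y → P x → P y) → Decidable P → Dec (∃ P)
    any? {P = P} resp P? = map′ to from (Any.any? P? elements)
      where
      to : ∀ {xs} → Any P xs → ∃ P
      to = Any.satisfied
      from : ∃ P → Any P elements
      from (a , pa) = Any.map (λ x≈a → resp (sym x≈a) pa) (complete a)

  open Enumeration using (elements)

  module _ {a b ℓ₁ ℓ₂} {S : DecSetoid a ℓ₁} {T : DecSetoid b ℓ₂} (ES : Enumeration S) (ET : Enumeration T) where
    private
      module S = DecSetoid S
      module T = DecSetoid T

    -- Change of variables: each g (φ x) is expanded as a sum over T against the indicator of y ≈ φ
    -- x. After the exchange of sums the inner one counts the fibre of φ over y, which is a single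
    -- class where P holds and empty elsewhere.
    ∑-image : ∀ {p} {P : Pred T.Carrier p} (P? : Decidable P) (φ : S.Carrier → T.Carrier) →
      (∀ {x y} → φ x T.≈ φ y → x S.≈ y) → (∀ {x y} → x S.≈ y → φ x T.≈ φ y) →
      (∀ x → P (φ x)) → (∀ {y} → P y → ∃[ x ] y T.≈ φ x) → (∀ {y z} → y T.≈ z → P y → P z) →
      ∀ {g : T.Carrier → ℤ} → (∀ {x y} → x T.≈ y → g x ≡ g y) →
      ∑[ x ∈ elements ES ] g (φ x) ≡ ∑[ y ∈ elements ET ] (𝟙 (P? y) Z.* g y)
    ∑-image {P = P} P? φ φ-inj φ-cong P-φ P-inv P-resp {g} g-cong = begin
      ∑[ x ∈ xs ] g (φ x)                                    ≡⟨ ∑-cong xs (λ x → ≡.sym (Enumeration.∑-pick ET g-cong (φ x))) ⟩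
      ∑[ x ∈ xs ] ∑[ y ∈ ys ] (𝟙 (y T.≟ φ x) Z.* g y)        ≡⟨ ∑-swap xs ys _ ⟩
      ∑[ y ∈ ys ] ∑[ x ∈ xs ] (𝟙 (y T.≟ φ x) Z.* g y)        ≡⟨ ∑-cong ys (λ y → ∑-*ʳ xs (g y) _) ⟩
      ∑[ y ∈ ys ] ((∑[ x ∈ xs ] 𝟙 (y T.≟ φ x)) Z.* g y)      ≡⟨ ∑-cong ys (λ y → cong (Z._* g y) (fibre y (P? y))) ⟩
      ∑[ y ∈ ys ] (𝟙 (P? y) Z.* g y)                         ∎
      where
      open ≡-Reasoning
      xs = elements ES
      ys = elements ET
      fibre : ∀ y (d : Dec (P y)) → ∑[ x ∈ xs ] 𝟙 (y T.≟ φ x) ≡ 𝟙 d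
      fibre y (yes py) with x₀ , y≈φx₀ ← P-inv py = ≡.trans
        (∑-cong xs λ x → 𝟙-cong (y T.≟ φ x) (x S.≟ x₀)
          (λ y≈φx → φ-inj (T.trans (T.sym y≈φx) y≈φx₀))
          (λ x≈x₀ → T.trans y≈φx₀ (φ-cong (S.sym x≈x₀))))
        (Enumeration.once ES x₀)
      fibre y (no ¬py) = ≡.trans
        (∑-cong xs λ x → 𝟙-no (y T.≟ φ x) (λ y≈φx → ¬py (P-resp (T.sym y≈φx) (P-φ x))))
        (∑-0 xs)

  module _ {a ℓ} {S : DecSetoid a ℓ} (E : Enumeration S) where
    open DecSetoid S

    card : ℤ
    card = ∑[ _ ∈ elements E ] 1ℤ

    opaque
      -- Pigeonhole: the image counts as many elements as the whole set, so a missed element would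
      -- give 1 + `card` ≤ `card`. Membership in the image is decidable by search, which turns the
      -- refutation into a preimage.
      injective⇒surjective : (φ : Carrier → Carrier) → (∀ {x y} → φ x ≈ φ y → x ≈ y) →
        (∀ {x y} → x ≈ y → φ x ≈ φ y) → ∀ y → ∃[ x ] y ≈ φ x
      injective⇒surjective φ φ-inj φ-cong y₀ = by (image? y₀)
        where
        image? : Decidable (λ y → ∃[ x ] y ≈ φ x)
        image? y = Enumeration.any? E (λ x≈z y≈φx → trans y≈φx (φ-cong x≈z)) (λ x → y ≟ φ x)

        image-resp : ∀ {y z} → y ≈ z → (∃[ x ] y ≈ φ x) → ∃[ x ] z ≈ φ x
        image-resp y≈z (x , y≈φx) = x , trans (sym y≈z) y≈φx

        card≡ : card ≡ ∑[ y ∈ elements E ] 𝟙 (image? y)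
        card≡ = ≡.trans
          (∑-image E E image? φ φ-inj φ-cong (λ x → x , refl) id image-resp (λ _ → ≡.refl))
          (∑-cong (elements E) (λ y → Z.*-identityʳ (𝟙 (image? y))))

        by : Dec (∃[ x ] y₀ ≈ φ x) → ∃[ x ] y₀ ≈ φ x
        by (yes p) = p
        by (no ¬p) = contradiction 1+card≤card (Z.1+i≰i card)
          where
          open Int.≤-Reasoning
          1+card≤card : 1ℤ Z.+ card Int.≤ card
          1+card≤card = begin
            1ℤ Z.+ card                                                                  ≡⟨ cong₂ Z._+_ (≡.sym (Enumeration.once E y₀)) card≡ ⟩
            (∑[ y ∈ elements E ] 𝟙 (y ≟ y₀)) Z.+ (∑[ y ∈ elements E ] 𝟙 (image? y))      ≡⟨ ∑-+ (elements E) _ _ ⟨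
            ∑[ y ∈ elements E ] (𝟙 (y ≟ y₀) Z.+ 𝟙 (image? y))                           ≤⟨ ∑-mono (elements E) (λ y → 𝟙-exclusive (y ≟ y₀) (image? y) λ y≈y₀ im → ¬p (image-resp y≈y₀ im)) ⟩
            card                                                                         ∎

  opaque
    Fin-enumeration : ∀ n → Enumeration (Fin.≡-decSetoid n)
    Fin-enumeration n = record { elements = fins n ; once = once n }
      where
      fins : ∀ n → List (Fin n)
      fins zero    = []
      fins (suc n) = Fin.zero ∷ map Fin.suc (fins n)
      once : ∀ n (j : Fin n) → ∑[ i ∈ fins n ] 𝟙 (i Fin.≟ j) ≡ 1ℤ
      once (suc n) Fin.zero = ≡.trans (cong (Z._+_ 1ℤ) (begin
        ∑[ i ∈ map Fin.suc (fins n) ] 𝟙 (i Fin.≟ Fin.zero)   ≡⟨ ∑-map (fins n) Fin.suc _ ⟩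
        ∑[ i ∈ fins n ] 0ℤ                                   ≡⟨ ∑-0 (fins n) ⟩
        0ℤ                                                   ∎)) (Z.+-identityʳ 1ℤ)
        where open ≡-Reasoning
      once (suc n) (Fin.suc j) = begin
        0ℤ Z.+ (∑[ i ∈ map Fin.suc (fins n) ] 𝟙 (i Fin.≟ Fin.suc j))   ≡⟨ Z.+-identityˡ _ ⟩
        ∑[ i ∈ map Fin.suc (fins n) ] 𝟙 (i Fin.≟ Fin.suc j)            ≡⟨ ∑-map (fins n) Fin.suc _ ⟩
        ∑[ i ∈ fins n ] 𝟙 (Fin.suc i Fin.≟ Fin.suc j)                  ≡⟨ ∑-cong (fins n) (λ i → 𝟙-cong (Fin.suc i Fin.≟ Fin.suc j) (i Fin.≟ j) Fin.suc-injective (cong Fin.suc)) ⟩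
        ∑[ i ∈ fins n ] 𝟙 (i Fin.≟ j)                                  ≡⟨ once n j ⟩
        1ℤ                                                             ∎
        where open ≡-Reasoning

    Fin-card : ∀ n → card (Fin-enumeration n) ≡ + n
    Fin-card zero    = ≡.refl
    Fin-card (suc n) = ≡.trans (cong (Z._+_ 1ℤ) (≡.trans (∑-map (elements (Fin-enumeration n)) Fin.suc _) (Fin-card n))) (Z.pos-suc n)

  module FromSize {a ℓ n} {S : Setoid a ℓ} (size : HasSize S n) where
    open Setoid S using (_≈_; trans; sym)
    open Inverse size using (to; from; to-cong; inverseˡ; inverseʳ)

    to-injective : ∀ {x y} → to x ≡ to y → x ≈ y
    to-injective eq = trans (sym (inverseʳ ≡.refl)) (inverseʳ eq)

    infix 4 _≟_
    opaque
      _≟_ : (x y : Setoid.Carrier S) → Dec (x ≈ y)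
      x ≟ y = map′ to-injective to-cong (to x Fin.≟ to y)

    decSetoid : DecSetoid a ℓ
    decSetoid = record { isDecEquivalence = record { isEquivalence = Setoid.isEquivalence S ; _≟_ = _≟_ } }

    opaque
      enumeration : Enumeration decSetoid
      enumeration = record { elements = map from fins ; once = once }
        where
        fins : List (Fin n)
        fins = elements (Fin-enumeration n)
        once : ∀ x → ∑[ y ∈ map from fins ] 𝟙 (y ≟ x) ≡ 1ℤ
        once x = begin
          ∑[ y ∈ map from fins ] 𝟙 (y ≟ x)   ≡⟨ ∑-map fins from _ ⟩
          ∑[ i ∈ fins ] 𝟙 (from i ≟ x)       ≡⟨ ∑-cong fins (λ i → 𝟙-cong (from i ≟ x) (i Fin.≟ to x) (λ eq → ≡.sym (inverseˡ (sym eq))) (λ eq → inverseʳ eq)) ⟩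
          ∑[ i ∈ fins ] 𝟙 (i Fin.≟ to x)     ≡⟨ Enumeration.once (Fin-enumeration n) (to x) ⟩
          1ℤ                                 ∎
          where open ≡-Reasoning

      card≡ : card enumeration ≡ + n
      card≡ = ≡.trans (∑-map (elements (Fin-enumeration n)) from _) (Fin-card n)

  module _ {a ℓ} {S : DecSetoid a ℓ} (E : Enumeration S) where
    open DecSetoid S

    ∑-reindex : (φ ψ : Carrier → Carrier) → (∀ {x y} → x ≈ y → φ x ≈ φ y) → (∀ {x y} → x ≈ y → ψ x ≈ ψ y) →
      (∀ x → ψ (φ x) ≈ x) → (∀ y → φ (ψ y) ≈ y) → {g : Carrier → ℤ} → (∀ {x y} → x ≈ y → g x ≡ g y) →
      ∑[ x ∈ elements E ] g (φ x) ≡ ∑ (elements E) g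
    ∑-reindex φ ψ φ-cong ψ-cong ψφ φψ {g} g-cong = ≡.trans
      (∑-image E E {P = λ _ → ⊤} (λ _ → yes tt) φ
        (λ {x} {y} eq → trans (sym (ψφ x)) (trans (ψ-cong eq) (ψφ y)))
        φ-cong (λ _ → tt) (λ {y} _ → ψ y , sym (φψ y)) (λ _ _ → tt) g-cong)
      (∑-cong (elements E) (λ y → Z.*-identityˡ (g y)))

  module _ {a ℓ} (S : DecSetoid a ℓ) where
    open DecSetoid S

    -- The covering list may repeat classes; it is thinned to one representative per class. This
    -- gives projective sets a size before anything is known about its value.
    covered⇒HasSize : (xs : List Carrier) → (∀ y → Any (y ≈_) xs) → ∃[ n ] HasSize setoid n
    covered⇒HasSize xs cover = n , record
      { to        = λ y → proj₁ (index (cover y))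
      ; from      = g
      ; to-cong   = λ {x} {y} x≈y → g-injective (trans (sym (proj₂ (index (cover x)))) (trans x≈y (proj₂ (index (cover y)))))
      ; from-cong = λ { ≡.refl → refl }
      ; inverse   = (λ {i} {y} y≈gi → g-injective (trans (sym (proj₂ (index (cover y)))) y≈gi))
                  , (λ { {y} ≡.refl → sym (proj₂ (index (cover y))) })
      }
      where
      deduplicate : ∀ xs → ∃[ n ] Σ[ g ∈ (Fin n → Carrier) ] (∀ {i j : Fin n} → g i ≈ g j → i ≡ j) × (∀ {y} → Any (y ≈_) xs → ∃[ i ] y ≈ g i)
      deduplicate []       = 0 , (λ ()) , (λ {i} → contradiction i λ ()) , λ ()
      deduplicate (x ∷ xs) with deduplicate xs
      ... | n , g , g-inj , cover with Fin.any? (λ i → x ≟ g i)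
      ...   | yes (i , x≈gi) = n , g , g-inj , λ { (here y≈x) → i , trans y≈x x≈gi ; (there y∈) → cover y∈ }
      ...   | no  ∄i         = suc n , g′ , g′-inj , cover′
        where
        g′ : Fin (suc n) → Carrier
        g′ Fin.zero    = x
        g′ (Fin.suc i) = g i
        g′-inj : ∀ {i j} → g′ i ≈ g′ j → i ≡ j
        g′-inj {Fin.zero}  {Fin.zero}  _  = ≡.refl
        g′-inj {Fin.zero}  {Fin.suc j} eq = contradiction (j , eq) ∄i
        g′-inj {Fin.suc i} {Fin.zero}  eq = contradiction (i , sym eq) ∄i
        g′-inj {Fin.suc i} {Fin.suc j} eq = cong Fin.suc (g-inj eq)
        cover′ : ∀ {y} → Any (y ≈_) (x ∷ xs) → ∃[ i ] y ≈ g′ i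
        cover′ (here y≈x) = Fin.zero , y≈x
        cover′ (there y∈) with i , eq ← cover y∈ = Fin.suc i , eq
      n = proj₁ (deduplicate xs)
      g = proj₁ (proj₂ (deduplicate xs))
      g-injective = proj₁ (proj₂ (proj₂ (deduplicate xs)))
      index = proj₂ (proj₂ (proj₂ (deduplicate xs)))

open Summation
open Enumeration using (elements)

-- Ternary forms and symmetric 3 × 3 matrices

-- Over raw operations, so that each formula can be evaluated both in the field
-- and in the polynomial expressions of the ring solver.
module Forms {a} {A : Set a} (_+_ _*_ : A → A → A) (-_ : A → A) (0# : A) where

  open import Data.Vec.Functional using ([]; _∷_)

  dot : ∀ {n} → Vector A n → Vector A n → A
  dot u v = Vector.foldr _+_ 0# (λ i → u i * v i)

  cross : Vector A 3 → Vector A 3 → Vector A 3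
  cross u v =
    ((u 1F * v 2F) + (- (u 2F * v 1F))) ∷
    ((u 2F * v 0F) + (- (u 0F * v 2F))) ∷
    ((u 0F * v 1F) + (- (u 1F * v 0F))) ∷ []

  row : Vector A 6 → Fin 3 → Vector A 3
  row M 0F = M 0F ∷ M 1F ∷ M 2F ∷ []
  row M 1F = M 1F ∷ M 3F ∷ M 4F ∷ []
  row M 2F = M 2F ∷ M 4F ∷ M 5F ∷ []

  app : Vector A 6 → Vector A 3 → Vector A 3
  app M u = dot (row M 0F) u ∷ dot (row M 1F) u ∷ dot (row M 2F) u ∷ []

  bil : Vector A 6 → Vector A 3 → Vector A 3 → A
  bil M u v = dot (app M u) v

  quad : Vector A 6 → Vector A 3 → A
  quad M u = bil M u u

  det : Vector A 6 → A
  det M = dot (row M 0F) (cross (row M 1F) (row M 2F))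

  -- The symmetric matrix P λᵗ + λ Pᵗ + μ P Pᵗ, a general element of the
  -- tangent plane of the Veronese surface at P Pᵗ.
  tangent : Vector A 3 → Vector A 3 → A → Vector A 6
  tangent P λ′ μ = entry 0F 0F ∷ entry 0F 1F ∷ entry 0F 2F ∷ entry 1F 1F ∷ entry 1F 2F ∷ entry 2F 2F ∷ []
    where
    entry : Fin 3 → Fin 3 → A
    entry i j = ((P i * λ′ j) + (λ′ i * P j)) + (μ * (P i * P j))

  -- The quadratic form (ℓ · X)².
  square : Vector A 3 → Vector A 6
  square ℓ =
    (ℓ 0F * ℓ 0F) ∷ ((ℓ 0F * ℓ 1F) + (ℓ 0F * ℓ 1F)) ∷ ((ℓ 0F * ℓ 2F) + (ℓ 0F * ℓ 2F)) ∷
    (ℓ 1F * ℓ 1F) ∷ ((ℓ 1F * ℓ 2F) + (ℓ 1F * ℓ 2F)) ∷ (ℓ 2F * ℓ 2F) ∷ []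

  eval : Vector A 6 → Vector A 3 → A
  eval f P =
    (((f 0F * (P 0F * P 0F)) + (f 1F * (P 0F * P 1F))) + (f 2F * (P 0F * P 2F))) +
    (((f 3F * (P 1F * P 1F)) + (f 4F * (P 1F * P 2F))) + (f 5F * (P 2F * P 2F)))

  polar : Vector A 6 → Vector A 6
  polar f = (f 0F + f 0F) ∷ f 1F ∷ f 2F ∷ (f 3F + f 3F) ∷ f 4F ∷ (f 5F + f 5F) ∷ []

  grad : Vector A 6 → Vector A 3 → Vector A 3
  grad f P = app (polar f) P

  disc : Vector A 6 → A
  disc f = ((((quadruple ((f 0F * f 3F) * f 5F)) + ((f 1F * f 2F) * f 4F)) + (- (f 0F * (f 4F * f 4F))))
      + (- (f 3F * (f 2F * f 2F)))) + (- (f 5F * (f 1F * f 1F)))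
    where
    -- This is the unfolding of `4 ×ℕ x`, so that over the field `disc` and `discriminant` agree by
    -- computation.
    quadruple : A → A
    quadruple x = x + (x + (x + (x + 0#)))

-- Linear algebra and counting of vectors over a finite field

module FiniteField {f ℓ₁ ℓ₂} (F : HeytingField f ℓ₁ ℓ₂) {q : ℕ} (size : HasSize (ProjectiveGeometry.scalars F) q) where

  open import Data.Vec.Functional public using ([]; _∷_; head; tail)
  open import Data.Integer.Base public using (+_)
  open ProjectiveGeometry F public
  open HeytingField F using (_#_; #⇒invertible; tight; heytingCommutativeRing)
  open HCRProperties heytingCommutativeRing using (1#0; x-0≈x; invertibleʳ⇒#)

  R : CommutativeRing f ℓ₁
  R = HeytingCommutativeRing.commutativeRing heytingCommutativeRing

  open CommutativeRing R public
  open RingProperties ring public using (-1*x≈-x; -0#≈0#; -‿involutive; -‿distribˡ-*)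
  open SemiringSum semiring public using (sum; sum-cong-≋; *-distribˡ-sum; *-distribʳ-sum; sum-remove)
    renaming (∑-distrib-+ to sum-distrib-+; ∑-comm to sum-comm; sum-replicate-zero to sum-zero)
  open VectorEquality setoid public using (_≋_; ≋-refl; ≋-sym; ≋-trans)
  module Ring-Solver = RingSolver R

  𝔽-decSetoid : DecSetoid f ℓ₁
  𝔽-decSetoid = FromSize.decSetoid size

  infix 4 _≟_ _≟ᵛ_
  _≟_ : (x y : Carrier) → Dec (x ≈ y)
  _≟_ = DecSetoid._≟_ 𝔽-decSetoid

  𝔽-enumeration : Enumeration 𝔽-decSetoid
  𝔽-enumeration = FromSize.enumeration size

  𝔽 : List Carrier
  𝔽 = elements 𝔽-enumeration

  -- Opaque so that integer expressions in Q do not compute.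
  opaque
    Q : ℤ
    Q = + q

    Q≡+q : Q ≡ + q
    Q≡+q = ≡.refl

    ∑-1 : ∑[ _ ∈ 𝔽 ] 1ℤ ≡ Q
    ∑-1 = FromSize.card≡ size

  x≈y⇒x-y≈0 : ∀ {x y} → x ≈ y → x - y ≈ 0#
  x≈y⇒x-y≈0 {x} {y} x≈y = trans (+-congʳ x≈y) (-‿inverseʳ y)

  x-y≈0⇒x≈y : ∀ {x y} → x - y ≈ 0# → x ≈ y
  x-y≈0⇒x≈y {x} {y} eq = trans (sym eq′) (trans (+-congʳ eq) (+-identityˡ y))
    where
    open Ring-Solver
    eq′ : (x - y) + y ≈ x
    eq′ = identity (x ∷ᵥ y ∷ᵥ []ᵥ) ((var 0F :+ (:- var 1F)) :+ var 1F) (var 0F)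

  0≉1 : ¬ 0# ≈ 1#
  0≉1 0≈1 = HeytingField.#-irrefl F (sym 0≈1) 1#0

  inverse⇒# : ∀ {x y} → x * y ≈ 1# → x # 0#
  inverse⇒# {x} {y} eq = invertibleʳ⇒# (y , trans (*-congʳ (x-0≈x x)) eq)

  inverse-cancel : ∀ {x x⁻¹} → x * x⁻¹ ≈ 1# → ∀ y → x⁻¹ * (x * y) ≈ y
  inverse-cancel {x} {x⁻¹} eq y = begin
    x⁻¹ * (x * y)  ≈⟨ *-assoc x⁻¹ x y ⟨
    (x⁻¹ * x) * y  ≈⟨ *-congʳ (trans (*-comm x⁻¹ x) eq) ⟩
    1# * y         ≈⟨ *-identityˡ y ⟩
    y              ∎
    where open ≈-Reasoning setoid

  opaque
    -- Multiplication by x ≉ 0 is injective because the apartness is tight, so it hits 1.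
    inverse : ∀ {x} → ¬ x ≈ 0# → ∃[ y ] x * y ≈ 1#
    inverse {x} x≉0 with injective⇒surjective 𝔽-enumeration (x *_) injective *-congˡ 1#
      where
      injective : ∀ {y z} → x * y ≈ x * z → y ≈ z
      injective {y} {z} xy≈xz = proj₁ (tight y z) λ y#z → x≉0 (x≈0 (#⇒invertible y#z))
        where
        x≈0 : (∃[ w ] w * (y - z) ≈ 1# × (y - z) * w ≈ 1#) → x ≈ 0#
        x≈0 (w , _ , eq) = begin
          x                       ≈⟨ *-identityʳ x ⟨
          x * 1#                  ≈⟨ *-congˡ eq ⟨
          x * ((y - z) * w)       ≈⟨ identity (x ∷ᵥ y ∷ᵥ z ∷ᵥ w ∷ᵥ []ᵥ)
                                       (var 0F :* ((var 1F :- var 2F) :* var 3F))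
                                       ((var 0F :* var 1F :- var 0F :* var 2F) :* var 3F) ⟩
          (x * y - x * z) * w     ≈⟨ *-congʳ (x≈y⇒x-y≈0 xy≈xz) ⟩
          0# * w                  ≈⟨ zeroˡ w ⟩
          0#                      ∎
          where
          open ≈-Reasoning setoid
          open Ring-Solver
    ... | y , eq = y , sym eq

  ≉⇒# : ∀ {x} → ¬ x ≈ 0# → x # 0#
  ≉⇒# x≉0 = inverse⇒# (proj₂ (inverse x≉0))

  #⇒≉ : ∀ {x} → x # 0# → ¬ x ≈ 0#
  #⇒≉ x#0 x≈0 = HeytingField.#-irrefl F x≈0 x#0

  xy≈0⇒y≈0 : ∀ {x y} → ¬ x ≈ 0# → x * y ≈ 0# → y ≈ 0#
  xy≈0⇒y≈0 {x} {y} x≉0 xy≈0 with x⁻¹ , eq ← inverse x≉0 =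
    trans (sym (inverse-cancel eq y)) (trans (*-congˡ xy≈0) (zeroʳ x⁻¹))

  xy≉0 : ∀ {x y} → ¬ x ≈ 0# → ¬ y ≈ 0# → ¬ x * y ≈ 0#
  xy≉0 x≉0 y≉0 xy≈0 = y≉0 (xy≈0⇒y≈0 x≉0 xy≈0)

  *-cancelˡ : ∀ {x y z} → ¬ x ≈ 0# → x * y ≈ x * z → y ≈ z
  *-cancelˡ {x} {y} {z} x≉0 eq with x⁻¹ , xx⁻¹≈1 ← inverse x≉0 =
    trans (sym (inverse-cancel xx⁻¹≈1 y)) (trans (*-congˡ eq) (inverse-cancel xx⁻¹≈1 z))

  xx≈0⇒x≈0 : ∀ {x} → x * x ≈ 0# → x ≈ 0#
  xx≈0⇒x≈0 {x} eq with x ≟ 0#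
  ... | yes x≈0 = x≈0
  ... | no  x≉0 = xy≈0⇒y≈0 x≉0 eq

  2≤q : 2 ℕ.≤ q
  2≤q = by q (Inverse.to size 0#) (Inverse.to size 1#) λ eq → 0≉1 (FromSize.to-injective size eq)
    where
    by : ∀ n (i j : Fin n) → ¬ i ≡ j → 2 ℕ.≤ n
    by (suc zero)    Fin.zero Fin.zero i≢j = contradiction ≡.refl i≢j
    by (suc (suc n)) _        _        _   = ℕ.s≤s (ℕ.s≤s ℕ.z≤n)

  𝕍-decSetoid : ℕ → DecSetoid f ℓ₁
  𝕍-decSetoid = Pointwise.decSetoid 𝔽-decSetoid

  _≟ᵛ_ : ∀ {n} (v w : Vector Carrier n) → Dec (v ≋ w)
  _≟ᵛ_ {n} = DecSetoid._≟_ (𝕍-decSetoid n)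

  opaque
    𝕍-enumeration : ∀ n → Enumeration (𝕍-decSetoid n)
    𝕍-enumeration n = record { elements = vs n ; once = once n }
      where
      vs : ∀ n → List (Vector Carrier n)
      vs zero    = List.[ [] ]
      vs (suc n) = cartesianProductWith _∷_ 𝔽 (vs n)
      once : ∀ n (w : Vector Carrier n) → ∑[ v ∈ vs n ] 𝟙 (v ≟ᵛ w) ≡ 1ℤ
      once zero    w = ≡.trans (Z.+-identityʳ _) (𝟙-yes ([] ≟ᵛ w) λ ())
      once (suc n) w = begin
        ∑[ v ∈ vs (suc n) ] 𝟙 (v ≟ᵛ w)                                     ≡⟨ ∑-cartesianProductWith _∷_ 𝔽 (vs n) _ ⟩
        ∑[ x ∈ 𝔽 ] ∑[ v ∈ vs n ] 𝟙 ((x ∷ v) ≟ᵛ w)                          ≡⟨ ∑-cong 𝔽 (λ x → ∑-cong (vs n) λ v → split x v) ⟩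
        ∑[ x ∈ 𝔽 ] ∑[ v ∈ vs n ] (𝟙 (x ≟ head w) Z.* 𝟙 (v ≟ᵛ tail w))      ≡⟨ ∑-cong 𝔽 (λ x → ∑-*ˡ (vs n) (𝟙 (x ≟ head w)) _) ⟩
        ∑[ x ∈ 𝔽 ] (𝟙 (x ≟ head w) Z.* (∑[ v ∈ vs n ] 𝟙 (v ≟ᵛ tail w)))    ≡⟨ ∑-*ʳ 𝔽 _ _ ⟩
        (∑[ x ∈ 𝔽 ] 𝟙 (x ≟ head w)) Z.* (∑[ v ∈ vs n ] 𝟙 (v ≟ᵛ tail w))    ≡⟨ cong₂ Z._*_ (Enumeration.once 𝔽-enumeration (head w)) (once n (tail w)) ⟩
        1ℤ Z.* 1ℤ                                                          ≡⟨ Z.*-identityˡ 1ℤ ⟩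
        1ℤ                                                                 ∎
        where
        open ≡-Reasoning
        split : ∀ x v → 𝟙 ((x ∷ v) ≟ᵛ w) ≡ 𝟙 (x ≟ head w) Z.* 𝟙 (v ≟ᵛ tail w)
        split x v = ≡.trans
          (𝟙-cong ((x ∷ v) ≟ᵛ w) ((x ≟ head w) ×-dec (v ≟ᵛ tail w))
            (λ eq → eq Fin.zero , λ i → eq (Fin.suc i))
            (λ { (x≈ , v≋) Fin.zero → x≈ ; (x≈ , v≋) (Fin.suc i) → v≋ i }))
          (𝟙-× (x ≟ head w) (v ≟ᵛ tail w))

  𝕍 : ∀ n → List (Vector Carrier n)
  𝕍 n = elements (𝕍-enumeration n)

  opaque
    unfolding 𝕍-enumeration

    ∑-empty : (g : Vector Carrier 0 → ℤ) → ∑ (𝕍 0) g ≡ g []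
    ∑-empty g = Z.+-identityʳ (g [])

    ∑-suc : ∀ n (g : Vector Carrier (suc n) → ℤ) → ∑ (𝕍 (suc n)) g ≡ ∑[ x ∈ 𝔽 ] ∑[ v ∈ 𝕍 n ] g (x ∷ v)
    ∑-suc n g = ∑-cartesianProductWith _∷_ 𝔽 (𝕍 n) g

    ∑ᵛ-1 : ∀ n → ∑[ _ ∈ 𝕍 n ] 1ℤ ≡ Q Z.^ n
    ∑ᵛ-1 zero    = Z.+-identityʳ 1ℤ
    ∑ᵛ-1 (suc n) = begin
      ∑[ _ ∈ 𝕍 (suc n) ] 1ℤ            ≡⟨ ∑-suc n _ ⟩
      ∑[ _ ∈ 𝔽 ] ∑[ _ ∈ 𝕍 n ] 1ℤ       ≡⟨ ∑-cong 𝔽 (λ _ → ≡.trans (∑ᵛ-1 n) (≡.sym (Z.*-identityˡ _))) ⟩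
      ∑[ _ ∈ 𝔽 ] (1ℤ Z.* Q Z.^ n)      ≡⟨ ∑-*ʳ 𝔽 (Q Z.^ n) _ ⟩
      (∑[ _ ∈ 𝔽 ] 1ℤ) Z.* Q Z.^ n      ≡⟨ cong (Z._* Q Z.^ n) ∑-1 ⟩
      Q Z.* Q Z.^ n                    ∎
      where open ≡-Reasoning

  any𝔽? : ∀ {p} {P : Pred Carrier p} → (∀ {x y} → x ≈ y → P x → P y) → Decidable P → Dec (∃ P)
  any𝔽? = Enumeration.any? 𝔽-enumeration

  any𝕍? : ∀ {n p} {P : Pred (Vector Carrier n) p} → (∀ {x y} → x ≋ y → P x → P y) → Decidable P → Dec (∃ P)
  any𝕍? {n} = Enumeration.any? (𝕍-enumeration n)

  infixl 6 _+ᵥ_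
  _+ᵥ_ : ∀ {n} → Vector Carrier n → Vector Carrier n → Vector Carrier n
  (v +ᵥ w) i = v i + w i

  dot : ∀ {n} → Vector Carrier n → Vector Carrier n → Carrier
  dot u v = sum (λ i → u i * v i)

  dot-cong : ∀ {n} {u u′ v v′ : Vector Carrier n} → u ≋ u′ → v ≋ v′ → dot u v ≈ dot u′ v′
  dot-cong u≋ v≋ = sum-cong-≋ λ i → *-cong (u≋ i) (v≋ i)

  dot-comm : ∀ {n} (u v : Vector Carrier n) → dot u v ≈ dot v u
  dot-comm u v = sum-cong-≋ λ i → *-comm (u i) (v i)

  dot-+ʳ : ∀ {n} (u v w : Vector Carrier n) → dot u (v +ᵥ w) ≈ dot u v + dot u w
  dot-+ʳ u v w = trans (sum-cong-≋ λ i → distribˡ (u i) (v i) (w i)) (sum-distrib-+ (λ i → u i * v i) (λ i → u i * w i))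

  dot-*ʳ : ∀ {n} (u : Vector Carrier n) a (v : Vector Carrier n) → dot u (a *ᵥ v) ≈ a * dot u v
  dot-*ʳ u a v = trans (sum-cong-≋ λ i → swap (u i) (v i)) (sym (*-distribˡ-sum a (λ i → u i * v i)))
    where
    open Ring-Solver
    swap : ∀ x y → x * (a * y) ≈ a * (x * y)
    swap x y = identity (x ∷ᵥ a ∷ᵥ y ∷ᵥ []ᵥ) (var 0F :* (var 1F :* var 2F)) (var 1F :* (var 0F :* var 2F))

  dot-0ʳ : ∀ {n} (u : Vector Carrier n) → dot u 0ᵥ ≈ 0#
  dot-0ʳ {n} u = trans (sum-cong-≋ λ i → zeroʳ (u i)) (sum-zero n)

  opaque
    -- The reciprocal of the first nonzero coordinate of u, placed at that coordinate. Later
    -- arguments on nonzero vectors use this v instead of singling out a coordinate.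
    dual : ∀ {n} {u : Vector Carrier n} → ¬ u ≋ 0ᵥ → ∃[ v ] dot u v ≈ 1#
    dual {zero}  {u} u≉0 = contradiction (λ ()) u≉0
    dual {suc n} {u} u≉0 with head u ≟ 0#
    ... | no u₀≉0 with u₀⁻¹ , eq ← inverse u₀≉0 =
      (u₀⁻¹ ∷ 0ᵥ) , trans (+-cong eq (dot-0ʳ (tail u))) (+-identityʳ 1#)
    ... | yes u₀≈0 with v , eq ← dual {u = tail u} (λ u≋0 → u≉0 λ { Fin.zero → u₀≈0 ; (Fin.suc i) → u≋0 i }) =
      (0# ∷ v) , trans (+-cong (zeroʳ (head u)) eq) (+-identityˡ 1#)

  ∑-translate : ∀ {n} (u : Vector Carrier n) {g : Vector Carrier n → ℤ} → (∀ {v w} → v ≋ w → g v ≡ g w) →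
    ∑[ v ∈ 𝕍 n ] g (v +ᵥ u) ≡ ∑ (𝕍 n) g
  ∑-translate {n} u = ∑-reindex (𝕍-enumeration n) (_+ᵥ u) (λ v i → v i - u i)
    (λ v≋w i → +-congʳ (v≋w i)) (λ v≋w i → +-congʳ (v≋w i))
    (λ v i → identity (v i ∷ᵥ u i ∷ᵥ []ᵥ) ((var 0F :+ var 1F) :- var 1F) (var 0F))
    (λ v i → identity (v i ∷ᵥ u i ∷ᵥ []ᵥ) ((var 0F :- var 1F) :+ var 1F) (var 0F))
    where open Ring-Solver

  -- The sum is invariant under each of the q translations by a multiple of u. Counting becomes
  -- counting along the lines of direction u, without choosing a representative of each line.
  ∑-average : ∀ {n} (u : Vector Carrier n) {g : Vector Carrier n → ℤ} → (∀ {v w} → v ≋ w → g v ≡ g w) →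
    Q Z.* ∑ (𝕍 n) g ≡ ∑[ v ∈ 𝕍 n ] ∑[ s ∈ 𝔽 ] g (v +ᵥ s *ᵥ u)
  ∑-average {n} u {g} g-cong = begin
    Q Z.* ∑ (𝕍 n) g                              ≡⟨ cong (Z._* ∑ (𝕍 n) g) ∑-1 ⟨
    (∑[ _ ∈ 𝔽 ] 1ℤ) Z.* ∑ (𝕍 n) g                ≡⟨ ∑-*ʳ 𝔽 (∑ (𝕍 n) g) _ ⟨
    ∑[ s ∈ 𝔽 ] (1ℤ Z.* ∑ (𝕍 n) g)                ≡⟨ ∑-cong 𝔽 (λ s → ≡.trans (Z.*-identityˡ _) (≡.sym (∑-translate (s *ᵥ u) g-cong))) ⟩
    ∑[ s ∈ 𝔽 ] ∑[ v ∈ 𝕍 n ] g (v +ᵥ s *ᵥ u)      ≡⟨ ∑-swap 𝔽 (𝕍 n) _ ⟩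
    ∑[ v ∈ 𝕍 n ] ∑[ s ∈ 𝔽 ] g (v +ᵥ s *ᵥ u)      ∎
    where open ≡-Reasoning

  -- For u ≠ 0 a direction e with u · e = 1 shifts u · v by s along v + s e, so each such line
  -- carries exactly one zero. The factor q on the left avoids the exponent n - 1 and allows one
  -- formula for all u.
  ∑-linear : ∀ {n} (u : Vector Carrier n) →
    Q Z.* (∑[ v ∈ 𝕍 n ] 𝟙 (dot u v ≟ 0#)) ≡ Q Z.^ n Z.+ (Q Z.* Q Z.^ n Z.- Q Z.^ n) Z.* 𝟙 (u ≟ᵛ 0ᵥ)
  ∑-linear {n} u with u ≟ᵛ 0ᵥ
  ... | yes u≋0 = begin
    Q Z.* (∑[ v ∈ 𝕍 n ] 𝟙 (dot u v ≟ 0#))        ≡⟨ cong (Q Z.*_) (∑-cong (𝕍 n) λ v → 𝟙-yes (dot u v ≟ 0#) (u·v≈0 v)) ⟩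
    Q Z.* (∑[ v ∈ 𝕍 n ] 1ℤ)                      ≡⟨ cong (Q Z.*_) (∑ᵛ-1 n) ⟩
    Q Z.* Q Z.^ n                                ≡⟨ identity (Q Z.* Q Z.^ n ∷ᵥ Q Z.^ n ∷ᵥ []ᵥ) (var 0F) (var 1F :+ (var 0F :- var 1F) :* con 1ℤ) ⟩
    Q Z.^ n Z.+ (Q Z.* Q Z.^ n Z.- Q Z.^ n) Z.* 1ℤ  ∎
    where
    open ≡-Reasoning
    open ℤ-Solver
    u·v≈0 : ∀ v → dot u v ≈ 0#
    u·v≈0 v = trans (dot-cong u≋0 (≋-refl {x = v})) (trans (dot-comm 0ᵥ v) (dot-0ʳ v))
  ... | no u≉0 with e , u·e≈1 ← dual u≉0 = begin
    Q Z.* (∑[ v ∈ 𝕍 n ] 𝟙 (dot u v ≟ 0#))                       ≡⟨ ∑-average e (λ {v} {w} v≋w → 𝟙-cong (dot u v ≟ 0#) (dot u w ≟ 0#)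
                                                                      (trans (dot-cong (≋-refl {x = u}) (≋-sym v≋w))) (trans (dot-cong (≋-refl {x = u}) v≋w))) ⟩
    ∑[ v ∈ 𝕍 n ] ∑[ s ∈ 𝔽 ] 𝟙 (dot u (v +ᵥ s *ᵥ e) ≟ 0#)        ≡⟨ ∑-cong (𝕍 n) (λ v → ∑-cong 𝔽 λ s → solution v s) ⟩
    ∑[ v ∈ 𝕍 n ] ∑[ s ∈ 𝔽 ] 𝟙 (s ≟ - dot u v)                   ≡⟨ ∑-cong (𝕍 n) (λ v → Enumeration.once 𝔽-enumeration (- dot u v)) ⟩
    ∑[ v ∈ 𝕍 n ] 1ℤ                                             ≡⟨ ∑ᵛ-1 n ⟩
    Q Z.^ n                                                     ≡⟨ ZS.identity (Q Z.* Q Z.^ n ∷ᵥ Q Z.^ n ∷ᵥ []ᵥ) (ZS.var 1F) (ZS.var 1F ZS.:+ (ZS.var 0F ZS.:- ZS.var 1F) ZS.:* ZS.con 0ℤ) ⟩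
    Q Z.^ n Z.+ (Q Z.* Q Z.^ n Z.- Q Z.^ n) Z.* 0ℤ              ∎
    where
    open ≡-Reasoning
    module ZS = ℤ-Solver
    along : ∀ v s → dot u (v +ᵥ s *ᵥ e) ≈ dot u v + s
    along v s = trans (dot-+ʳ u v (s *ᵥ e)) (+-congˡ (trans (dot-*ʳ u s e) (trans (*-congˡ u·e≈1) (*-identityʳ s))))
    solution : ∀ v s → 𝟙 (dot u (v +ᵥ s *ᵥ e) ≟ 0#) ≡ 𝟙 (s ≟ - dot u v)
    solution v s = 𝟙-cong _ _
      (λ eq → x-y≈0⇒x≈y (trans (+-congˡ (-‿involutive _)) (trans (+-comm s _) (trans (sym (along v s)) eq))))
      (λ eq → trans (along v s) (trans (+-congˡ eq) (-‿inverseʳ _)))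

  cancel-Q-1 : ∀ x y → (Q Z.- 1ℤ) Z.* x ≡ (Q Z.- 1ℤ) Z.* y → x ≡ y
  cancel-Q-1 x y = ≡.subst (λ z → (z Z.- 1ℤ) Z.* x ≡ (z Z.- 1ℤ) Z.* y → x ≡ y) (≡.sym Q≡+q) (Z.pred-cancelˡ 2≤q)

  cancel-Q : ∀ x y → Q Z.* x ≡ Q Z.* y → x ≡ y
  cancel-Q x y = ≡.subst (λ z → z Z.* x ≡ z Z.* y → x ≡ y) (≡.sym Q≡+q) (Z.cancelˡ 2≤q)

  -- Count the pairs (x , y) with α x · y ≈ 0 in both orders.
  ∑-adjoint-kernels : ∀ {m n} (α : Vector Carrier n → Vector Carrier m) (γ : Vector Carrier m → Vector Carrier n) →
    (∀ x y → dot (α x) y ≈ dot x (γ y)) →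
    Q Z.^ m Z.* (∑[ x ∈ 𝕍 n ] 𝟙 (α x ≟ᵛ 0ᵥ)) ≡ Q Z.^ n Z.* (∑[ y ∈ 𝕍 m ] 𝟙 (γ y ≟ᵛ 0ᵥ))
  ∑-adjoint-kernels {m} {n} α γ adjoint = cancel-Q-1 _ _ (begin
    (Q Z.- 1ℤ) Z.* (Q Z.^ m Z.* A)                             ≡⟨ shape (Q Z.^ m) (Q Z.^ n) A ⟩
    total m n A Z.- Q Z.^ m Z.* Q Z.^ n                        ≡⟨ cong₂ Z._-_ (≡.trans (≡.sym count-x) count-y) (Z.*-comm (Q Z.^ m) (Q Z.^ n)) ⟩
    total n m B Z.- Q Z.^ n Z.* Q Z.^ m                        ≡⟨ shape (Q Z.^ n) (Q Z.^ m) B ⟨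
    (Q Z.- 1ℤ) Z.* (Q Z.^ n Z.* B)                             ∎)
    where
    open ≡-Reasoning
    A = ∑[ x ∈ 𝕍 n ] 𝟙 (α x ≟ᵛ 0ᵥ)
    B = ∑[ y ∈ 𝕍 m ] 𝟙 (γ y ≟ᵛ 0ᵥ)
    total : ℕ → ℕ → ℤ → ℤ
    total m n X = Q Z.^ m Z.* Q Z.^ n Z.+ (Q Z.* Q Z.^ m Z.- Q Z.^ m) Z.* X
    shape : ∀ a b X → (Q Z.- 1ℤ) Z.* (a Z.* X) ≡ (a Z.* b Z.+ (Q Z.* a Z.- a) Z.* X) Z.- a Z.* b
    shape a b X = identity (Q ∷ᵥ a ∷ᵥ b ∷ᵥ X ∷ᵥ []ᵥ) ((var 0F :- con 1ℤ) :* (var 1F :* var 3F))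
      ((var 1F :* var 2F :+ (var 0F :* var 1F :- var 1F) :* var 3F) :- var 1F :* var 2F)
      where open ℤ-Solver
    summed : ∀ {m n} (κ : Vector Carrier n → Vector Carrier m) →
      ∑[ x ∈ 𝕍 n ] (Q Z.* (∑[ y ∈ 𝕍 m ] 𝟙 (dot (κ x) y ≟ 0#))) ≡ total m n (∑[ x ∈ 𝕍 n ] 𝟙 (κ x ≟ᵛ 0ᵥ))
    summed {m} {n} κ = begin
      ∑[ x ∈ 𝕍 n ] (Q Z.* (∑[ y ∈ 𝕍 m ] 𝟙 (dot (κ x) y ≟ 0#)))
        ≡⟨ ∑-cong (𝕍 n) (λ x → ≡.trans (∑-linear (κ x)) (cong (Z._+ (Q Z.* Q Z.^ m Z.- Q Z.^ m) Z.* 𝟙 (κ x ≟ᵛ 0ᵥ)) (≡.sym (Z.*-identityʳ (Q Z.^ m))))) ⟩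
      ∑[ x ∈ 𝕍 n ] (Q Z.^ m Z.* 1ℤ Z.+ (Q Z.* Q Z.^ m Z.- Q Z.^ m) Z.* 𝟙 (κ x ≟ᵛ 0ᵥ))
        ≡⟨ ∑-+ (𝕍 n) _ _ ⟩
      (∑[ x ∈ 𝕍 n ] (Q Z.^ m Z.* 1ℤ)) Z.+ (∑[ x ∈ 𝕍 n ] ((Q Z.* Q Z.^ m Z.- Q Z.^ m) Z.* 𝟙 (κ x ≟ᵛ 0ᵥ)))
        ≡⟨ cong₂ Z._+_ (≡.trans (∑-*ˡ (𝕍 n) (Q Z.^ m) _) (cong (Q Z.^ m Z.*_) (∑ᵛ-1 n))) (∑-*ˡ (𝕍 n) _ _) ⟩
      total m n (∑[ x ∈ 𝕍 n ] 𝟙 (κ x ≟ᵛ 0ᵥ))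
        ∎
    pairs = ∑[ x ∈ 𝕍 n ] ∑[ y ∈ 𝕍 m ] 𝟙 (dot (α x) y ≟ 0#)
    count-x : Q Z.* pairs ≡ total m n A
    count-x = ≡.trans (≡.sym (∑-*ˡ (𝕍 n) Q _)) (summed α)
    swapped : pairs ≡ ∑[ y ∈ 𝕍 m ] ∑[ x ∈ 𝕍 n ] 𝟙 (dot (γ y) x ≟ 0#)
    swapped = ≡.trans (∑-swap (𝕍 n) (𝕍 m) _) (∑-cong (𝕍 m) λ y → ∑-cong (𝕍 n) λ x →
      let eq = trans (adjoint x y) (dot-comm x (γ y)) in
      𝟙-cong (dot (α x) y ≟ 0#) (dot (γ y) x ≟ 0#) (trans (sym eq)) (trans eq))
    count-y : Q Z.* pairs ≡ total n m B
    count-y = ≡.trans (cong (Q Z.*_) swapped) (≡.trans (≡.sym (∑-*ˡ (𝕍 m) Q _)) (summed γ))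

  lc-cong : ∀ {k n} (b : Vector (Vector Carrier n) k) {a a′} → a ≋ a′ → linearCombination a b ≋ linearCombination a′ b
  lc-cong b a≋a′ j = sum-cong-≋ λ i → *-congʳ (a≋a′ i)

  -- linearCombination a b j is definitionally dot a (λ i → b i j).
  lc-- : ∀ {k n} (b : Vector (Vector Carrier n) k) a a′ → ∀ j →
    linearCombination (λ i → a i - a′ i) b j ≈ linearCombination a b j - linearCombination a′ b j
  lc-- b a a′ j = begin
    dot (λ i → a i - a′ i) bⱼ                    ≈⟨ dot-comm (λ i → a i - a′ i) bⱼ ⟩
    dot bⱼ (λ i → a i - a′ i)                    ≈⟨ dot-+ʳ bⱼ a (λ i → - a′ i) ⟩
    dot bⱼ a + dot bⱼ (λ i → - a′ i)             ≈⟨ +-congˡ (dot-cong (≋-refl {x = bⱼ}) (λ i → sym (-1*x≈-x (a′ i)))) ⟩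
    dot bⱼ a + dot bⱼ (- 1# *ᵥ a′)               ≈⟨ +-cong (dot-comm bⱼ a) (trans (dot-*ʳ bⱼ (- 1#) a′) (trans (-1*x≈-x (dot bⱼ a′)) (-‿cong (dot-comm bⱼ a′)))) ⟩
    dot a bⱼ - dot a′ bⱼ                         ∎
    where
    open ≈-Reasoning setoid
    bⱼ = λ i → b i j

  lc-injective : ∀ {k n} {b : Vector (Vector Carrier n) k} → LinearlyIndependent b →
    ∀ {a a′} → linearCombination a b ≋ linearCombination a′ b → a ≋ a′
  lc-injective {b = b} independent {a} {a′} eq i = x-y≈0⇒x≈y
    (independent (λ i → a i - a′ i) (λ j → trans (lc-- b a a′ j) (x≈y⇒x-y≈0 (eq j))) i)

  Span? : ∀ {k n} (b : Vector (Vector Carrier n) k) → Decidable (Span b)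
  Span? b v = any𝕍? (λ a≋a′ v≋ → ≋-trans v≋ (lc-cong b a≋a′)) (λ a → v ≟ᵛ linearCombination a b)

  module _ {k n p} (b : Vector (Vector Carrier n) k) {U : Pred (Vector Carrier n) p} (basis : IsBasis b U) where
    private
      module Eq v = Equivalence (proj₂ basis v)

    ∈-basis? : Decidable U
    ∈-basis? v = map′ (Eq.from v) (Eq.to v) (Span? b v)

    ∈-basis-resp : ∀ {v w} → v ≋ w → U v → U w
    ∈-basis-resp {v} {w} v≋w Uv with a , v≋ ← Eq.to v Uv = Eq.from w (a , ≋-trans (≋-sym v≋w) v≋)

    ∈-basis-lc : ∀ a → U (linearCombination a b)
    ∈-basis-lc a = Eq.from _ (a , ≋-refl)

    ∑-basis : ∀ {g : Vector Carrier n → ℤ} → (∀ {v w} → v ≋ w → g v ≡ g w) →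
      ∑[ a ∈ 𝕍 k ] g (linearCombination a b) ≡ ∑[ v ∈ 𝕍 n ] (𝟙 (∈-basis? v) Z.* g v)
    ∑-basis = ∑-image (𝕍-enumeration k) (𝕍-enumeration n) ∈-basis? (λ a → linearCombination a b)
      (lc-injective (proj₁ basis)) (lc-cong b) ∈-basis-lc (λ {v} → Eq.to v) ∈-basis-resp

  ∑-nonzero : ∑[ a ∈ 𝔽 ] 𝟙 (¬? (a ≟ 0#)) ≡ Q Z.- 1ℤ
  ∑-nonzero = ≡.trans (∑-¬ 𝔽 (_≟ 0#)) (cong₂ Z._-_ ∑-1 (Enumeration.once 𝔽-enumeration 0#))

  scalar-unique : ∀ {n} {w : Vector Carrier n} {a b} → ¬ w ≋ 0ᵥ → (a *ᵥ w) ≋ (b *ᵥ w) → a ≈ b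
  scalar-unique {w = w} {a} {b} w≉0 aw≋bw = let r , w·r≈1 = dual w≉0 in begin
    a                ≈⟨ scale a r w·r≈1 ⟨
    dot r (a *ᵥ w)   ≈⟨ dot-cong (≋-refl {x = r}) aw≋bw ⟩
    dot r (b *ᵥ w)   ≈⟨ scale b r w·r≈1 ⟩
    b                ∎
    where
    open ≈-Reasoning setoid
    scale : ∀ c r → dot w r ≈ 1# → dot r (c *ᵥ w) ≈ c
    scale c r w·r≈1 = trans (dot-*ʳ r c w) (trans (*-congˡ (trans (dot-comm r w) w·r≈1)) (*-identityʳ c))

  -- Sizes of projective sets

  module _ {d p} {P : Pred (Vector Carrier (suc d)) p} (P? : Decidable P)
    (P-resp : ∀ {v w} → v ≋ w → P v → P w) (P-0 : P 0ᵥ) (P-scale : ∀ a {v} → P v → P (a *ᵥ v)) where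

    private
      S = PG d P
      module S = Setoid S

      proportional? : (v w : Vector Carrier (suc d)) → Dec (Proportional v w)
      proportional? v w = map′
        (λ (a , a≉0 , eq) → a , ≉⇒# a≉0 , eq) (λ (a , a#0 , eq) → a , #⇒≉ a#0 , eq)
        (any𝔽? {P = λ a → ¬ a ≈ 0# × v ≋ (a *ᵥ w)}
          (λ a≈b (a≉0 , eq) → (λ b≈0 → a≉0 (trans a≈b b≈0)) , λ i → trans (eq i) (*-congʳ a≈b))
          (λ a → ¬? (a ≟ 0#) ×-dec (v ≟ᵛ (a *ᵥ w))))

      S-dec : DecSetoid _ _
      S-dec = record { isDecEquivalence = record
        { isEquivalence = S.isEquivalence
        ; _≟_           = λ x y → proportional? (proj₁ x) (proj₁ y) } }

      points : List (Vector Carrier (suc d)) → List S.Carrier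
      points List.[]       = List.[]
      points (v List.∷ vs) with ¬? (v ≟ᵛ 0ᵥ) ×-dec P? v
      ... | yes point = (v , point) List.∷ points vs
      ... | no  _     = points vs

      points-complete : ∀ x vs → Any (_≋ proj₁ x) vs → Any (x S.≈_) (points vs)
      points-complete x@(w , w≉0 , Pw) (v List.∷ vs) v∈ with ¬? (v ≟ᵛ 0ᵥ) ×-dec P? v | v∈
      ... | yes _  | here v≋w  = here (1# , ≉⇒# (0≉1 ∘ sym) , λ i → trans (sym (v≋w i)) (sym (*-identityˡ (v i))))
      ... | yes _  | there v∈′ = there (points-complete x vs v∈′)
      ... | no ¬pt | here v≋w  = contradiction ((λ v≋0 → w≉0 (≋-trans (≋-sym v≋w) v≋0)) , P-resp (≋-sym v≋w) Pw) ¬pt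
      ... | no _   | there v∈′ = points-complete x vs v∈′

    opaque
     PG-size : ∃[ N ] HasSize (PG d P) N
     PG-size = covered⇒HasSize S-dec (points (𝕍 (suc d)))
      (λ x → points-complete x (𝕍 (suc d)) (Enumeration.complete (𝕍-enumeration (suc d)) (proj₁ x)))

    -- Each nonzero vector satisfying P is a multiple, by exactly one a ≠ 0, of exactly one chosen
    -- representative. This makes q - 1 vectors for each point, and the zero vector adds 1.
    PG-count : ∀ {N} → HasSize (PG d P) N → ∑[ v ∈ 𝕍 (suc d) ] 𝟙 (P? v) ≡ (Q Z.- 1ℤ) Z.* + N Z.+ 1ℤ
    PG-count {N} PG≅N = begin
      ∑[ v ∈ Vs ] 𝟙 (P? v)
        ≡⟨ ∑-cong Vs pointwise ⟩
      ∑[ v ∈ Vs ] ((∑[ i ∈ Is ] ∑[ a ∈ 𝔽 ] 𝟙 (multiple? v i a)) Z.+ 𝟙 (v ≟ᵛ 0ᵥ))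
        ≡⟨ ∑-+ Vs _ _ ⟩
      (∑[ v ∈ Vs ] ∑[ i ∈ Is ] ∑[ a ∈ 𝔽 ] 𝟙 (multiple? v i a)) Z.+ (∑[ v ∈ Vs ] 𝟙 (v ≟ᵛ 0ᵥ))
        ≡⟨ cong₂ Z._+_ (∑-swap Vs Is _) (Enumeration.once (𝕍-enumeration (suc d)) 0ᵥ) ⟩
      (∑[ i ∈ Is ] ∑[ v ∈ Vs ] ∑[ a ∈ 𝔽 ] 𝟙 (multiple? v i a)) Z.+ 1ℤ
        ≡⟨ cong (Z._+ 1ℤ) (∑-cong Is multiples) ⟩
      (∑[ i ∈ Is ] (Q Z.- 1ℤ)) Z.+ 1ℤ
        ≡⟨ cong (Z._+ 1ℤ) (∑-cong Is (λ _ → Z.*-identityʳ (Q Z.- 1ℤ))) ⟨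
      (∑[ i ∈ Is ] ((Q Z.- 1ℤ) Z.* 1ℤ)) Z.+ 1ℤ
        ≡⟨ cong (Z._+ 1ℤ) (≡.trans (∑-*ˡ Is (Q Z.- 1ℤ) _) (cong (Z._*_ (Q Z.- 1ℤ)) (Fin-card N))) ⟩
      (Q Z.- 1ℤ) Z.* + N Z.+ 1ℤ
        ∎
      where
      open ≡-Reasoning
      open Inverse PG≅N using (to; from; inverseˡ; inverseʳ)
      Vs = 𝕍 (suc d)
      Is = elements (Fin-enumeration N)
      rep : Fin N → Vector Carrier (suc d)
      rep i = proj₁ (from i)
      multiple? : ∀ v i a → Dec (¬ a ≈ 0# × v ≋ (a *ᵥ rep i))
      multiple? v i a = ¬? (a ≟ 0#) ×-dec (v ≟ᵛ (a *ᵥ rep i))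

      multiples : ∀ i → ∑[ v ∈ Vs ] ∑[ a ∈ 𝔽 ] 𝟙 (multiple? v i a) ≡ Q Z.- 1ℤ
      multiples i = begin
        ∑[ v ∈ Vs ] ∑[ a ∈ 𝔽 ] 𝟙 (multiple? v i a)                                    ≡⟨ ∑-swap Vs 𝔽 _ ⟩
        ∑[ a ∈ 𝔽 ] ∑[ v ∈ Vs ] 𝟙 (multiple? v i a)                                    ≡⟨ ∑-cong 𝔽 (λ a → ∑-cong Vs λ v → 𝟙-× (¬? (a ≟ 0#)) (v ≟ᵛ (a *ᵥ rep i))) ⟩
        ∑[ a ∈ 𝔽 ] ∑[ v ∈ Vs ] (𝟙 (¬? (a ≟ 0#)) Z.* 𝟙 (v ≟ᵛ (a *ᵥ rep i)))            ≡⟨ ∑-cong 𝔽 (λ a → ≡.trans (∑-*ˡ Vs (𝟙 (¬? (a ≟ 0#))) _)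
                                                                                           (≡.trans (cong (Z._*_ (𝟙 (¬? (a ≟ 0#)))) (Enumeration.once (𝕍-enumeration (suc d)) (a *ᵥ rep i))) (Z.*-identityʳ _))) ⟩
        ∑[ a ∈ 𝔽 ] 𝟙 (¬? (a ≟ 0#))                                                    ≡⟨ ∑-nonzero ⟩
        Q Z.- 1ℤ                                                                      ∎

      none : ∀ v → (∀ i a → ¬ (¬ a ≈ 0# × v ≋ (a *ᵥ rep i))) → ∑[ i ∈ Is ] ∑[ a ∈ 𝔽 ] 𝟙 (multiple? v i a) ≡ 0ℤ
      none v ∄ = ≡.trans (∑-cong Is λ i → ≡.trans (∑-cong 𝔽 λ a → 𝟙-no (multiple? v i a) (∄ i a)) (∑-0 𝔽)) (∑-0 Is)

      unique : ∀ x i₀ → Proportional (proj₁ x) (rep i₀) → ∑[ i ∈ Is ] ∑[ a ∈ 𝔽 ] 𝟙 (multiple? (proj₁ x) i a) ≡ 1ℤ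
      unique x@(v , v≉0 , _) i₀ (a₀ , a₀#0 , v≋a₀w) = begin
        ∑[ i ∈ Is ] ∑[ a ∈ 𝔽 ] 𝟙 (multiple? v i a)                 ≡⟨ ∑-cong Is (λ i → ∑-cong 𝔽 λ a → split i a) ⟩
        ∑[ i ∈ Is ] ∑[ a ∈ 𝔽 ] (𝟙 (i Fin.≟ i₀) Z.* 𝟙 (a ≟ a₀))     ≡⟨ ∑-cong Is (λ i → ≡.trans (∑-*ˡ 𝔽 (𝟙 (i Fin.≟ i₀)) _)
                                                                       (≡.trans (cong (Z._*_ (𝟙 (i Fin.≟ i₀))) (Enumeration.once 𝔽-enumeration a₀)) (Z.*-identityʳ _))) ⟩
        ∑[ i ∈ Is ] 𝟙 (i Fin.≟ i₀)                                 ≡⟨ Enumeration.once (Fin-enumeration N) i₀ ⟩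
        1ℤ                                                         ∎
        where
        same : ∀ a → v ≋ (a *ᵥ rep i₀) → a ≈ a₀
        same a v≋aw = scalar-unique (proj₁ (proj₂ (from i₀))) (≋-trans (≋-sym v≋aw) v≋a₀w)
        same-point : ∀ i a → ¬ a ≈ 0# → v ≋ (a *ᵥ rep i) → i ≡ i₀
        same-point i a a≉0 v≋aw = ≡.trans (≡.sym (inverseˡ {i} {x} (a , ≉⇒# a≉0 , v≋aw))) (inverseˡ {i₀} {x} (a₀ , a₀#0 , v≋a₀w))
        split : ∀ i a → 𝟙 (multiple? v i a) ≡ 𝟙 (i Fin.≟ i₀) Z.* 𝟙 (a ≟ a₀)
        split i a = ≡.trans (𝟙-cong (multiple? v i a) ((i Fin.≟ i₀) ×-dec (a ≟ a₀))
          (λ (a≉0 , v≋aw) → same-point i a a≉0 v≋aw , same a (≡.subst (λ j → v ≋ (a *ᵥ rep j)) (same-point i a a≉0 v≋aw) v≋aw))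
          (λ { (≡.refl , a≈a₀) → (λ a≈0 → #⇒≉ a₀#0 (trans (sym a≈a₀) a≈0)) , λ j → trans (v≋a₀w j) (*-congʳ (sym a≈a₀)) }))
          (𝟙-× (i Fin.≟ i₀) (a ≟ a₀))

      pointwise : ∀ v → 𝟙 (P? v) ≡ (∑[ i ∈ Is ] ∑[ a ∈ 𝔽 ] 𝟙 (multiple? v i a)) Z.+ 𝟙 (v ≟ᵛ 0ᵥ)
      pointwise v with P? v | v ≟ᵛ 0ᵥ
      ... | yes Pv | yes v≋0 = ≡.sym (≡.trans (cong (Z._+ 1ℤ) (none v λ i a (a≉0 , v≋aw) →
        proj₁ (proj₂ (from i)) (λ j → xy≈0⇒y≈0 a≉0 (trans (sym (v≋aw j)) (v≋0 j))))) (Z.+-identityˡ 1ℤ))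
      ... | yes Pv | no v≉0  = ≡.sym (≡.trans (Z.+-identityʳ _) (unique (v , v≉0 , Pv) (to (v , v≉0 , Pv))
        (S.sym {from (to (v , v≉0 , Pv))} {v , v≉0 , Pv} (inverseʳ {v , v≉0 , Pv} ≡.refl))))
      ... | no ¬Pv | yes v≋0 = contradiction (P-resp (≋-sym v≋0) P-0) ¬Pv
      ... | no ¬Pv | no v≉0  = ≡.sym (≡.trans (Z.+-identityʳ _) (none v λ i a (_ , v≋aw) →
        ¬Pv (P-resp (≋-sym v≋aw) (P-scale a (proj₂ (proj₂ (from i)))))))

    -- For the converse, `PG-size` supplies some size N′; the count holds for it as well, and
    -- cancelling q - 1 identifies N′ with N.
    PG-size⇔count : ∀ N → HasSize (PG d P) N ⇔ (∑[ v ∈ 𝕍 (suc d) ] 𝟙 (P? v) ≡ (Q Z.- 1ℤ) Z.* + N Z.+ 1ℤ)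
    PG-size⇔count N = mk⇔ PG-count from-count
      where
      from-count : ∑[ v ∈ 𝕍 (suc d) ] 𝟙 (P? v) ≡ (Q Z.- 1ℤ) Z.* + N Z.+ 1ℤ → HasSize (PG d P) N
      from-count eq with N′ , PG≅N′ ← PG-size = ≡.subst (HasSize (PG d P)) N′≡N PG≅N′
        where
        N′≡N : N′ ≡ N
        N′≡N = Int.+-injective (cancel-Q-1 _ _ (Z.+-cancelʳ 1ℤ _ _ (≡.trans (≡.sym (PG-count PG≅N′)) eq)))

  -- Identities for vectors, symmetric matrices and quadratic forms

  module _ where

    open Forms _+_ _*_ -_ 0# public hiding (dot)
    private
      module S = Ring-Solver
      open GroupProperties +-group using () renaming (∙-cancelˡ to +-cancelˡ)
      open S using (Polynomial; var; con; _:+_; _:*_; _:-_; :-_; identity)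
      module E {n} = Forms (S._:+_ {n}) S._:*_ S.:-_ (con 0ℤ)

      0ₑ : ∀ {n} → Polynomial n
      0ₑ = con 0ℤ

      -- The block of m variables at offset k, for environments in which `_⊕_` has concatenated the
      -- coordinates of several vectors.
      vars : ∀ k {m r} → Vector (Polynomial (k ℕ.+ (m ℕ.+ r))) m
      vars k {m} {r} i = var (k Fin.↑ʳ (i Fin.↑ˡ r))

      infixr 5 _⊕_
      _⊕_ : ∀ {m n} → Vector Carrier m → Vec Carrier n → Vec Carrier (m ℕ.+ n)
      u ⊕ ρ = Vec.tabulate u Vec.++ ρ

    ≋-ext₃ : {u v : Vector Carrier 3} → u 0F ≈ v 0F → u 1F ≈ v 1F → u 2F ≈ v 2F → u ≋ v
    ≋-ext₃ p₀ p₁ p₂ 0F = p₀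
    ≋-ext₃ p₀ p₁ p₂ 1F = p₁
    ≋-ext₃ p₀ p₁ p₂ 2F = p₂

    ≋-ext₆ : {u v : Vector Carrier 6} → u 0F ≈ v 0F → u 1F ≈ v 1F → u 2F ≈ v 2F →
      u 3F ≈ v 3F → u 4F ≈ v 4F → u 5F ≈ v 5F → u ≋ v
    ≋-ext₆ p₀ p₁ p₂ p₃ p₄ p₅ 0F = p₀
    ≋-ext₆ p₀ p₁ p₂ p₃ p₄ p₅ 1F = p₁
    ≋-ext₆ p₀ p₁ p₂ p₃ p₄ p₅ 2F = p₂
    ≋-ext₆ p₀ p₁ p₂ p₃ p₄ p₅ 3F = p₃
    ≋-ext₆ p₀ p₁ p₂ p₃ p₄ p₅ 4F = p₄
    ≋-ext₆ p₀ p₁ p₂ p₃ p₄ p₅ 5F = p₅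

    0+0≈0 : ∀ {x y} → x ≈ 0# → y ≈ 0# → x + y ≈ 0#
    0+0≈0 x≈0 y≈0 = trans (+-cong x≈0 y≈0) (+-identityˡ 0#)

    *0≈0 : ∀ x {y} → y ≈ 0# → x * y ≈ 0#
    *0≈0 x y≈0 = trans (*-congˡ y≈0) (zeroʳ x)

    0*≈0 : ∀ {x} y → x ≈ 0# → x * y ≈ 0#
    0*≈0 y x≈0 = trans (*-congʳ x≈0) (zeroˡ y)

    -0≈0 : ∀ {x} → x ≈ 0# → - x ≈ 0#
    -0≈0 x≈0 = trans (-‿cong x≈0) -0#≈0#

    dot-0 : ∀ {n} (u : Vector Carrier n) {v} → v ≋ 0ᵥ → dot u v ≈ 0#
    dot-0 u v≋0 = trans (dot-cong (≋-refl {x = u}) v≋0) (dot-0ʳ u)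

    dot-0′ : ∀ {n} {u : Vector Carrier n} v → u ≋ 0ᵥ → dot u v ≈ 0#
    dot-0′ {u = u} v u≋0 = trans (dot-comm u v) (dot-0 v u≋0)

    row-cong : ∀ {M N} → M ≋ N → ∀ i → row M i ≋ row N i
    row-cong eq 0F = ≋-ext₃ (eq 0F) (eq 1F) (eq 2F)
    row-cong eq 1F = ≋-ext₃ (eq 1F) (eq 3F) (eq 4F)
    row-cong eq 2F = ≋-ext₃ (eq 2F) (eq 4F) (eq 5F)

    app-cong : ∀ {M N u v} → M ≋ N → u ≋ v → app M u ≋ app N v
    app-cong {M} {N} {u} {v} eq u≋v = ≋-ext₃ (by 0F) (by 1F) (by 2F)
      where
      by : ∀ i → dot (row M i) u ≈ dot (row N i) v
      by i = dot-cong (row-cong {M} {N} eq i) u≋v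

    bil-cong : ∀ {M N u u′ v v′} → M ≋ N → u ≋ u′ → v ≋ v′ → bil M u v ≈ bil N u′ v′
    bil-cong {M} {N} {u} {u′} eq u≋u′ v≋v′ = dot-cong {u = app M u} {app N u′} (app-cong {M} {N} eq u≋u′) v≋v′

    quad-cong : ∀ {M N u v} → M ≋ N → u ≋ v → quad M u ≈ quad N v
    quad-cong {M} {N} eq u≋v = bil-cong {M} {N} eq u≋v u≋v

    cross-cong : ∀ {u u′ v v′} → u ≋ u′ → v ≋ v′ → cross u v ≋ cross u′ v′
    cross-cong p r = ≋-ext₃
      (+-cong (*-cong (p 1F) (r 2F)) (-‿cong (*-cong (p 2F) (r 1F))))
      (+-cong (*-cong (p 2F) (r 0F)) (-‿cong (*-cong (p 0F) (r 2F))))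
      (+-cong (*-cong (p 0F) (r 1F)) (-‿cong (*-cong (p 1F) (r 0F))))

    det-cong : ∀ {M N} → M ≋ N → det M ≈ det N
    det-cong {M} {N} eq = dot-cong {u = row M 0F} {row N 0F} (row-cong {M} {N} eq 0F)
      (cross-cong {row M 1F} {row N 1F} {row M 2F} {row N 2F} (row-cong {M} {N} eq 1F) (row-cong {M} {N} eq 2F))

    e₀ e₁ e₂ : Vector Carrier 3
    e₀ = 1# ∷ 0# ∷ 0# ∷ []
    e₁ = 0# ∷ 1# ∷ 0# ∷ []
    e₂ = 0# ∷ 0# ∷ 1# ∷ []

    private
      x₁ : ∀ {r} → Vector (Polynomial (3 ℕ.+ r)) 3
      x₁ = vars 0
      x₂ : ∀ {r} → Vector (Polynomial (6 ℕ.+ r)) 3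
      x₂ = vars 3
      x₃ : ∀ {r} → Vector (Polynomial (9 ℕ.+ r)) 3
      x₃ = vars 6
      x₄ : ∀ {r} → Vector (Polynomial (12 ℕ.+ r)) 3
      x₄ = vars 9
      x₅ : ∀ {r} → Vector (Polynomial (15 ℕ.+ r)) 3
      x₅ = vars 12
      y₁ : ∀ {r} → Vector (Polynomial (6 ℕ.+ r)) 6
      y₁ = vars 0
      y₂ : ∀ {r} → Vector (Polynomial (12 ℕ.+ r)) 6
      y₂ = vars 6

    opaque
      dot-crossˡ : ∀ u v → dot u (cross u v) ≈ 0#
      dot-crossˡ u v = identity (u ⊕ v ⊕ []ᵥ) (E.dot x₁ (E.cross x₁ x₂)) 0ₑ

      dot-crossʳ : ∀ u v → dot v (cross u v) ≈ 0#
      dot-crossʳ u v = identity (u ⊕ v ⊕ []ᵥ) (E.dot x₂ (E.cross x₁ x₂)) 0ₑ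

      cross-cross : ∀ u v w → cross u (cross v w) ≋ (λ i → dot u w * v i - dot u v * w i)
      cross-cross u v w = ≋-ext₃ (identity ρ (l 0F) (r 0F)) (identity ρ (l 1F) (r 1F)) (identity ρ (l 2F) (r 2F))
        where
        ρ : Vec Carrier 9
        ρ = u ⊕ v ⊕ w ⊕ []ᵥ
        l r : Vector (Polynomial 9) 3
        l = E.cross x₁ (E.cross x₂ x₃)
        r i = E.dot x₁ x₃ :* x₂ i :- E.dot x₁ x₂ :* x₃ i

      -- Expanding the double cross product gives (u · r) v = (v · r) u - r × (u × v), and the last
      -- term vanishes.
      parallel : ∀ u v r → dot u r ≈ 1# → cross u v ≋ 0ᵥ → v ≋ (dot v r *ᵥ u)
      parallel u v r u·r≈1 u×v≋0 = ≋-ext₃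
        (by 0F (identity ρ (lhs 0F) (rhs 0F)) zero₀)
        (by 1F (identity ρ (lhs 1F) (rhs 1F)) zero₁)
        (by 2F (identity ρ (lhs 2F) (rhs 2F)) zero₂)
        where
        ρ : Vec Carrier 9
        ρ = u ⊕ v ⊕ r ⊕ []ᵥ
        e : Vector Carrier 3
        e = cross r (cross u v)
        lhs rhs : Vector (Polynomial 9) 3
        lhs i = E.dot x₁ x₃ :* x₂ i
        rhs i = E.dot x₂ x₃ :* x₁ i :+ (:- E.cross x₃ (E.cross x₁ x₂) i)
        by : ∀ i → dot u r * v i ≈ dot v r * u i - e i → e i ≈ 0# → v i ≈ dot v r * u i
        by i eq e≈0 = begin
          v i                        ≈⟨ *-identityˡ (v i) ⟨
          1# * v i                   ≈⟨ *-congʳ u·r≈1 ⟨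
          dot u r * v i              ≈⟨ eq ⟩
          dot v r * u i - e i        ≈⟨ +-congˡ (-0≈0 e≈0) ⟩
          dot v r * u i + 0#         ≈⟨ +-identityʳ _ ⟩
          dot v r * u i              ∎
          where open ≈-Reasoning setoid
        zero₀ : e 0F ≈ 0#
        zero₀ = 0+0≈0 (*0≈0 (r 1F) (u×v≋0 2F)) (-0≈0 (*0≈0 (r 2F) (u×v≋0 1F)))
        zero₁ : e 1F ≈ 0#
        zero₁ = 0+0≈0 (*0≈0 (r 2F) (u×v≋0 0F)) (-0≈0 (*0≈0 (r 0F) (u×v≋0 2F)))
        zero₂ : e 2F ≈ 0#
        zero₂ = 0+0≈0 (*0≈0 (r 0F) (u×v≋0 1F)) (-0≈0 (*0≈0 (r 1F) (u×v≋0 0F)))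

      -- The multiple of v by the determinant of a, b, c is (v · a) b × c + (v · b) c × a + (v · c)
      -- a × b.
      orthogonal-to-basis : ∀ a b c v → dot a (cross b c) ≈ 1# → dot v a ≈ 0# → dot v b ≈ 0# → dot v c ≈ 0# → v ≋ 0ᵥ
      orthogonal-to-basis a b c v D≈1 v·a v·b v·c = ≋-ext₃
        (by 0F (identity ρ (lhs 0F) (rhs 0F))) (by 1F (identity ρ (lhs 1F) (rhs 1F))) (by 2F (identity ρ (lhs 2F) (rhs 2F)))
        where
        ρ : Vec Carrier 12
        ρ = a ⊕ b ⊕ c ⊕ v ⊕ []ᵥ
        lhs rhs : Vector (Polynomial 12) 3
        lhs i = E.dot x₁ (E.cross x₂ x₃) :* x₄ i
        rhs i = (E.dot x₄ x₁ :* E.cross x₂ x₃ i :+ E.dot x₄ x₂ :* E.cross x₃ x₁ i) :+ E.dot x₄ x₃ :* E.cross x₁ x₂ i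
        by : ∀ i → dot a (cross b c) * v i ≈ (dot v a * cross b c i + dot v b * cross c a i) + dot v c * cross a b i → v i ≈ 0#
        by i eq = trans (trans (sym (*-identityˡ (v i))) (trans (*-congʳ (sym D≈1)) eq))
          (0+0≈0 (0+0≈0 (0*≈0 _ v·a) (0*≈0 _ v·b)) (0*≈0 _ v·c))

      -- The cross products of pairs of rows are the rows of the adjugate of the symmetric matrix M,
      -- and adj(M) M k = det(M) k.
      det≉0⇒kernel≋0 : ∀ M k → ¬ det M ≈ 0# → app M k ≋ 0ᵥ → k ≋ 0ᵥ
      det≉0⇒kernel≋0 M k det≉0 Mk≋0 = ≋-ext₃
        (by 0F (cross (row M 1F) (row M 2F)) (identity ρ (E.det y₁ :* x₃ 0F) (E.dot (E.cross (E.row y₁ 1F) (E.row y₁ 2F)) (E.app y₁ x₃))))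
        (by 1F (cross (row M 2F) (row M 0F)) (identity ρ (E.det y₁ :* x₃ 1F) (E.dot (E.cross (E.row y₁ 2F) (E.row y₁ 0F)) (E.app y₁ x₃))))
        (by 2F (cross (row M 0F) (row M 1F)) (identity ρ (E.det y₁ :* x₃ 2F) (E.dot (E.cross (E.row y₁ 0F) (E.row y₁ 1F)) (E.app y₁ x₃))))
        where
        ρ : Vec Carrier 9
        ρ = M ⊕ k ⊕ []ᵥ
        by : ∀ i a → det M * k i ≈ dot a (app M k) → k i ≈ 0#
        by i a eq = xy≈0⇒y≈0 det≉0 (trans eq (dot-0 a Mk≋0))

    parallel-orthogonal : ∀ u v r w → dot u r ≈ 1# → cross u v ≋ 0ᵥ → dot u w ≈ 0# → dot v w ≈ 0#
    parallel-orthogonal u v r w u·r≈1 u×v≋0 u·w≈0 = begin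
      dot v w                   ≈⟨ dot-cong (parallel u v r u·r≈1 u×v≋0) (≋-refl {x = w}) ⟩
      dot (dot v r *ᵥ u) w      ≈⟨ dot-comm (dot v r *ᵥ u) w ⟩
      dot w (dot v r *ᵥ u)      ≈⟨ dot-*ʳ w (dot v r) u ⟩
      dot v r * dot w u         ≈⟨ *0≈0 (dot v r) (trans (dot-comm w u) u·w≈0) ⟩
      0#                        ∎
      where open ≈-Reasoning setoid

    orthogonal₁ : ∀ u → ∃[ w ] ¬ w ≋ 0ᵥ × dot u w ≈ 0#
    orthogonal₁ u = by (u 0F ≟ 0#)
      where
      by : Dec (u 0F ≈ 0#) → ∃[ w ] ¬ w ≋ 0ᵥ × dot u w ≈ 0#
      by (yes u₀≈0) = e₀ , (λ eq → 0≉1 (sym (eq 0F))) ,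
        0+0≈0 (0*≈0 1# u₀≈0) (0+0≈0 (zeroʳ (u 1F)) (0+0≈0 (zeroʳ (u 2F)) refl))
      by (no u₀≉0) = (- u 1F ∷ u 0F ∷ 0# ∷ []) , (λ eq → u₀≉0 (eq 1F)) ,
        identity (u ⊕ []ᵥ) (E.dot x₁ ((:- x₁ 1F) ∷ x₁ 0F ∷ 0ₑ ∷ [])) 0ₑ

    orthogonal₂ : ∀ u v → ∃[ w ] ¬ w ≋ 0ᵥ × dot u w ≈ 0# × dot v w ≈ 0#
    orthogonal₂ u v = by (cross u v ≟ᵛ 0ᵥ) (u ≟ᵛ 0ᵥ)
      where
      by : Dec (cross u v ≋ 0ᵥ) → Dec (u ≋ 0ᵥ) → ∃[ w ] ¬ w ≋ 0ᵥ × dot u w ≈ 0# × dot v w ≈ 0#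
      by (no u×v≉0) _ = cross u v , u×v≉0 , dot-crossˡ u v , dot-crossʳ u v
      by (yes u×v≋0) (yes u≋0) = let w , w≉0 , v·w≈0 = orthogonal₁ v in w , w≉0 , dot-0′ w u≋0 , v·w≈0
      by (yes u×v≋0) (no u≉0) =
        let w , w≉0 , u·w≈0 = orthogonal₁ u
            r , u·r≈1 = dual u≉0
        in w , w≉0 , u·w≈0 , parallel-orthogonal u v r w u·r≈1 u×v≋0 u·w≈0

    -- Pairing the cross product of rows 1 and 2 with row 0 gives the determinant, so this cross
    -- product is in the kernel, and it serves if it is nonzero. Otherwise the two rows are
    -- dependent, and a vector orthogonal to row 0 and to a row spanning the other two is enough.
    kernel : ∀ M → det M ≈ 0# → ∃[ k ] ¬ k ≋ 0ᵥ × app M k ≋ 0ᵥ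
    kernel M det≈0 = by (cross (row M 1F) (row M 2F) ≟ᵛ 0ᵥ) (row M 1F ≟ᵛ 0ᵥ)
      where
      by : Dec (cross (row M 1F) (row M 2F) ≋ 0ᵥ) → Dec (row M 1F ≋ 0ᵥ) → ∃[ k ] ¬ k ≋ 0ᵥ × app M k ≋ 0ᵥ
      by (no ×≉0) _ = cross (row M 1F) (row M 2F) , ×≉0 ,
        ≋-ext₃ det≈0 (dot-crossˡ (row M 1F) (row M 2F)) (dot-crossʳ (row M 1F) (row M 2F))
      by (yes ×≋0) (yes r₁≋0) =
        let w , w≉0 , r₀·w , r₂·w = orthogonal₂ (row M 0F) (row M 2F)
        in w , w≉0 , ≋-ext₃ r₀·w (dot-0′ w r₁≋0) r₂·w
      by (yes ×≋0) (no r₁≉0) =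
        let w , w≉0 , r₀·w , r₁·w = orthogonal₂ (row M 0F) (row M 1F)
            r , r₁·r≈1 = dual r₁≉0
        in w , w≉0 , ≋-ext₃ r₀·w r₁·w (parallel-orthogonal (row M 1F) (row M 2F) r w r₁·r≈1 ×≋0 r₁·w)

    ∑-line : ∀ {n p} {A : Pred (Vector Carrier n) p} (A? : Decidable A) → (∀ {v w} → v ≋ w → A v → A w) →
      ∀ {d} v₀ → ¬ d ≋ 0ᵥ → (∀ s → A (v₀ +ᵥ s *ᵥ d)) → (∀ {v} → A v → ∃[ s ] v ≋ (v₀ +ᵥ s *ᵥ d)) →
      ∑[ v ∈ 𝕍 n ] 𝟙 (A? v) ≡ Q
    ∑-line {n} {A = A} A? A-resp {d} v₀ d≉0 on-line param = ≡.sym (≡.trans (≡.sym ∑-1) (≡.trans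
      (∑-image 𝔽-enumeration (𝕍-enumeration n) A? (λ s → v₀ +ᵥ s *ᵥ d) injective
        (λ s≈t j → +-congˡ (*-congʳ s≈t)) on-line param A-resp {λ _ → 1ℤ} (λ _ → ≡.refl))
      (∑-cong (𝕍 n) (λ v → Z.*-identityʳ (𝟙 (A? v))))))
      where
      injective : ∀ {s t} → (v₀ +ᵥ s *ᵥ d) ≋ (v₀ +ᵥ t *ᵥ d) → s ≈ t
      injective {s} {t} eq = scalar-unique d≉0 λ j → +-cancelˡ (v₀ j) _ _ (eq j)

    opaque
      quad-along : ∀ M v s d → quad M (v +ᵥ s *ᵥ d) ≈ (quad M v + (s * s) * quad M d) + (s * bil M v d + s * bil M v d)
      quad-along M v s d = identity (M ⊕ v ⊕ d ⊕ s ∷ᵥ []ᵥ) (E.quad y₁ (λ i → x₃ i :+ var (# 12) :* x₄ i))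
        ((E.quad y₁ x₃ :+ (var (# 12) :* var (# 12)) :* E.quad y₁ x₄) :+ (var (# 12) :* E.bil y₁ x₃ x₄ :+ var (# 12) :* E.bil y₁ x₃ x₄))

      bil-sym : ∀ M u v → bil M u v ≈ bil M v u
      bil-sym M u v = identity (M ⊕ u ⊕ v ⊕ []ᵥ) (E.bil y₁ x₃ x₄) (E.bil y₁ x₄ x₃)

      app-combine : ∀ M a u b v → app M (a *ᵥ u +ᵥ b *ᵥ v) ≋ (a *ᵥ app M u +ᵥ b *ᵥ app M v)
      app-combine M a u b v = ≋-ext₃ (identity ρ (l 0F) (r 0F)) (identity ρ (l 1F) (r 1F)) (identity ρ (l 2F) (r 2F))
        where
        ρ : Vec Carrier 14
        ρ = M ⊕ u ⊕ v ⊕ a ∷ᵥ b ∷ᵥ []ᵥ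
        l r : Vector (Polynomial 14) 3
        l = E.app y₁ (λ i → var (# 12) :* x₃ i :+ var (# 13) :* x₄ i)
        r i = var (# 12) :* E.app y₁ x₃ i :+ var (# 13) :* E.app y₁ x₄ i

      quad-combine : ∀ M a u b v w → quad M ((a *ᵥ u +ᵥ b *ᵥ v) +ᵥ w) ≈
        (((a * a) * quad M u + (b * b) * quad M v) + quad M w) +
        (((a * b + a * b) * bil M u v + (a + a) * bil M u w) + (b + b) * bil M v w)
      quad-combine M a u b v w = identity (M ⊕ u ⊕ v ⊕ w ⊕ a ∷ᵥ b ∷ᵥ []ᵥ)
        (E.quad y₁ (λ i → (a′ :* x₃ i :+ b′ :* x₄ i) :+ x₅ i))
        ((((a′ :* a′) :* E.quad y₁ x₃ :+ (b′ :* b′) :* E.quad y₁ x₄) :+ E.quad y₁ x₅) :+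
          (((a′ :* b′ :+ a′ :* b′) :* E.bil y₁ x₃ x₄ :+ (a′ :+ a′) :* E.bil y₁ x₃ x₅) :+ (b′ :+ b′) :* E.bil y₁ x₄ x₅))
        where
        a′ b′ : Polynomial 17
        a′ = var (# 15)
        b′ = var (# 16)

      bil-combine : ∀ M a u b v w → bil M ((a *ᵥ u +ᵥ b *ᵥ v) +ᵥ w) w ≈ (a * bil M u w + b * bil M v w) + quad M w
      bil-combine M a u b v w = identity (M ⊕ u ⊕ v ⊕ w ⊕ a ∷ᵥ b ∷ᵥ []ᵥ)
        (E.bil y₁ (λ i → (var (# 15) :* x₃ i :+ var (# 16) :* x₄ i) :+ x₅ i) x₅)
        ((var (# 15) :* E.bil y₁ x₃ x₅ :+ var (# 16) :* E.bil y₁ x₄ x₅) :+ E.quad y₁ x₅)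

      quad-e₀ : ∀ M → quad M e₀ ≈ M 0F
      quad-e₀ M = identity (M ⊕ []ᵥ) (E.quad y₁ (con 1ℤ ∷ 0ₑ ∷ 0ₑ ∷ [])) (y₁ 0F)

      quad-e₁ : ∀ M → quad M e₁ ≈ M 3F
      quad-e₁ M = identity (M ⊕ []ᵥ) (E.quad y₁ (0ₑ ∷ con 1ℤ ∷ 0ₑ ∷ [])) (y₁ 3F)

      quad-e₂ : ∀ M → quad M e₂ ≈ M 5F
      quad-e₂ M = identity (M ⊕ []ᵥ) (E.quad y₁ (0ₑ ∷ 0ₑ ∷ con 1ℤ ∷ [])) (y₁ 5F)

      -- Grouped so that every term has a diagonal entry or 2 as a factor. In characteristic 2 a
      -- symmetric matrix with zero diagonal is alternating, hence singular in odd order.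
      det-expand : ∀ M → det M ≈
        ((M 3F * M 5F - M 4F * M 4F) * M 0F + (- (M 2F * M 2F)) * M 3F) + ((- (M 1F * M 1F)) * M 5F + (M 1F * (M 2F * M 4F)) * (1# + 1#))
      det-expand M = identity (M ⊕ []ᵥ) (E.det y₁)
        (((y₁ 3F :* y₁ 5F :- y₁ 4F :* y₁ 4F) :* y₁ 0F :+ (:- (y₁ 2F :* y₁ 2F)) :* y₁ 3F) :+ ((:- (y₁ 1F :* y₁ 1F)) :* y₁ 5F :+ (y₁ 1F :* (y₁ 2F :* y₁ 4F)) :* (con 1ℤ :+ con 1ℤ)))

      app-tangent : ∀ M P λ′ μ x → app (M +ᵥ tangent P λ′ μ) x ≋
        (λ i → (app M x i + dot λ′ x * P i) + (dot P x * λ′ i + (μ * dot P x) * P i))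
      app-tangent M P λ′ μ x = ≋-ext₃ (identity ρ (l 0F) (r 0F)) (identity ρ (l 1F) (r 1F)) (identity ρ (l 2F) (r 2F))
        where
        ρ : Vec Carrier 16
        ρ = M ⊕ P ⊕ λ′ ⊕ x ⊕ μ ∷ᵥ []ᵥ
        l r : Vector (Polynomial 16) 3
        l = E.app (λ i → y₁ i :+ E.tangent x₃ x₄ (var (# 15)) i) x₅
        r i = (E.app y₁ x₅ i :+ E.dot x₄ x₅ :* x₃ i) :+ (E.dot x₃ x₅ :* x₄ i :+ (var (# 15) :* E.dot x₃ x₅) :* x₃ i)

      quad-tangent : ∀ P λ′ μ x → quad (tangent P λ′ μ) x ≈ ((dot λ′ x + dot λ′ x) + μ * dot P x) * dot P x
      quad-tangent P λ′ μ x = identity (P ⊕ λ′ ⊕ x ⊕ μ ∷ᵥ []ᵥ) (E.quad (E.tangent x₁ x₂ (var 9F)) x₃)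
        (((E.dot x₂ x₃ :+ E.dot x₂ x₃) :+ var 9F :* E.dot x₁ x₃) :* E.dot x₁ x₃)

      -- A tangent matrix is recovered from its value at any k not orthogonal to P.
      tangent-recover : ∀ P λ′ μ k → ((dot P k * dot P k) *ᵥ tangent P λ′ μ) ≋
        tangent P (dot P k *ᵥ app (tangent P λ′ μ) k) (- dot k (app (tangent P λ′ μ) k))
      tangent-recover P λ′ μ k = ≋-ext₆
        (identity ρ (l 0F) (r 0F)) (identity ρ (l 1F) (r 1F)) (identity ρ (l 2F) (r 2F))
        (identity ρ (l 3F) (r 3F)) (identity ρ (l 4F) (r 4F)) (identity ρ (l 5F) (r 5F))
        where
        ρ : Vec Carrier 10
        ρ = P ⊕ λ′ ⊕ k ⊕ μ ∷ᵥ []ᵥ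
        T l r : Vector (Polynomial 10) 6
        T = E.tangent x₁ x₂ (var 9F)
        l i = (E.dot x₁ x₃ :* E.dot x₁ x₃) :* T i
        r = E.tangent x₁ (λ i → E.dot x₁ x₃ :* E.app T x₃ i) (:- E.dot x₃ (E.app T x₃))

      -- The redundancy of the presentation: λ = s P contributes 2 s P Pᵗ, and μ = - 2 s cancels it.
      tangent-kernel : ∀ P s → tangent P (s *ᵥ P) (- (s + s)) ≋ 0ᵥ
      tangent-kernel P s = ≋-ext₆
        (identity ρ (l 0F) 0ₑ) (identity ρ (l 1F) 0ₑ) (identity ρ (l 2F) 0ₑ) (identity ρ (l 3F) 0ₑ) (identity ρ (l 4F) 0ₑ) (identity ρ (l 5F) 0ₑ)
        where
        ρ : Vec Carrier 4
        ρ = P ⊕ s ∷ᵥ []ᵥ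
        l : Vector (Polynomial 4) 6
        l = E.tangent x₁ (λ i → var 3F :* x₁ i) (:- (var 3F :+ var 3F))

      tangent-+ : ∀ P λ′ μ κ ν → tangent P (λ′ +ᵥ κ) (μ + ν) ≋ (tangent P λ′ μ +ᵥ tangent P κ ν)
      tangent-+ P λ′ μ κ ν = ≋-ext₆
        (identity ρ (l 0F) (r 0F)) (identity ρ (l 1F) (r 1F)) (identity ρ (l 2F) (r 2F))
        (identity ρ (l 3F) (r 3F)) (identity ρ (l 4F) (r 4F)) (identity ρ (l 5F) (r 5F))
        where
        ρ : Vec Carrier 11
        ρ = P ⊕ λ′ ⊕ κ ⊕ μ ∷ᵥ ν ∷ᵥ []ᵥ
        l r : Vector (Polynomial 11) 6
        l = E.tangent x₁ (λ i → x₂ i :+ x₃ i) (var 9F :+ var (# 10))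
        r i = E.tangent x₁ x₂ (var 9F) i :+ E.tangent x₁ x₃ (var (# 10)) i

      tangent-at-0 : ∀ λ′ μ → tangent 0ᵥ λ′ μ ≋ 0ᵥ
      tangent-at-0 λ′ μ = ≋-ext₆
        (identity ρ (l 0F) 0ₑ) (identity ρ (l 1F) 0ₑ) (identity ρ (l 2F) 0ₑ) (identity ρ (l 3F) 0ₑ) (identity ρ (l 4F) 0ₑ) (identity ρ (l 5F) 0ₑ)
        where
        ρ : Vec Carrier 4
        ρ = λ′ ⊕ μ ∷ᵥ []ᵥ
        l : Vector (Polynomial 4) 6
        l = E.tangent (λ _ → 0ₑ) x₁ (var 3F)

      app-tangent₀ : ∀ P λ′ μ x → app (tangent P λ′ μ) x ≋
        (λ i → dot λ′ x * P i + (dot P x * λ′ i + (μ * dot P x) * P i))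
      app-tangent₀ P λ′ μ x = ≋-ext₃ (identity ρ (l 0F) (r 0F)) (identity ρ (l 1F) (r 1F)) (identity ρ (l 2F) (r 2F))
        where
        ρ : Vec Carrier 10
        ρ = P ⊕ λ′ ⊕ x ⊕ μ ∷ᵥ []ᵥ
        l r : Vector (Polynomial 10) 3
        l = E.app (E.tangent x₁ x₂ (var 9F)) x₃
        r i = E.dot x₂ x₃ :* x₁ i :+ (E.dot x₁ x₃ :* x₂ i :+ (var 9F :* E.dot x₁ x₃) :* x₁ i)

      quad-+ : ∀ M N x → quad (M +ᵥ N) x ≈ quad M x + quad N x
      quad-+ M N x = identity (M ⊕ N ⊕ x ⊕ []ᵥ) (E.quad (λ i → y₁ i :+ y₂ i) x₅) (E.quad y₁ x₅ :+ E.quad y₂ x₅)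

      app-+ : ∀ M N x → app (M +ᵥ N) x ≋ (app M x +ᵥ app N x)
      app-+ M N x = ≋-ext₃ (identity ρ (l 0F) (r 0F)) (identity ρ (l 1F) (r 1F)) (identity ρ (l 2F) (r 2F))
        where
        ρ : Vec Carrier 15
        ρ = M ⊕ N ⊕ x ⊕ []ᵥ
        l r : Vector (Polynomial 15) 3
        l = E.app (λ i → y₁ i :+ y₂ i) x₅
        r i = E.app y₁ x₅ i :+ E.app y₂ x₅ i

      cross-+ : ∀ u v s w → cross u (v +ᵥ s *ᵥ w) ≋ (cross u v +ᵥ s *ᵥ cross u w)
      cross-+ u v s w = ≋-ext₃ (identity ρ (l 0F) (r 0F)) (identity ρ (l 1F) (r 1F)) (identity ρ (l 2F) (r 2F))
        where
        ρ : Vec Carrier 10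
        ρ = u ⊕ v ⊕ w ⊕ s ∷ᵥ []ᵥ
        l r : Vector (Polynomial 10) 3
        l = E.cross x₁ (λ i → x₂ i :+ var 9F :* x₃ i)
        r i = E.cross x₁ x₂ i :+ var 9F :* E.cross x₁ x₃ i

      cross-self : ∀ u → cross u u ≋ 0ᵥ
      cross-self u = ≋-ext₃ (identity ρ (E.cross x₁ x₁ 0F) 0ₑ) (identity ρ (E.cross x₁ x₁ 1F) 0ₑ) (identity ρ (E.cross x₁ x₁ 2F) 0ₑ)
        where
        ρ : Vec Carrier 3
        ρ = u ⊕ []ᵥ

    tangent-cong : ∀ {P P′ λ′ κ μ ν} → P ≋ P′ → λ′ ≋ κ → μ ≈ ν → tangent P λ′ μ ≋ tangent P′ κ ν
    tangent-cong {P} {P′} {λ′} {κ} {μ} {ν} P≋ λ≋ μ≈ = ≋-ext₆ (by 0F 0F) (by 0F 1F) (by 0F 2F) (by 1F 1F) (by 1F 2F) (by 2F 2F)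
      where
      by : ∀ i j → (P i * λ′ j + λ′ i * P j) + μ * (P i * P j) ≈ (P′ i * κ j + κ i * P′ j) + ν * (P′ i * P′ j)
      by i j = +-cong (+-cong (*-cong (P≋ i) (λ≋ j)) (*-cong (λ≋ i) (P≋ j))) (*-cong μ≈ (*-cong (P≋ i) (P≋ j)))

    opaque
      cross-anti : ∀ u v → cross u v ≋ (λ i → - cross v u i)
      cross-anti u v = ≋-ext₃ (identity ρ (l 0F) (r 0F)) (identity ρ (l 1F) (r 1F)) (identity ρ (l 2F) (r 2F))
        where
        ρ : Vec Carrier 6
        ρ = u ⊕ v ⊕ []ᵥ
        l r : Vector (Polynomial 6) 3
        l = E.cross x₁ x₂
        r i = :- E.cross x₂ x₁ i

      cross-combine : ∀ p x r a b → - (a * dot (cross p x) r) ≈ dot (cross p (b *ᵥ p +ᵥ (- a) *ᵥ x)) r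
      cross-combine p x r a b = identity (p ⊕ x ⊕ r ⊕ a ∷ᵥ b ∷ᵥ []ᵥ)
        (:- (var 9F :* E.dot (E.cross x₁ x₂) x₃))
        (E.dot (E.cross x₁ (λ i → var (# 10) :* x₁ i :+ (:- var 9F) :* x₂ i)) x₃)

    cross-0ʳ : ∀ u {v} → v ≋ 0ᵥ → cross u v ≋ 0ᵥ
    cross-0ʳ u v≋0 = ≋-ext₃
      (0+0≈0 (*0≈0 (u 1F) (v≋0 2F)) (-0≈0 (*0≈0 (u 2F) (v≋0 1F))))
      (0+0≈0 (*0≈0 (u 2F) (v≋0 0F)) (-0≈0 (*0≈0 (u 0F) (v≋0 2F))))
      (0+0≈0 (*0≈0 (u 0F) (v≋0 1F)) (-0≈0 (*0≈0 (u 1F) (v≋0 0F))))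

    y≈-x : ∀ {x y} → x + y ≈ 0# → y ≈ - x
    y≈-x {x} {y} eq = x-y≈0⇒x≈y (trans (+-congˡ (-‿involutive x)) (trans (+-comm y x) eq))

    ∑-orthogonal : ∀ {n} (u : Vector Carrier (suc n)) → ¬ u ≋ 0ᵥ → ∑[ v ∈ 𝕍 (suc n) ] 𝟙 (dot u v ≟ 0#) ≡ Q Z.^ n
    ∑-orthogonal {n} u u≉0 = cancel-Q _ _ (begin
      Q Z.* (∑[ v ∈ 𝕍 (suc n) ] 𝟙 (dot u v ≟ 0#))                                      ≡⟨ ∑-linear u ⟩
      Q Z.^ suc n Z.+ (Q Z.* Q Z.^ suc n Z.- Q Z.^ suc n) Z.* 𝟙 (u ≟ᵛ 0ᵥ)              ≡⟨ cong (Z._+_ (Q Z.^ suc n)) (≡.trans (cong (Z._*_ _) (𝟙-no (u ≟ᵛ 0ᵥ) u≉0)) (Z.*-zeroʳ _)) ⟩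
      Q Z.^ suc n Z.+ 0ℤ                                                               ≡⟨ Z.+-identityʳ _ ⟩
      Q Z.* Q Z.^ n                                                                    ∎)
      where open ≡-Reasoning

    ∑-nonorthogonal : ∀ {n} (u : Vector Carrier (suc n)) → ¬ u ≋ 0ᵥ → ∑[ v ∈ 𝕍 (suc n) ] 𝟙 (¬? (dot u v ≟ 0#)) ≡ Q Z.^ suc n Z.- Q Z.^ n
    ∑-nonorthogonal {n} u u≉0 = ≡.trans (∑-¬ (𝕍 (suc n)) (λ v → dot u v ≟ 0#)) (cong₂ Z._-_ (∑ᵛ-1 (suc n)) (∑-orthogonal u u≉0))

    row-0 : ∀ {M} → M ≋ 0ᵥ → ∀ i → row M i ≋ 0ᵥ
    row-0 eq 0F = ≋-ext₃ (eq 0F) (eq 1F) (eq 2F)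
    row-0 eq 1F = ≋-ext₃ (eq 1F) (eq 3F) (eq 4F)
    row-0 eq 2F = ≋-ext₃ (eq 2F) (eq 4F) (eq 5F)

    app-0ˡ : ∀ M x → M ≋ 0ᵥ → app M x ≋ 0ᵥ
    app-0ˡ M x M≋0 = ≋-ext₃ (dot-0′ x (row-0 {M} M≋0 0F)) (dot-0′ x (row-0 {M} M≋0 1F)) (dot-0′ x (row-0 {M} M≋0 2F))

    det-0 : det 0ᵥ ≈ 0#
    det-0 = dot-0′ (cross (row 0ᵥ 1F) (row 0ᵥ 2F)) (row-0 {0ᵥ} ≋-refl 0F)

    opaque
      -- A tangent matrix has rank at most 2. The sign is present because presentations are written
      -- M + T = 0, so that M = - T.
      det-tangent : ∀ P λ′ μ → det (λ i → - tangent P λ′ μ i) ≈ 0#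
      det-tangent P λ′ μ = identity (P ⊕ λ′ ⊕ μ ∷ᵥ []ᵥ) (E.det (λ i → :- E.tangent x₁ x₂ (var 6F) i)) 0ₑ

      -- This is the duality behind the double count: the map (λ , μ) ↦ `tangent P λ μ` is the
      -- transpose of taking gradient and value of a form at P.
      dot-tangent : ∀ f P λ′ μ → dot f (tangent P λ′ μ) ≈ μ * eval f P + dot (grad f P) λ′
      dot-tangent f P λ′ μ = identity (f ⊕ P ⊕ λ′ ⊕ μ ∷ᵥ []ᵥ)
        (E.dot y₁ (E.tangent x₃ x₄ (var (# 12)))) (var (# 12) :* E.eval y₁ x₃ :+ E.dot (E.grad y₁ x₃) x₄)

      -- Hence ℓ² lies in the web exactly when ℓ is isotropic for every matrix of the line.
      dot-square : ∀ ℓ M → dot (square ℓ) M ≈ quad M ℓ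
      dot-square ℓ M = identity (M ⊕ ℓ ⊕ []ᵥ) (E.dot (E.square x₃) y₁) (E.quad y₁ x₃)

      -- The multiples of the squares of the coordinates of P by the discriminant
      -- lie in the ideal generated by the value and the partial derivatives at P.
      disc-eval₀ : ∀ f P → disc f * (P 0F * P 0F) ≈
        ((((f 3F * f 5F + f 3F * f 5F) + (f 3F * f 5F + f 3F * f 5F)) - f 4F * f 4F) * eval f P + f 4F * (grad f P 1F * grad f P 2F))
        + (- (f 5F * (grad f P 1F * grad f P 1F)) - f 3F * (grad f P 2F * grad f P 2F))
      disc-eval₀ f P = identity (f ⊕ P ⊕ []ᵥ) (E.disc y₁ :* (x₃ 0F :* x₃ 0F))
        (((((y₁ 3F :* y₁ 5F :+ y₁ 3F :* y₁ 5F) :+ (y₁ 3F :* y₁ 5F :+ y₁ 3F :* y₁ 5F)) :- y₁ 4F :* y₁ 4F) :* E.eval y₁ x₃ :+ y₁ 4F :* (E.grad y₁ x₃ 1F :* E.grad y₁ x₃ 2F))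
        :+ ((:- (y₁ 5F :* (E.grad y₁ x₃ 1F :* E.grad y₁ x₃ 1F))) :- y₁ 3F :* (E.grad y₁ x₃ 2F :* E.grad y₁ x₃ 2F)))

      disc-eval₁ : ∀ f P → disc f * (P 1F * P 1F) ≈
        ((((f 0F * f 5F + f 0F * f 5F) + (f 0F * f 5F + f 0F * f 5F)) - f 2F * f 2F) * eval f P + f 2F * (grad f P 0F * grad f P 2F))
        + (- (f 5F * (grad f P 0F * grad f P 0F)) - f 0F * (grad f P 2F * grad f P 2F))
      disc-eval₁ f P = identity (f ⊕ P ⊕ []ᵥ) (E.disc y₁ :* (x₃ 1F :* x₃ 1F))
        (((((y₁ 0F :* y₁ 5F :+ y₁ 0F :* y₁ 5F) :+ (y₁ 0F :* y₁ 5F :+ y₁ 0F :* y₁ 5F)) :- y₁ 2F :* y₁ 2F) :* E.eval y₁ x₃ :+ y₁ 2F :* (E.grad y₁ x₃ 0F :* E.grad y₁ x₃ 2F))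
        :+ ((:- (y₁ 5F :* (E.grad y₁ x₃ 0F :* E.grad y₁ x₃ 0F))) :- y₁ 0F :* (E.grad y₁ x₃ 2F :* E.grad y₁ x₃ 2F)))

      disc-eval₂ : ∀ f P → disc f * (P 2F * P 2F) ≈
        ((((f 0F * f 3F + f 0F * f 3F) + (f 0F * f 3F + f 0F * f 3F)) - f 1F * f 1F) * eval f P + f 1F * (grad f P 0F * grad f P 1F))
        + (- (f 3F * (grad f P 0F * grad f P 0F)) - f 0F * (grad f P 1F * grad f P 1F))
      disc-eval₂ f P = identity (f ⊕ P ⊕ []ᵥ) (E.disc y₁ :* (x₃ 2F :* x₃ 2F))
        (((((y₁ 0F :* y₁ 3F :+ y₁ 0F :* y₁ 3F) :+ (y₁ 0F :* y₁ 3F :+ y₁ 0F :* y₁ 3F)) :- y₁ 1F :* y₁ 1F) :* E.eval y₁ x₃ :+ y₁ 1F :* (E.grad y₁ x₃ 0F :* E.grad y₁ x₃ 1F))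
        :+ ((:- (y₁ 3F :* (E.grad y₁ x₃ 0F :* E.grad y₁ x₃ 0F))) :- y₁ 0F :* (E.grad y₁ x₃ 1F :* E.grad y₁ x₃ 1F)))

      det-polar : ∀ f → det (polar f) ≈ disc f + disc f
      det-polar f = identity (f ⊕ []ᵥ) (E.det (E.polar y₁)) (E.disc y₁ :+ E.disc y₁)

      euler : ∀ f P → dot P (grad f P) ≈ eval f P + eval f P
      euler f P = identity (f ⊕ P ⊕ []ᵥ) (E.dot x₃ (E.grad y₁ x₃)) (E.eval y₁ x₃ :+ E.eval y₁ x₃)

      -- The point (a₁₂ , a₀₂ , a₀₁) is the nucleus of the conic in characteristic 2: the partial
      -- derivatives there are divisible by 2. By `eval-nucleus` the value there is - Δ up to a
      -- multiple of 4.
      grad-nucleus : ∀ f → grad f (f 4F ∷ f 2F ∷ f 1F ∷ []) ≋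
        (λ i → ((f 0F * f 4F ∷ f 3F * f 2F ∷ f 5F * f 1F ∷ []) i + (f 0F * f 4F ∷ f 3F * f 2F ∷ f 5F * f 1F ∷ []) i) +
               ((f 1F * f 2F ∷ f 1F * f 4F ∷ f 2F * f 4F ∷ []) i + (f 1F * f 2F ∷ f 1F * f 4F ∷ f 2F * f 4F ∷ []) i))
      grad-nucleus f = ≋-ext₃ (identity (f ⊕ []ᵥ) (l 0F) (r 0F)) (identity (f ⊕ []ᵥ) (l 1F) (r 1F)) (identity (f ⊕ []ᵥ) (l 2F) (r 2F))
        where
        l a b r : Vector (Polynomial 6) 3
        l = E.grad y₁ (y₁ 4F ∷ y₁ 2F ∷ y₁ 1F ∷ [])
        a = y₁ 0F :* y₁ 4F ∷ y₁ 3F :* y₁ 2F ∷ y₁ 5F :* y₁ 1F ∷ []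
        b = y₁ 1F :* y₁ 2F ∷ y₁ 1F :* y₁ 4F ∷ y₁ 2F :* y₁ 4F ∷ []
        r i = (a i :+ a i) :+ (b i :+ b i)

      eval-nucleus : ∀ f → eval f (f 4F ∷ f 2F ∷ f 1F ∷ []) ≈
        - disc f + (((f 0F * (f 3F * f 5F) + f 1F * (f 2F * f 4F)) + (f 0F * (f 3F * f 5F) + f 1F * (f 2F * f 4F)))
                 + ((f 0F * (f 3F * f 5F) + f 1F * (f 2F * f 4F)) + (f 0F * (f 3F * f 5F) + f 1F * (f 2F * f 4F))))
      eval-nucleus f = identity (f ⊕ []ᵥ) (E.eval y₁ (y₁ 4F ∷ y₁ 2F ∷ y₁ 1F ∷ [])) ((:- E.disc y₁) :+ ((a :+ a) :+ (a :+ a)))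
        where
        a : Polynomial 6
        a = y₁ 0F :* (y₁ 3F :* y₁ 5F) :+ y₁ 1F :* (y₁ 2F :* y₁ 4F)

      -- Splits off the mixed terms, whose coefficients are the coordinates of the nucleus. If these
      -- vanish, f has the values of a diagonal symmetric matrix, to which `isotropic` applies.
      eval-diagonal : ∀ f P → eval f P ≈ quad (f 0F ∷ 0# ∷ 0# ∷ f 3F ∷ 0# ∷ f 5F ∷ []) P + dot (f 4F ∷ f 2F ∷ f 1F ∷ []) (P 1F * P 2F ∷ P 0F * P 2F ∷ P 0F * P 1F ∷ [])
      eval-diagonal f P = identity (f ⊕ P ⊕ []ᵥ) (E.eval y₁ x₃)
        (E.quad (y₁ 0F ∷ 0ₑ ∷ 0ₑ ∷ y₁ 3F ∷ 0ₑ ∷ y₁ 5F ∷ []) x₃ :+ E.dot (y₁ 4F ∷ y₁ 2F ∷ y₁ 1F ∷ []) (x₃ 1F :* x₃ 2F ∷ x₃ 0F :* x₃ 2F ∷ x₃ 0F :* x₃ 1F ∷ []))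

      grad-diagonal : ∀ f P → grad f P ≋
        (λ i → ((f 0F * P 0F ∷ f 3F * P 1F ∷ f 5F * P 2F ∷ []) i + (f 0F * P 0F ∷ f 3F * P 1F ∷ f 5F * P 2F ∷ []) i)
               + dot (f 4F ∷ f 2F ∷ f 1F ∷ []) (((0# ∷ P 2F ∷ P 1F ∷ []) ∷ (P 2F ∷ 0# ∷ P 0F ∷ []) ∷ (P 1F ∷ P 0F ∷ 0# ∷ []) ∷ []) i))
      grad-diagonal f P = ≋-ext₃ (identity ρ (l 0F) (r 0F)) (identity ρ (l 1F) (r 1F)) (identity ρ (l 2F) (r 2F))
        where
        ρ : Vec Carrier 9
        ρ = f ⊕ P ⊕ []ᵥ
        l a r : Vector (Polynomial 9) 3
        l = E.grad y₁ x₃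
        a = y₁ 0F :* x₃ 0F ∷ y₁ 3F :* x₃ 1F ∷ y₁ 5F :* x₃ 2F ∷ []
        b : Vector (Vector (Polynomial 9) 3) 3
        b = (0ₑ ∷ x₃ 2F ∷ x₃ 1F ∷ []) ∷ (x₃ 2F ∷ 0ₑ ∷ x₃ 0F ∷ []) ∷ (x₃ 1F ∷ x₃ 0F ∷ 0ₑ ∷ []) ∷ []
        r i = (a i :+ a i) :+ E.dot (y₁ 4F ∷ y₁ 2F ∷ y₁ 1F ∷ []) (b i)

      eval-combine : ∀ f a b c′ P P′ r → eval f ((a *ᵥ P +ᵥ b *ᵥ P′) +ᵥ c′ *ᵥ r) ≈
        (((a * a) * eval f P + (b * b) * eval f P′) + (c′ * c′) * eval f r) +
        (((a * b) * dot P′ (grad f P) + (a * c′) * dot r (grad f P)) + (b * c′) * dot r (grad f P′))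
      eval-combine f a b c′ P P′ r = identity (f ⊕ P ⊕ P′ ⊕ r ⊕ a ∷ᵥ b ∷ᵥ c′ ∷ᵥ []ᵥ)
        (E.eval y₁ (λ i → (α :* x₃ i :+ β :* x₄ i) :+ γ :* x₅ i))
        ((((α :* α) :* E.eval y₁ x₃ :+ (β :* β) :* E.eval y₁ x₄) :+ (γ :* γ) :* E.eval y₁ x₅) :+
         (((α :* β) :* E.dot x₄ (E.grad y₁ x₃) :+ (α :* γ) :* E.dot x₅ (E.grad y₁ x₃)) :+ (β :* γ) :* E.dot x₅ (E.grad y₁ x₄)))
        where
        α β γ : Polynomial 18
        α = var (# 15)
        β = var (# 16)
        γ = var (# 17)

      coordinates : ∀ a b c′ x → dot a (cross b c′) ≈ 1# →
        x ≋ ((dot x (cross b c′) *ᵥ a +ᵥ dot x (cross c′ a) *ᵥ b) +ᵥ dot x (cross a b) *ᵥ c′)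
      coordinates a b c′ x D≈1 = ≋-ext₃
        (by 0F (identity ρ (lhs 0F) (rhs 0F))) (by 1F (identity ρ (lhs 1F) (rhs 1F))) (by 2F (identity ρ (lhs 2F) (rhs 2F)))
        where
        ρ : Vec Carrier 12
        ρ = a ⊕ b ⊕ c′ ⊕ x ⊕ []ᵥ
        lhs rhs : Vector (Polynomial 12) 3
        lhs i = E.dot x₁ (E.cross x₂ x₃) :* x₄ i
        rhs i = (E.dot x₄ (E.cross x₂ x₃) :* x₁ i :+ E.dot x₄ (E.cross x₃ x₁) :* x₂ i) :+ E.dot x₄ (E.cross x₁ x₂) :* x₃ i
        by : ∀ i {y} → dot a (cross b c′) * x i ≈ y → x i ≈ y
        by i eq = trans (sym (*-identityˡ (x i))) (trans (*-congʳ (sym D≈1)) eq)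

      eval-square : ∀ a ℓ X → eval (a *ᵥ square ℓ) X ≈ a * (dot ℓ X * dot ℓ X)
      eval-square a ℓ X = identity (ℓ ⊕ X ⊕ a ∷ᵥ []ᵥ) (E.eval (λ i → var 6F :* E.square x₁ i) x₂) (var 6F :* (E.dot x₁ x₂ :* E.dot x₁ x₂))

      grad-square : ∀ a ℓ X → grad (a *ᵥ square ℓ) X ≋ (λ i → ((a + a) * ℓ i) * dot ℓ X)
      grad-square a ℓ X = ≋-ext₃ (identity ρ (l 0F) (r 0F)) (identity ρ (l 1F) (r 1F)) (identity ρ (l 2F) (r 2F))
        where
        ρ : Vec Carrier 7
        ρ = ℓ ⊕ X ⊕ a ∷ᵥ []ᵥ
        l r : Vector (Polynomial 7) 3
        l = E.grad (λ i → var 6F :* E.square x₁ i) x₂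
        r i = ((var 6F :+ var 6F) :* x₁ i) :* E.dot x₁ x₂

      disc-square : ∀ a ℓ → disc (a *ᵥ square ℓ) ≈ 0#
      disc-square a ℓ = identity (ℓ ⊕ a ∷ᵥ []ᵥ) (E.disc (λ i → var 3F :* E.square x₁ i)) 0ₑ

      -- The values at e₀, e₁, e₂ and at their pairwise sums determine the six coefficients, so
      -- forms equal as functions are equal even over the field of two elements.
      eval-injective : ∀ f g → (∀ X → eval f X ≈ eval g X) → f ≋ g
      eval-injective f g eq = ≋-ext₆
        (by 0F (identity (f ⊕ []ᵥ) (y₁ 0F) (d 0F)) (identity (g ⊕ []ᵥ) (y₁ 0F) (d 0F)) (eq e₀))
        (by 1F (identity (f ⊕ []ᵥ) (y₁ 1F) (m e₀ₑ e₁ₑ)) (identity (g ⊕ []ᵥ) (y₁ 1F) (m e₀ₑ e₁ₑ)) (mixed e₀ e₁))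
        (by 2F (identity (f ⊕ []ᵥ) (y₁ 2F) (m e₀ₑ e₂ₑ)) (identity (g ⊕ []ᵥ) (y₁ 2F) (m e₀ₑ e₂ₑ)) (mixed e₀ e₂))
        (by 3F (identity (f ⊕ []ᵥ) (y₁ 3F) (d 1F)) (identity (g ⊕ []ᵥ) (y₁ 3F) (d 1F)) (eq e₁))
        (by 4F (identity (f ⊕ []ᵥ) (y₁ 4F) (m e₁ₑ e₂ₑ)) (identity (g ⊕ []ᵥ) (y₁ 4F) (m e₁ₑ e₂ₑ)) (mixed e₁ e₂))
        (by 5F (identity (f ⊕ []ᵥ) (y₁ 5F) (d 2F)) (identity (g ⊕ []ᵥ) (y₁ 5F) (d 2F)) (eq e₂))
        where
        e₀ₑ e₁ₑ e₂ₑ : Vector (Polynomial 6) 3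
        e₀ₑ = con 1ℤ ∷ 0ₑ ∷ 0ₑ ∷ []
        e₁ₑ = 0ₑ ∷ con 1ℤ ∷ 0ₑ ∷ []
        e₂ₑ = 0ₑ ∷ 0ₑ ∷ con 1ℤ ∷ []
        d : Vector (Polynomial 6) 3
        d = E.eval y₁ e₀ₑ ∷ E.eval y₁ e₁ₑ ∷ E.eval y₁ e₂ₑ ∷ []
        m : Vector (Polynomial 6) 3 → Vector (Polynomial 6) 3 → Polynomial 6
        m u v = (E.eval y₁ (λ i → u i :+ v i) :- E.eval y₁ u) :- E.eval y₁ v
        mixed : ∀ u v → (eval f (u +ᵥ v) - eval f u) - eval f v ≈ (eval g (u +ᵥ v) - eval g u) - eval g v
        mixed u v = +-cong (+-cong (eq (u +ᵥ v)) (-‿cong (eq u))) (-‿cong (eq v))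
        by : ∀ i {x y} → f i ≈ x → g i ≈ y → x ≈ y → f i ≈ g i
        by i f≈ g≈ x≈y = trans f≈ (trans x≈y (sym g≈))

      eval-multiple : ∀ f s P → eval f (0ᵥ +ᵥ s *ᵥ P) ≈ (s * s) * eval f P
      eval-multiple f s P = identity (f ⊕ P ⊕ s ∷ᵥ []ᵥ) (E.eval y₁ (λ i → 0ₑ :+ var 9F :* x₃ i)) ((var 9F :* var 9F) :* E.eval y₁ x₃)

      grad-multiple : ∀ f s P → grad f (0ᵥ +ᵥ s *ᵥ P) ≋ (s *ᵥ grad f P)
      grad-multiple f s P = ≋-ext₃ (identity ρ (l 0F) (r 0F)) (identity ρ (l 1F) (r 1F)) (identity ρ (l 2F) (r 2F))
        where
        ρ : Vec Carrier 10
        ρ = f ⊕ P ⊕ s ∷ᵥ []ᵥ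
        l r : Vector (Polynomial 10) 3
        l = E.grad y₁ (λ i → 0ₑ :+ var 9F :* x₃ i)
        r i = var 9F :* E.grad y₁ x₃ i

      triple-cyclic : ∀ u v w → dot u (cross v w) ≈ dot (cross u v) w
      triple-cyclic u v w = identity (u ⊕ v ⊕ w ⊕ []ᵥ) (E.dot x₁ (E.cross x₂ x₃)) (E.dot (E.cross x₁ x₂) x₃)

      dot-e : ∀ u → u ≋ (dot u e₀ ∷ dot u e₁ ∷ dot u e₂ ∷ [])
      dot-e u = ≋-ext₃
        (identity (u ⊕ []ᵥ) (x₁ 0F) (E.dot x₁ (con 1ℤ ∷ 0ₑ ∷ 0ₑ ∷ [])))
        (identity (u ⊕ []ᵥ) (x₁ 1F) (E.dot x₁ (0ₑ ∷ con 1ℤ ∷ 0ₑ ∷ [])))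
        (identity (u ⊕ []ᵥ) (x₁ 2F) (E.dot x₁ (0ₑ ∷ 0ₑ ∷ con 1ℤ ∷ [])))

      square-multiple : ∀ t ℓ → square (t *ᵥ ℓ) ≋ ((t * t) *ᵥ square ℓ)
      square-multiple t ℓ = ≋-ext₆
        (identity ρ (l 0F) (r 0F)) (identity ρ (l 1F) (r 1F)) (identity ρ (l 2F) (r 2F))
        (identity ρ (l 3F) (r 3F)) (identity ρ (l 4F) (r 4F)) (identity ρ (l 5F) (r 5F))
        where
        ρ : Vec Carrier 4
        ρ = ℓ ⊕ t ∷ᵥ []ᵥ
        l r : Vector (Polynomial 4) 6
        l = E.square (λ i → var 3F :* x₁ i)
        r i = (var 3F :* var 3F) :* E.square x₁ i

    square-cong : ∀ {ℓ m} → ℓ ≋ m → square ℓ ≋ square m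
    square-cong {ℓ} {m} eq = ≋-ext₆ (by 0F 0F) (+-cong (by 0F 1F) (by 0F 1F)) (+-cong (by 0F 2F) (by 0F 2F)) (by 1F 1F) (+-cong (by 1F 2F) (by 1F 2F)) (by 2F 2F)
      where
      by : ∀ i j → ℓ i * ℓ j ≈ m i * m j
      by i j = *-cong (eq i) (eq j)

    eval-cong : ∀ {f g P R} → f ≋ g → P ≋ R → eval f P ≈ eval g R
    eval-cong {f} {g} {P} {R} f≋g P≋R = +-cong (+-cong (+-cong (by 0F 0F 0F) (by 1F 0F 1F)) (by 2F 0F 2F)) (+-cong (+-cong (by 3F 1F 1F) (by 4F 1F 2F)) (by 5F 2F 2F))
      where
      by : ∀ k i j → f k * (P i * P j) ≈ g k * (R i * R j)
      by k i j = *-cong (f≋g k) (*-cong (P≋R i) (P≋R j))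

    grad-cong : ∀ {f g P R} → f ≋ g → P ≋ R → grad f P ≋ grad g R
    grad-cong {f} {g} f≋g P≋R = app-cong {polar f} {polar g}
      (≋-ext₆ (+-cong (f≋g 0F) (f≋g 0F)) (f≋g 1F) (f≋g 2F) (+-cong (f≋g 3F) (f≋g 3F)) (f≋g 4F) (+-cong (f≋g 5F) (f≋g 5F))) P≋R

    disc-cong : ∀ {f g} → f ≋ g → disc f ≈ disc g
    disc-cong {f} {g} eq = +-cong (+-cong (+-cong (+-cong (four a≈) (*-cong (*-cong (eq 1F) (eq 2F)) (eq 4F)))
      (by 0F 4F)) (by 3F 2F)) (by 5F 1F)
      where
      by : ∀ i j → - (f i * (f j * f j)) ≈ - (g i * (g j * g j))
      by i j = -‿cong (*-cong (eq i) (*-cong (eq j) (eq j)))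
      a≈ : f 0F * f 3F * f 5F ≈ g 0F * g 3F * g 5F
      a≈ = *-cong (*-cong (eq 0F) (eq 3F)) (eq 5F)
      four : ∀ {x y} → x ≈ y → x + (x + (x + (x + 0#))) ≈ y + (y + (y + (y + 0#)))
      four x≈y = +-cong x≈y (+-cong x≈y (+-cong x≈y (+-congʳ x≈y)))

    opaque
      det-scale : ∀ a M → det (a *ᵥ M) ≈ (a * (a * a)) * det M
      det-scale a M = identity (M ⊕ a ∷ᵥ []ᵥ) (E.det (λ i → var 6F :* y₁ i)) ((var 6F :* (var 6F :* var 6F)) :* E.det y₁)

      disc-scale : ∀ a f → disc (a *ᵥ f) ≈ (a * (a * a)) * disc f
      disc-scale a f = identity (f ⊕ a ∷ᵥ []ᵥ) (E.disc (λ i → var 6F :* y₁ i)) ((var 6F :* (var 6F :* var 6F)) :* E.disc y₁)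

  -- Isotropic vectors of symmetric matrices

  2≈0 : Set ℓ₁
  2≈0 = 1# + 1# ≈ 0#

  double : 2≈0 → ∀ x → x + x ≈ 0#
  double 2≈0 x = trans (+-cong (sym (*-identityʳ x)) (sym (*-identityʳ x))) (trans (sym (distribˡ x 1# 1#)) (*0≈0 x 2≈0))

  x+x≈0⇒x≈0 : ¬ 2≈0 → ∀ {x} → x + x ≈ 0# → x ≈ 0#
  x+x≈0⇒x≈0 2≉0 {x} eq = xy≈0⇒y≈0 2≉0 (trans (trans (distribʳ x 1# 1#) (+-cong (*-identityˡ x) (*-identityˡ x))) eq)

  scaled-square : Carrier → Carrier → Carrier
  scaled-square b x = b * (x * x)

  scaled-square-cong : ∀ b {x y} → x ≈ y → scaled-square b x ≈ scaled-square b y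
  scaled-square-cong b x≈y = *-congˡ (*-cong x≈y x≈y)

  scaled-square-± : ∀ {b x y} → ¬ b ≈ 0# → scaled-square b x ≈ scaled-square b y → x ≈ y ⊎ x ≈ - y
  scaled-square-± {b} {x} {y} b≉0 eq = by (x - y ≟ 0#)
    where
    open Ring-Solver
    factored : (x - y) * (x + y) ≈ 0#
    factored = trans
      (identity (x ∷ᵥ y ∷ᵥ []ᵥ) ((var 0F :- var 1F) :* (var 0F :+ var 1F)) (var 0F :* var 0F :- var 1F :* var 1F))
      (x≈y⇒x-y≈0 (*-cancelˡ b≉0 eq))
    by : Dec (x - y ≈ 0#) → x ≈ y ⊎ x ≈ - y
    by (yes x-y≈0) = inj₁ (x-y≈0⇒x≈y x-y≈0)
    by (no  x-y≉0) = inj₂ (x-y≈0⇒x≈y (trans (+-congˡ (-‿involutive y)) (xy≈0⇒y≈0 x-y≉0 factored)))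

  scaled-square-injective : 2≈0 → ∀ {b x y} → ¬ b ≈ 0# → scaled-square b x ≈ scaled-square b y → x ≈ y
  scaled-square-injective 2≈0 {b} {x} {y} b≉0 eq = by (scaled-square-± b≉0 eq)
    where
    by : x ≈ y ⊎ x ≈ - y → x ≈ y
    by (inj₁ x≈y)  = x≈y
    by (inj₂ x≈-y) = x-y≈0⇒x≈y (trans (+-congʳ x≈-y) (trans (sym (+-congʳ (-1*x≈-x y))) (trans (+-congˡ (sym (-1*x≈-x y))) (double 2≈0 (- 1# * y)))))

  scaled-square-surjective : 2≈0 → ∀ {b} → ¬ b ≈ 0# → ∀ y → ∃[ x ] y ≈ scaled-square b x
  scaled-square-surjective 2≈0 {b} b≉0 = injective⇒surjective 𝔽-enumeration (scaled-square b)
    (scaled-square-injective 2≈0 b≉0) (scaled-square-cong b)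

  private
    roots : Carrier → Carrier → ℤ
    roots b y = ∑[ x ∈ 𝔽 ] 𝟙 (scaled-square b x ≟ y)

    ∃root? : ∀ b y → Dec (∃[ x ] scaled-square b x ≈ y)
    ∃root? b y = any𝔽? (λ x≈x′ eq → trans (scaled-square-cong b (sym x≈x′)) eq) (λ x → scaled-square b x ≟ y)

    no-roots : ∀ b y → ¬ (∃[ x ] scaled-square b x ≈ y) → roots b y ≡ 0ℤ
    no-roots b y ∄ = ≡.trans (∑-cong 𝔽 λ x → 𝟙-no (scaled-square b x ≟ y) λ eq → ∄ (x , eq)) (∑-0 𝔽)

    roots-0 : ∀ {b y} → ¬ b ≈ 0# → y ≈ 0# → roots b y ≡ 1ℤ
    roots-0 {b} {y} b≉0 y≈0 = ≡.trans
      (∑-cong 𝔽 λ x → 𝟙-cong (scaled-square b x ≟ y) (x ≟ 0#)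
        (λ eq → xx≈0⇒x≈0 (xy≈0⇒y≈0 b≉0 (trans eq y≈0)))
        (λ x≈0 → trans (*0≈0 b (*0≈0 x x≈0)) (sym y≈0)))
      (Enumeration.once 𝔽-enumeration 0#)

    roots≤2 : ∀ {b} y → ¬ b ≈ 0# → roots b y Int.≤ 1ℤ Z.+ 1ℤ
    roots≤2 {b} y b≉0 = by (∃root? b y)
      where
      open Int.≤-Reasoning
      by : Dec (∃[ x ] scaled-square b x ≈ y) → roots b y Int.≤ 1ℤ Z.+ 1ℤ
      by (no ∄) = begin
        roots b y       ≡⟨ no-roots b y ∄ ⟩
        0ℤ              ≡⟨ Z.+-identityˡ 0ℤ ⟨
        0ℤ Z.+ 0ℤ       ≤⟨ Z.+-mono-≤ (Int.+≤+ ℕ.z≤n) (Int.+≤+ ℕ.z≤n) ⟩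
        1ℤ Z.+ 1ℤ       ∎
      by (yes (x₀ , eq₀)) = begin
        roots b y                                                  ≤⟨ ∑-mono 𝔽 (λ x → 𝟙-⊎ (scaled-square b x ≟ y) (x ≟ x₀) (x ≟ - x₀)
                                                                        (λ eq → scaled-square-± b≉0 (trans eq (sym eq₀)))) ⟩
        ∑[ x ∈ 𝔽 ] (𝟙 (x ≟ x₀) Z.+ 𝟙 (x ≟ - x₀))                   ≡⟨ ∑-+ 𝔽 _ _ ⟩
        (∑[ x ∈ 𝔽 ] 𝟙 (x ≟ x₀)) Z.+ (∑[ x ∈ 𝔽 ] 𝟙 (x ≟ - x₀))      ≡⟨ cong₂ Z._+_ (Enumeration.once 𝔽-enumeration x₀) (Enumeration.once 𝔽-enumeration (- x₀)) ⟩
        1ℤ Z.+ 1ℤ                                                  ∎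

    ∑-fibres : ∀ (g : Carrier → Carrier) → ∑[ y ∈ 𝔽 ] ∑[ x ∈ 𝔽 ] 𝟙 (y ≟ g x) ≡ Q
    ∑-fibres g = ≡.trans (∑-swap 𝔽 𝔽 _) (≡.trans (∑-cong 𝔽 λ x → Enumeration.once 𝔽-enumeration (g x)) ∑-1)

  -- Pigeonhole: {a x²} and {c − b y²} each contain more than half of the field.
  two-squares : ∀ {a b} → ¬ a ≈ 0# → ¬ b ≈ 0# → ∀ c → ∃[ x ] ∃[ y ] scaled-square a x + scaled-square b y ≈ c
  two-squares {a} {b} a≉0 b≉0 c = by (any𝔽? (λ x≈x′ (y , eq) → y , trans (+-congʳ (scaled-square-cong a (sym x≈x′))) eq) sum?)
    where
    sum? : Decidable (λ x → ∃[ y ] scaled-square a x + scaled-square b y ≈ c)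
    sum? x = any𝔽? (λ y≈y′ eq → trans (+-congˡ (scaled-square-cong b (sym y≈y′))) eq) (λ y → scaled-square a x + scaled-square b y ≟ c)
    by : Dec (∃[ x ] ∃[ y ] scaled-square a x + scaled-square b y ≈ c) → ∃[ x ] ∃[ y ] scaled-square a x + scaled-square b y ≈ c
    by (yes solution) = solution
    by (no ∄) = contradiction too-many (Z.1+i≰i (Q Z.+ Q))
      where
      open Ring-Solver
      -- In the absence of a solution at most one of the two root counts at y is nonzero. The value
      -- 0 has a single root under `scaled-square a`; the indicator of y = 0 fills the gap up to 2
      -- and supplies the surplus 1 in `too-many`.
      bound : ∀ y → (roots a y Z.+ 𝟙 (y ≟ 0#)) Z.+ roots b (c - y) Int.≤ 1ℤ Z.+ 1ℤ
      bound y = cases (∃root? a y) (y ≟ 0#)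
        where
        open Int.≤-Reasoning
        cases : Dec (∃[ x ] scaled-square a x ≈ y) → (d : Dec (y ≈ 0#)) → (roots a y Z.+ 𝟙 d) Z.+ roots b (c - y) Int.≤ 1ℤ Z.+ 1ℤ
        cases (no ∄x) (yes y≈0) = contradiction (0# , trans (*0≈0 a (zeroˡ 0#)) (sym y≈0)) ∄x
        cases (no ∄x) (no _) = begin
          (roots a y Z.+ 0ℤ) Z.+ roots b (c - y)   ≡⟨ cong (Z._+ roots b (c - y)) (≡.trans (Z.+-identityʳ _) (no-roots a y ∄x)) ⟩
          0ℤ Z.+ roots b (c - y)                   ≡⟨ Z.+-identityˡ _ ⟩
          roots b (c - y)                          ≤⟨ roots≤2 (c - y) b≉0 ⟩
          1ℤ Z.+ 1ℤ                                ∎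
        cases (yes (x , ax²≈y)) d = begin
          (roots a y Z.+ 𝟙 d) Z.+ roots b (c - y)  ≡⟨ cong (Z._+_ (roots a y Z.+ 𝟙 d)) (no-roots b (c - y) λ (z , eq) → ∄ (x , z ,
                                                        trans (+-cong ax²≈y eq) (identity (c ∷ᵥ y ∷ᵥ []ᵥ) (var 1F :+ (var 0F :- var 1F)) (var 0F)))) ⟩
          (roots a y Z.+ 𝟙 d) Z.+ 0ℤ               ≡⟨ Z.+-identityʳ _ ⟩
          roots a y Z.+ 𝟙 d                        ≤⟨ zero-or-not d ⟩
          1ℤ Z.+ 1ℤ                                ∎
          where
          zero-or-not : (d : Dec (y ≈ 0#)) → roots a y Z.+ 𝟙 d Int.≤ 1ℤ Z.+ 1ℤ
          zero-or-not (yes y≈0) = Int.≤-reflexive (cong (Z._+ 1ℤ) (roots-0 a≉0 y≈0))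
          zero-or-not (no _)    = Int.≤-trans (Int.≤-reflexive (Z.+-identityʳ _)) (roots≤2 y a≉0)

      fibre-a : ∑[ y ∈ 𝔽 ] roots a y ≡ Q
      fibre-a = ≡.trans (∑-cong 𝔽 λ y → ∑-cong 𝔽 λ x → 𝟙-cong (scaled-square a x ≟ y) (y ≟ scaled-square a x) sym sym) (∑-fibres (scaled-square a))

      move : ∀ {x y z} → z ≈ x - y → y ≈ x - z
      move {x} {y} {z} eq = trans
        (identity (x ∷ᵥ y ∷ᵥ []ᵥ) (var 1F) (var 0F :- (var 0F :- var 1F))) (+-congˡ (-‿cong (sym eq)))

      fibre-b : ∑[ y ∈ 𝔽 ] roots b (c - y) ≡ Q
      fibre-b = ≡.trans (∑-cong 𝔽 λ y → ∑-cong 𝔽 λ x → 𝟙-cong (scaled-square b x ≟ c - y) (y ≟ c - scaled-square b x) move move)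
        (∑-fibres (λ x → c - scaled-square b x))

      too-many : 1ℤ Z.+ (Q Z.+ Q) Int.≤ Q Z.+ Q
      too-many = begin
        1ℤ Z.+ (Q Z.+ Q)                                                              ≡⟨ rearrange Q ⟩
        (Q Z.+ 1ℤ) Z.+ Q                                                              ≡⟨ cong₂ Z._+_ (cong₂ Z._+_ fibre-a (Enumeration.once 𝔽-enumeration 0#)) fibre-b ⟨
        ((∑[ y ∈ 𝔽 ] roots a y) Z.+ (∑[ y ∈ 𝔽 ] 𝟙 (y ≟ 0#))) Z.+ (∑[ y ∈ 𝔽 ] roots b (c - y))
                                                                                      ≡⟨ cong (Z._+ _) (∑-+ 𝔽 _ _) ⟨
        (∑[ y ∈ 𝔽 ] (roots a y Z.+ 𝟙 (y ≟ 0#))) Z.+ (∑[ y ∈ 𝔽 ] roots b (c - y))      ≡⟨ ∑-+ 𝔽 _ _ ⟨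
        ∑[ y ∈ 𝔽 ] ((roots a y Z.+ 𝟙 (y ≟ 0#)) Z.+ roots b (c - y))                  ≤⟨ ∑-mono 𝔽 bound ⟩
        ∑[ y ∈ 𝔽 ] (1ℤ Z.+ 1ℤ)                                                        ≡⟨ ≡.trans (∑-+ 𝔽 _ _) (cong₂ Z._+_ ∑-1 ∑-1) ⟩
        Q Z.+ Q                                                                       ∎
        where
        open Int.≤-Reasoning
        rearrange : ∀ x → 1ℤ Z.+ (x Z.+ x) ≡ (x Z.+ 1ℤ) Z.+ x
        rearrange x = ≡.trans (≡.sym (Z.+-assoc 1ℤ x x)) (cong (Z._+ x) (Z.+-comm 1ℤ x))

  -- Orthogonalization: v = e₀, then w orthogonal to v, then u orthogonal to both. Either one of
  -- them is isotropic, or x² Q(v) + y² Q(w) = - Q(u) has a solution, where Q is the form of M, and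
  -- x v + y w + u is isotropic.
  isotropic : ∀ M → ∃[ p ] ¬ p ≋ 0ᵥ × quad M p ≈ 0#
  isotropic M = step₁ (quad M e₀ ≟ 0#)
    where
    Result : Set _
    Result = ∃[ p ] ¬ p ≋ 0ᵥ × quad M p ≈ 0#

    step₃ : ∀ v w u → ¬ quad M v ≈ 0# → ¬ quad M w ≈ 0# → ¬ u ≋ 0ᵥ →
      bil M v w ≈ 0# → bil M v u ≈ 0# → bil M w u ≈ 0# → Dec (quad M u ≈ 0#) → Result
    step₃ v w u _ _ u≉0 _ _ _ (yes Qu≈0) = u , u≉0 , Qu≈0
    step₃ v w u Qv≉0 Qw≉0 _ vw vu wu (no Qu≉0) =
      let x , y , eq = two-squares Qv≉0 Qw≉0 (- quad M u)
          p = (x *ᵥ v +ᵥ y *ᵥ w) +ᵥ u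
      in p ,
        -- The vector p is nonzero because its pairing with u equals `quad M u`.
        (λ p≋0 → Qu≉0 (trans (sym (+-identityˡ _)) (trans (+-congʳ (sym (0+0≈0 (*0≈0 x vu) (*0≈0 y wu))))
          (trans (sym (bil-combine M x v y w u)) (trans (bil-sym M p u) (dot-0 (app M u) p≋0)))))) ,
        trans (quad-combine M x v y w u) (0+0≈0
          (trans (+-congʳ (trans (+-cong (*-comm (x * x) (quad M v)) (*-comm (y * y) (quad M w))) eq)) (-‿inverseˡ (quad M u)))
          (0+0≈0 (0+0≈0 (*0≈0 _ vw) (*0≈0 _ vu)) (*0≈0 _ wu)))

    step₂ : ∀ v w → ¬ quad M v ≈ 0# → ¬ w ≋ 0ᵥ → bil M v w ≈ 0# → Dec (quad M w ≈ 0#) → Result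
    step₂ v w _ w≉0 _ (yes Qw≈0) = w , w≉0 , Qw≈0
    step₂ v w Qv≉0 _ vw (no Qw≉0) =
      let u , u≉0 , vu , wu = orthogonal₂ (app M v) (app M w)
      in step₃ v w u Qv≉0 Qw≉0 u≉0 vw vu wu (quad M u ≟ 0#)

    step₁ : Dec (quad M e₀ ≈ 0#) → Result
    step₁ (yes Qe₀≈0) = e₀ , (λ eq → 0≉1 (sym (eq 0F))) , Qe₀≈0
    step₁ (no  Qe₀≉0) =
      let w , w≉0 , vw = orthogonal₁ (app M e₀)
      in step₂ e₀ w Qe₀≉0 w≉0 vw (quad M w ≟ 0#)

  ∑-unique : ∀ {p} {A : Pred Carrier p} (A? : Decidable A) s₀ → (∀ {s} → A s → s ≈ s₀) → (∀ {s} → s ≈ s₀ → A s) →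
    ∑[ s ∈ 𝔽 ] 𝟙 (A? s) ≡ 1ℤ
  ∑-unique A? s₀ to from = ≡.trans (∑-cong 𝔽 λ s → 𝟙-cong (A? s) (s ≟ s₀) to from) (Enumeration.once 𝔽-enumeration s₀)

  ζ : Vector Carrier 6 → ℤ
  ζ M = ∑[ ℓ ∈ 𝕍 3 ] 𝟙 (quad M ℓ ≟ 0#)

  private
    quad≟0-cong : ∀ M {v w} → v ≋ w → 𝟙 (quad M v ≟ 0#) ≡ 𝟙 (quad M w ≟ 0#)
    quad≟0-cong M {v} {w} v≋w = 𝟙-cong (quad M v ≟ 0#) (quad M w ≟ 0#) (trans (sym eq)) (trans eq)
      where
      eq : quad M v ≈ quad M w
      eq = quad-cong {M} {M} ≋-refl v≋w

  -- In characteristic 2 the form is additive and s ↦ s² is bijective, so every line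
  -- in a direction e with quad M e ≉ 0 carries exactly one isotropic vector.
  ζ-nonsingular-2≈0 : 2≈0 → ∀ M → ¬ det M ≈ 0# → ζ M ≡ Q Z.^ 2
  ζ-nonsingular-2≈0 2≈0 M det≉0 = cancel-Q (ζ M) (Q Z.^ 2) (begin
    Q Z.* ζ M                                                  ≡⟨ ∑-average e (quad≟0-cong M) ⟩
    ∑[ v ∈ 𝕍 3 ] ∑[ s ∈ 𝔽 ] 𝟙 (quad M (v +ᵥ s *ᵥ e) ≟ 0#)      ≡⟨ ∑-cong (𝕍 3) one ⟩
    ∑[ v ∈ 𝕍 3 ] 1ℤ                                            ≡⟨ ∑ᵛ-1 3 ⟩
    Q Z.^ 3                                                    ∎)
    where
    open ≡-Reasoning
    nonisotropic : Dec (M 0F ≈ 0#) → Dec (M 3F ≈ 0#) → Dec (M 5F ≈ 0#) → ∃[ e ] ¬ quad M e ≈ 0#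
    nonisotropic (no M₀≉0) _ _ = e₀ , λ eq → M₀≉0 (trans (sym (quad-e₀ M)) eq)
    nonisotropic (yes _) (no M₃≉0) _ = e₁ , λ eq → M₃≉0 (trans (sym (quad-e₁ M)) eq)
    nonisotropic (yes _) (yes _) (no M₅≉0) = e₂ , λ eq → M₅≉0 (trans (sym (quad-e₂ M)) eq)
    nonisotropic (yes M₀≈0) (yes M₃≈0) (yes M₅≈0) = contradiction
      (trans (det-expand M) (0+0≈0 (0+0≈0 (*0≈0 _ M₀≈0) (*0≈0 _ M₃≈0)) (0+0≈0 (*0≈0 _ M₅≈0) (*0≈0 _ 2≈0)))) det≉0
    e : Vector Carrier 3
    e = proj₁ (nonisotropic (M 0F ≟ 0#) (M 3F ≟ 0#) (M 5F ≟ 0#))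
    Qe≉0 : ¬ quad M e ≈ 0#
    Qe≉0 = proj₂ (nonisotropic (M 0F ≟ 0#) (M 3F ≟ 0#) (M 5F ≟ 0#))
    along : ∀ v s → quad M (v +ᵥ s *ᵥ e) ≈ quad M v + scaled-square (quad M e) s
    along v s = trans (quad-along M v s e)
      (trans (+-congˡ (double 2≈0 _)) (trans (+-identityʳ _) (+-congˡ (*-comm (s * s) (quad M e)))))
    one : ∀ v → ∑[ s ∈ 𝔽 ] 𝟙 (quad M (v +ᵥ s *ᵥ e) ≟ 0#) ≡ 1ℤ
    one v = let s₀ , eq = scaled-square-surjective 2≈0 Qe≉0 (- quad M v) in
      ∑-unique (λ s → quad M (v +ᵥ s *ᵥ e) ≟ 0#) s₀
        (λ {s} Q≈0 → scaled-square-injective 2≈0 Qe≉0 (trans (y≈-x (trans (sym (along v s)) Q≈0)) eq))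
        (λ {s} s≈s₀ → trans (along v s) (trans (+-congˡ (trans (scaled-square-cong _ s≈s₀) (sym eq))) (-‿inverseʳ _)))

  -- In odd characteristic, a line through an isotropic p that is not orthogonal
  -- to p carries exactly one further isotropic point.
  ζ-nonsingular-2≉0 : ¬ 2≈0 → ∀ M → ¬ det M ≈ 0# → ζ M ≡ Q Z.^ 2
  ζ-nonsingular-2≉0 2≉0 M det≉0 = begin
    ζ M                                                     ≡⟨ ∑-cong (𝕍 3) (λ x → 𝟙-split (quad M x ≟ 0#) (bil M p x ≟ 0#)) ⟩
    ∑[ x ∈ 𝕍 3 ] (𝟙 (off? x) Z.+ 𝟙 (on? x))                 ≡⟨ ∑-+ (𝕍 3) _ _ ⟩
    (∑[ x ∈ 𝕍 3 ] 𝟙 (off? x)) Z.+ (∑[ x ∈ 𝕍 3 ] 𝟙 (on? x))  ≡⟨ cong₂ Z._+_ (cancel-Q _ _ off-count) on-count ⟩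
    (Q Z.* Q Z.- Q) Z.+ Q                                   ≡⟨ ℤ-Solver.identity (Q ∷ᵥ []ᵥ) ((var 0F :* var 0F :- var 0F) :+ var 0F) (var 0F :* (var 0F :* con 1ℤ)) ⟩
    Q Z.^ 2                                                 ∎
    where
    open ≡-Reasoning
    open ℤ-Solver using (var; con; _:+_; _:*_; _:-_)
    p : Vector Carrier 3
    p = proj₁ (isotropic M)
    p≉0 : ¬ p ≋ 0ᵥ
    p≉0 = proj₁ (proj₂ (isotropic M))
    Qp≈0 : quad M p ≈ 0#
    Qp≈0 = proj₂ (proj₂ (isotropic M))
    n≉0 : ¬ app M p ≋ 0ᵥ
    n≉0 n≋0 = p≉0 (det≉0⇒kernel≋0 M p det≉0 n≋0)
    -- The isotropic vectors are split by the plane p⊥. Those off it are counted along lines of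
    -- direction p; those on it turn out to be the multiples of p.
    off? : ∀ x → Dec (quad M x ≈ 0# × ¬ bil M p x ≈ 0#)
    off? x = (quad M x ≟ 0#) ×-dec ¬? (bil M p x ≟ 0#)
    on? : ∀ x → Dec (quad M x ≈ 0# × bil M p x ≈ 0#)
    on? x = (quad M x ≟ 0#) ×-dec (bil M p x ≟ 0#)
    bil-p-cong : ∀ {v w} → v ≋ w → bil M p v ≈ bil M p w
    bil-p-cong v≋w = bil-cong {M} {M} ≋-refl (≋-refl {x = p}) v≋w
    off-resp : ∀ {v w} → v ≋ w → quad M v ≈ 0# × ¬ bil M p v ≈ 0# → quad M w ≈ 0# × ¬ bil M p w ≈ 0#
    off-resp v≋w (Qv≈0 , n·v≉0) = trans (quad-cong {M} {M} ≋-refl (≋-sym v≋w)) Qv≈0 , λ eq → n·v≉0 (trans (bil-p-cong v≋w) eq)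
    on-resp : ∀ {v w} → v ≋ w → quad M v ≈ 0# × bil M p v ≈ 0# → quad M w ≈ 0# × bil M p w ≈ 0#
    on-resp v≋w (Qv≈0 , n·v≈0) = trans (quad-cong {M} {M} ≋-refl (≋-sym v≋w)) Qv≈0 , trans (bil-p-cong (≋-sym v≋w)) n·v≈0

    bil-along : ∀ v s → bil M p (v +ᵥ s *ᵥ p) ≈ bil M p v
    bil-along v s = trans (dot-+ʳ (app M p) v (s *ᵥ p)) (trans (+-congˡ (trans (dot-*ʳ (app M p) s p) (*0≈0 s Qp≈0))) (+-identityʳ _))
    t : Vector Carrier 3 → Carrier
    t v = bil M p v + bil M p v
    along : ∀ v s → quad M (v +ᵥ s *ᵥ p) ≈ quad M v + t v * s
    along v s = trans (quad-along M v s p) (+-cong (trans (+-congˡ (*0≈0 (s * s) Qp≈0)) (+-identityʳ _))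
      (trans (+-cong (*-comm s _) (*-comm s _)) (trans (sym (distribʳ s _ _)) (*-congʳ (+-cong (bil-sym M v p) (bil-sym M v p))))))

    one : ∀ v (d : Dec (bil M p v ≈ 0#)) → ∑[ s ∈ 𝔽 ] 𝟙 (off? (v +ᵥ s *ᵥ p)) ≡ 𝟙 (¬? d)
    one v (yes n·v≈0) = ≡.trans (∑-cong 𝔽 λ s → 𝟙-no (off? (v +ᵥ s *ᵥ p)) λ (_ , ≉0) → ≉0 (trans (bil-along v s) n·v≈0)) (∑-0 𝔽)
    one v (no n·v≉0) = let t⁻¹ , tt⁻¹≈1 = inverse {t v} (λ eq → n·v≉0 (x+x≈0⇒x≈0 2≉0 eq)) in
      ∑-unique (λ s → off? (v +ᵥ s *ᵥ p)) (t⁻¹ * - quad M v)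
        (λ {s} (Q≈0 , _) → trans (sym (inverse-cancel tt⁻¹≈1 s)) (*-congˡ (y≈-x (trans (sym (along v s)) Q≈0))))
        (λ {s} s≈ → trans (along v s) (trans (+-congˡ (trans (*-congˡ s≈) (trans (sym (*-assoc (t v) t⁻¹ _)) (trans (*-congʳ tt⁻¹≈1) (*-identityˡ _))))) (-‿inverseʳ _))
          , λ eq → n·v≉0 (trans (sym (bil-along v s)) eq))

    off-count : Q Z.* (∑[ x ∈ 𝕍 3 ] 𝟙 (off? x)) ≡ Q Z.* (Q Z.* Q Z.- Q)
    off-count = begin
      Q Z.* (∑[ x ∈ 𝕍 3 ] 𝟙 (off? x))                         ≡⟨ ∑-average p (λ {v} {w} v≋w → 𝟙-cong (off? v) (off? w) (off-resp v≋w) (off-resp (≋-sym v≋w))) ⟩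
      ∑[ v ∈ 𝕍 3 ] ∑[ s ∈ 𝔽 ] 𝟙 (off? (v +ᵥ s *ᵥ p))          ≡⟨ ∑-cong (𝕍 3) (λ v → one v (bil M p v ≟ 0#)) ⟩
      ∑[ v ∈ 𝕍 3 ] 𝟙 (¬? (dot (app M p) v ≟ 0#))              ≡⟨ ∑-nonorthogonal (app M p) n≉0 ⟩
      Q Z.^ 3 Z.- Q Z.^ 2                                     ≡⟨ ℤ-Solver.identity (Q ∷ᵥ []ᵥ)
                                                                   (var 0F :* (var 0F :* (var 0F :* con 1ℤ)) :- var 0F :* (var 0F :* con 1ℤ)) (var 0F :* (var 0F :* var 0F :- var 0F)) ⟩
      Q Z.* (Q Z.* Q Z.- Q)                                   ∎

    on-count : ∑[ x ∈ 𝕍 3 ] 𝟙 (on? x) ≡ Q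
    on-count = ∑-line on? on-resp 0ᵥ p≉0
      (λ s → trans (along 0ᵥ s) (0+0≈0 (dot-0 (app M 0ᵥ) (≋-refl {x = 0ᵥ})) (0*≈0 s (0+0≈0 n·0 n·0))) , trans (bil-along 0ᵥ s) n·0)
      (λ {x} (Qx≈0 , n·x≈0) → multiple x Qx≈0 n·x≈0 (cross p x ≟ᵛ 0ᵥ))
      where
      n·0 : bil M p 0ᵥ ≈ 0#
      n·0 = dot-0 (app M p) (≋-refl {x = 0ᵥ})
      multiple : ∀ x → quad M x ≈ 0# → bil M p x ≈ 0# → Dec (cross p x ≋ 0ᵥ) → ∃[ s ] x ≋ (0ᵥ +ᵥ s *ᵥ p)
      multiple x _ _ (yes p×x≋0) = let r , p·r≈1 = dual p≉0 in
        dot x r , λ i → trans (parallel p x r p·r≈1 p×x≋0 i) (sym (+-identityˡ _))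
      -- Otherwise M p and M x are both parallel to p × x, so M has a kernel.
      multiple x Qx≈0 n·x≈0 (no v≉0) = contradiction (det≉0⇒kernel≋0 M p det≉0 Mp≋0) p≉0
        where
        v : Vector Carrier 3
        v = cross p x
        r : Vector Carrier 3
        r = proj₁ (dual v≉0)
        v·r≈1 : dot v r ≈ 1#
        v·r≈1 = proj₂ (dual v≉0)
        ∥v : ∀ y → dot y p ≈ 0# → dot y x ≈ 0# → y ≋ (dot y r *ᵥ v)
        ∥v y y·p≈0 y·x≈0 = parallel v y r v·r≈1 (λ i → trans (anti i) (-0≈0 (trans (cross-cross y p x i)
          (0+0≈0 (0*≈0 (p i) y·x≈0) (-0≈0 (0*≈0 (x i) y·p≈0))))))
          where
          anti : ∀ i → cross v y i ≈ - cross y v i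
          anti = cross-anti v y
        α β : Carrier
        α = dot (app M p) r
        β = dot (app M x) r
        -- Since M p = α v and M x = β v, the vector β p - α x lies in the kernel of M and so
        -- vanishes. Its cross product with p is - α v, which forces α = 0.
        k : Vector Carrier 3
        k = β *ᵥ p +ᵥ (- α) *ᵥ x
        Mk≋0 : app M k ≋ 0ᵥ
        Mk≋0 i = trans (app-combine M β p (- α) x i) (trans
          (+-cong (*-congˡ (∥v (app M p) Qp≈0 n·x≈0 i)) (*-congˡ (∥v (app M x) (trans (bil-sym M x p) n·x≈0) Qx≈0 i)))
          (Ring-Solver.identity (α ∷ᵥ β ∷ᵥ v i ∷ᵥ []ᵥ)
            (b R.:* (a R.:* w) R.:+ (R.:- a) R.:* (b R.:* w)) (R.con 0ℤ)))
          where
          module R = Ring-Solver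
          a b w : R.Polynomial 3
          a = R.var 0F
          b = R.var 1F
          w = R.var 2F
        α≈0 : α ≈ 0#
        α≈0 = trans (sym (*-identityʳ α)) (trans (*-congˡ (sym v·r≈1)) (trans (sym (-‿involutive _)) (-0≈0 (trans (scaled) (dot-0′ r (cross-0ʳ p (det≉0⇒kernel≋0 M k det≉0 Mk≋0)))))))
          where
          scaled : - (α * dot v r) ≈ dot (cross p k) r
          scaled = cross-combine p x r α β
        Mp≋0 : app M p ≋ 0ᵥ
        Mp≋0 i = trans (∥v (app M p) Qp≈0 n·x≈0 i) (0*≈0 (v i) α≈0)

  ζ-nonsingular : ∀ M → ¬ det M ≈ 0# → ζ M ≡ Q Z.^ 2
  ζ-nonsingular M det≉0 = by (1# + 1# ≟ 0#)
    where
    by : Dec 2≈0 → ζ M ≡ Q Z.^ 2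
    by (yes 2≈0) = ζ-nonsingular-2≈0 2≈0 M det≉0
    by (no  2≉0) = ζ-nonsingular-2≉0 2≉0 M det≉0

  -- Presentations of a matrix as a tangent matrix

  -- The vector z is (μ , λ), in the order value, gradient of the dual conditions. The sum M + T
  -- replaces the equation M = T so that the pairs (m , z) for M = M_m form the kernel of a linear
  -- map.
  TangentAt : Vector Carrier 6 → Vector Carrier 3 → Pred (Vector Carrier 4) ℓ₁
  TangentAt M P z = (M +ᵥ tangent P (tail z) (head z)) ≋ 0ᵥ

  tangentAt? : ∀ M P → Decidable (TangentAt M P)
  tangentAt? M P z = (M +ᵥ tangent P (tail z) (head z)) ≟ᵛ 0ᵥ

  φ : Vector Carrier 6 → Vector Carrier 3 → ℤ
  φ M P = ∑[ z ∈ 𝕍 4 ] 𝟙 (tangentAt? M P z)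

  private
    -𝟚 : Carrier
    -𝟚 = - (1# + 1#)

    s*-𝟚 : ∀ s → s * -𝟚 ≈ - (s + s)
    s*-𝟚 s = identity (s ∷ᵥ []ᵥ) (var 0F :* (:- (con 1ℤ :+ con 1ℤ))) (:- (var 0F :+ var 0F))
      where open Ring-Solver

  -- Applying the zero matrix to r, where P · r = 1, gives (κ · r) P + κ + ν P = 0, so κ = s P.
  -- Pairing κ with r then yields κ · r = s, and with it ν = - 2 s.
  tangent-kernel⁻¹ : ∀ P r κ ν → dot P r ≈ 1# → tangent P κ ν ≋ 0ᵥ → ∃[ s ] κ ≋ (s *ᵥ P) × ν ≈ - (s + s)
  tangent-kernel⁻¹ P r κ ν P·r≈1 T≋0 = s , κ≋sP , ν≈
    where
    s : Carrier
    s = - (dot κ r + ν)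
    κ≋sP : κ ≋ (s *ᵥ P)
    κ≋sP i = x-y≈0⇒x≈y (begin
      κ i - s * P i
        ≈⟨ identity (κ i ∷ᵥ dot κ r ∷ᵥ ν ∷ᵥ P i ∷ᵥ []ᵥ) (var 0F :- (:- (var 1F :+ var 2F)) :* var 3F)
             (var 1F :* var 3F :+ (con 1ℤ :* var 0F :+ (var 2F :* con 1ℤ) :* var 3F)) ⟩
      dot κ r * P i + (1# * κ i + (ν * 1#) * P i)
        ≈⟨ +-congˡ (+-cong (*-congʳ P·r≈1) (*-congʳ (*-congˡ P·r≈1))) ⟨
      dot κ r * P i + (dot P r * κ i + (ν * dot P r) * P i)
        ≈⟨ app-tangent₀ P κ ν r i ⟨
      app (tangent P κ ν) r i
        ≈⟨ app-0ˡ (tangent P κ ν) r T≋0 i ⟩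
      0# ∎)
      where
      open ≈-Reasoning setoid
      open Ring-Solver
    κ·r≈s : dot κ r ≈ s
    κ·r≈s = trans (dot-cong κ≋sP (≋-refl {x = r})) (trans (dot-comm (s *ᵥ P) r) (trans (dot-*ʳ r s P)
      (trans (*-congˡ (trans (dot-comm r P) P·r≈1)) (*-identityʳ s))))
    ν≈ : ν ≈ - (s + s)
    ν≈ = trans (identity (ν ∷ᵥ dot κ r ∷ᵥ []ᵥ) (var 0F) (:- (var 1F :+ (:- (var 1F :+ var 0F))))) (-‿cong (+-congʳ κ·r≈s))
      where open Ring-Solver

  φ-empty : ∀ M P → ¬ ∃ (TangentAt M P) → φ M P ≡ 0ℤ
  φ-empty M P ∄ = ≡.trans (∑-cong (𝕍 4) λ z → 𝟙-no (tangentAt? M P z) λ t → ∄ (z , t)) (∑-0 (𝕍 4))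

  TangentAt-resp : ∀ M P {z w} → z ≋ w → TangentAt M P z → TangentAt M P w
  TangentAt-resp M P {z} {w} z≋w t i = trans (+-congˡ (sym (tangent-cong {P} ≋-refl (λ j → z≋w (Fin.suc j)) (z≋w 0F) i))) (t i)

  -- The solutions form a coset of the kernel of (λ , μ) ↦ tangent P λ μ.
  φ-fibre : ∀ M P z₀ → ¬ P ≋ 0ᵥ → TangentAt M P z₀ → φ M P ≡ Q
  φ-fibre M P z₀ P≉0 t₀ = ∑-line (tangentAt? M P) (TangentAt-resp M P) z₀ d≉0 on-line param
    where
    -- The generator of the kernel, `tangent-kernel` at s = 1: μ = - 2 and λ = P.
    d : Vector Carrier 4
    d = -𝟚 ∷ P
    d≉0 : ¬ d ≋ 0ᵥ
    d≉0 eq = P≉0 λ i → eq (Fin.suc i)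
    shift : ∀ z κ ν → (M +ᵥ tangent P (tail z +ᵥ κ) (head z + ν)) ≋ ((M +ᵥ tangent P (tail z) (head z)) +ᵥ tangent P κ ν)
    shift z κ ν i = trans (+-congˡ (tangent-+ P (tail z) (head z) κ ν i)) (sym (+-assoc _ _ _))
    on-line : ∀ s → TangentAt M P (z₀ +ᵥ s *ᵥ d)
    on-line s i = trans (+-congˡ (tangent-cong {P} {P} {tail z₀ +ᵥ s *ᵥ P} {tail z₀ +ᵥ s *ᵥ P} ≋-refl ≋-refl (+-congˡ (s*-𝟚 s)) i))
      (trans (shift z₀ (s *ᵥ P) (- (s + s)) i) (0+0≈0 (t₀ i) (tangent-kernel P s i)))
    param : ∀ {z} → TangentAt M P z → ∃[ s ] z ≋ (z₀ +ᵥ s *ᵥ d)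
    param {z} t =
      let r , P·r≈1 = dual P≉0
          s , κ≋ , ν≈ = tangent-kernel⁻¹ P r κ ν P·r≈1 T≋0
      in s , λ { Fin.zero → trans (sym (back (head z₀) (head z))) (+-congˡ (trans ν≈ (sym (s*-𝟚 s))))
               ; (Fin.suc i) → trans (sym (back (tail z₀ i) (tail z i))) (+-congˡ (κ≋ i)) }
      where
      κ : Vector Carrier 3
      κ i = tail z i - tail z₀ i
      ν : Carrier
      ν = head z - head z₀
      back : ∀ x y → x + (y - x) ≈ y
      back x y = identity (x ∷ᵥ y ∷ᵥ []ᵥ) (var 0F :+ (var 1F :- var 0F)) (var 1F)
        where open Ring-Solver
      T≋0 : tangent P κ ν ≋ 0ᵥ
      T≋0 i = trans (sym (+-identityˡ _)) (trans (+-congʳ (sym (t₀ i))) (trans (sym (shift z₀ κ ν i))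
        (trans (+-congˡ (tangent-cong {P} ≋-refl (λ j → back (tail z₀ j) (tail z j)) (back (head z₀) (head z)) i)) (t i))))

  φ-at-0 : ∀ M {P} → P ≋ 0ᵥ → φ M P ≡ Q Z.^ 4 Z.* 𝟙 (M ≟ᵛ 0ᵥ)
  φ-at-0 M {P} P≋0 = begin
    φ M P                                     ≡⟨ ∑-cong (𝕍 4) (λ z → ≡.trans (𝟙-cong (tangentAt? M P z) (M ≟ᵛ 0ᵥ)
                                                   (λ t i → trans (sym (+-identityʳ _)) (trans (+-congˡ (sym (T≋0 z i))) (t i)))
                                                   (λ M≋0 i → 0+0≈0 (M≋0 i) (T≋0 z i))) (≡.sym (Z.*-identityˡ _))) ⟩
    ∑[ _ ∈ 𝕍 4 ] (1ℤ Z.* 𝟙 (M ≟ᵛ 0ᵥ))         ≡⟨ ∑-*ʳ (𝕍 4) _ _ ⟩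
    (∑[ _ ∈ 𝕍 4 ] 1ℤ) Z.* 𝟙 (M ≟ᵛ 0ᵥ)         ≡⟨ cong (Z._* 𝟙 (M ≟ᵛ 0ᵥ)) (∑ᵛ-1 4) ⟩
    Q Z.^ 4 Z.* 𝟙 (M ≟ᵛ 0ᵥ)                   ∎
    where
    open ≡-Reasoning
    T≋0 : ∀ z → tangent P (tail z) (head z) ≋ 0ᵥ
    T≋0 z i = trans (tangent-cong {P} {0ᵥ} {tail z} {tail z} P≋0 ≋-refl refl i) (tangent-at-0 (tail z) (head z) i)

  Φ : Vector Carrier 6 → ℤ
  Φ M = ∑[ P ∈ 𝕍 3 ] φ M P

  tangent≋- : ∀ M P z → TangentAt M P z → tangent P (tail z) (head z) ≋ (λ i → - M i)
  tangent≋- M P z t i = y≈-x (t i)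

  Φ-nonsingular : ∀ M → ¬ det M ≈ 0# → Φ M ≡ 0ℤ
  Φ-nonsingular M det≉0 = ≡.trans (∑-cong (𝕍 3) λ P → φ-empty M P λ (z , t) → det≉0 (trans
    (det-cong {M} {λ i → - tangent P (tail z) (head z) i} λ i → y≈-x (trans (+-comm _ _) (t i)))
    (det-tangent P (tail z) (head z)))) (∑-0 (𝕍 3))

  -- The zero matrix has q presentations at each of the q³ vectors P, except that at P = 0 all q⁴
  -- pairs qualify.
  Φ-zero : ∀ M → M ≋ 0ᵥ → Φ M ≡ Q Z.^ 3 Z.* Q Z.+ (Q Z.^ 4 Z.- Q)
  Φ-zero M M≋0 = begin
    Φ M                                                             ≡⟨ ∑-cong (𝕍 3) (λ P → pointwise P (P ≟ᵛ 0ᵥ)) ⟩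
    ∑[ P ∈ 𝕍 3 ] (1ℤ Z.* Q Z.+ 𝟙 (P ≟ᵛ 0ᵥ) Z.* (Q Z.^ 4 Z.- Q))      ≡⟨ ∑-+ (𝕍 3) _ _ ⟩
    (∑[ P ∈ 𝕍 3 ] (1ℤ Z.* Q)) Z.+ (∑[ P ∈ 𝕍 3 ] (𝟙 (P ≟ᵛ 0ᵥ) Z.* (Q Z.^ 4 Z.- Q)))
                                                                    ≡⟨ cong₂ Z._+_ (≡.trans (∑-*ʳ (𝕍 3) Q _) (cong (Z._* Q) (∑ᵛ-1 3)))
                                                                         (≡.trans (∑-*ʳ (𝕍 3) _ _) (≡.trans (cong (Z._* (Q Z.^ 4 Z.- Q)) (Enumeration.once (𝕍-enumeration 3) 0ᵥ)) (Z.*-identityˡ _))) ⟩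
    Q Z.^ 3 Z.* Q Z.+ (Q Z.^ 4 Z.- Q)                               ∎
    where
    open ≡-Reasoning
    open ℤ-Solver
    -- The trivial presentation, with μ written as - (0 + 0) to match `tangent-kernel` at s = 0.
    z₀ : Vector Carrier 4
    z₀ = - (0# + 0#) ∷ (λ _ → 0#)
    solution : ∀ P → TangentAt M P z₀
    solution P i = 0+0≈0 (M≋0 i) (trans (tangent-cong {P} ≋-refl (λ j → sym (zeroˡ (P j))) refl i) (tangent-kernel P 0# i))
    pointwise : ∀ P (d : Dec (P ≋ 0ᵥ)) → φ M P ≡ 1ℤ Z.* Q Z.+ 𝟙 d Z.* (Q Z.^ 4 Z.- Q)
    pointwise P (yes P≋0) = ≡.trans (φ-at-0 M P≋0) (≡.trans (cong (Z._*_ (Q Z.^ 4)) (𝟙-yes (M ≟ᵛ 0ᵥ) M≋0))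
      (identity (Q ∷ᵥ Q Z.^ 4 ∷ᵥ []ᵥ) (var 1F :* con 1ℤ) (con 1ℤ :* var 0F :+ con 1ℤ :* (var 1F :- var 0F))))
    pointwise P (no P≉0) = ≡.trans (φ-fibre M P z₀ P≉0 (solution P))
      (identity (Q ∷ᵥ Q Z.^ 4 ∷ᵥ []ᵥ) (var 0F) (con 1ℤ :* var 0F :+ con 0ℤ :* (var 1F :- var 0F)))

  -- Sort the isotropic ℓ by P = k × ℓ, where M k ≋ 0ᵥ: for P ≉ 0 both the isotropic ℓ with
  -- k × ℓ ≋ P and the presentations of M as a tangent matrix at P form a line
  -- or are absent, so both number q or 0.
  module _ (M : Vector Carrier 6) (M≉0 : ¬ M ≋ 0ᵥ) (k : Vector Carrier 3) (k≉0 : ¬ k ≋ 0ᵥ) (Mk≋0 : app M k ≋ 0ᵥ) where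

    private
      Over : Vector Carrier 3 → Pred (Vector Carrier 3) ℓ₁
      Over P ℓ = cross k ℓ ≋ P × quad M ℓ ≈ 0#

      over? : ∀ P → Decidable (Over P)
      over? P ℓ = (cross k ℓ ≟ᵛ P) ×-dec (quad M ℓ ≟ 0#)

      over-resp : ∀ P {v w} → v ≋ w → Over P v → Over P w
      over-resp P v≋w (k×v , Qv) = ≋-trans (cross-cong {k} ≋-refl (≋-sym v≋w)) k×v , trans (quad-cong {M} {M} ≋-refl (≋-sym v≋w)) Qv

      bil-k≈0 : ∀ v → bil M v k ≈ 0#
      bil-k≈0 v = trans (bil-sym M v k) (dot-0′ v Mk≋0)

      quad-along-k : ∀ v s → quad M (v +ᵥ s *ᵥ k) ≈ quad M v
      quad-along-k v s = trans (quad-along M v s k) (trans (+-cong (trans (+-congˡ (*0≈0 (s * s) (bil-k≈0 k))) (+-identityʳ _))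
        (0+0≈0 (*0≈0 s (bil-k≈0 v)) (*0≈0 s (bil-k≈0 v)))) (+-identityʳ _))

      cross-along-k : ∀ v s → cross k (v +ᵥ s *ᵥ k) ≋ cross k v
      cross-along-k v s i = trans (cross-+ k v s k i) (trans (+-congˡ (*0≈0 s (cross-self k i))) (+-identityʳ _))

      same-cross : ∀ v w → cross k v ≋ cross k w → ∃[ s ] v ≋ (w +ᵥ s *ᵥ k)
      same-cross v w eq = let r , k·r≈1 = dual k≉0 in dot d r , λ i →
        trans (back (w i) (v i)) (+-congˡ (trans (*-identityˡ (d i)) (parallel k d r k·r≈1 k×d≋0 i)))
        where
        d : Vector Carrier 3
        d = 1# *ᵥ v +ᵥ (- 1#) *ᵥ w
        back : ∀ x y → y ≈ x + 1# * (1# * y + (- 1#) * x)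
        back x y = identity (x ∷ᵥ y ∷ᵥ []ᵥ) (var 1F) (var 0F :+ con 1ℤ :* (con 1ℤ :* var 1F :+ (:- con 1ℤ) :* var 0F))
          where open Ring-Solver
        k×d≋0 : cross k d ≋ 0ᵥ
        k×d≋0 i = trans (cross-+ k (1# *ᵥ v) (- 1#) w i) (trans
          (+-cong (trans (cross-cong {k} ≋-refl (λ j → *-identityˡ (v j)) i) (eq i)) (-1*x≈-x _)) (-‿inverseʳ _))

      line-over : ∀ P ℓ₀ → Over P ℓ₀ → ∑[ ℓ ∈ 𝕍 3 ] 𝟙 (over? P ℓ) ≡ Q
      line-over P ℓ₀ (k×ℓ₀≋P , Qℓ₀≈0) = ∑-line (over? P) (over-resp P) ℓ₀ k≉0
        (λ s → ≋-trans (cross-along-k ℓ₀ s) k×ℓ₀≋P , trans (quad-along-k ℓ₀ s) Qℓ₀≈0)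
        (λ {ℓ} (k×ℓ≋P , _) → same-cross ℓ ℓ₀ (≋-trans k×ℓ≋P (≋-sym k×ℓ₀≋P)))

      none-over : ∀ P → ¬ ∃ (Over P) → ∑[ ℓ ∈ 𝕍 3 ] 𝟙 (over? P ℓ) ≡ 0ℤ
      none-over P ∄ = ≡.trans (∑-cong (𝕍 3) λ ℓ → 𝟙-no (over? P ℓ) λ o → ∄ (ℓ , o)) (∑-0 (𝕍 3))

      -- A tangent matrix T with M + T = 0 also annihilates k. As P · k ≠ 0, `tangent-recover`
      -- rebuilds T from T k = 0, so T and hence M would vanish.
      not-tangent : ∀ P → ¬ dot P k ≈ 0# → ¬ ∃ (TangentAt M P)
      not-tangent P P·k≉0 (z , t) = M≉0 λ i → trans (sym (-‿involutive (M i))) (-0≈0 (trans (sym (tangent≋- M P z t i)) (T≋0 i)))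
        where
        T : Vector Carrier 6
        T = tangent P (tail z) (head z)
        Tk≋0 : app T k ≋ 0ᵥ
        Tk≋0 i = trans (sym (+-identityˡ _)) (trans (+-congʳ (sym (Mk≋0 i))) (trans (sym (app-+ M T k i)) (app-0ˡ (M +ᵥ T) k t i)))
        T≋0 : T ≋ 0ᵥ
        T≋0 i = xy≈0⇒y≈0 (xy≉0 P·k≉0 P·k≉0) (trans (tangent-recover P (tail z) (head z) k i)
          (trans (tangent-cong {P} {P} {_} {0# *ᵥ P} {_} { - (0# + 0#)} ≋-refl
            (λ j → trans (*0≈0 (dot P k) (Tk≋0 j)) (sym (zeroˡ (P j))))
            (-‿cong (trans (dot-0 k Tk≋0) (sym (+-identityˡ 0#)))) i)
            (tangent-kernel P 0# i)))

      module _ (P : Vector Carrier 3) (P≉0 : ¬ P ≋ 0ᵥ) (P·k≈0 : dot P k ≈ 0#) (ℓ₀ : Vector Carrier 3) (k×ℓ₀≋P : cross k ℓ₀ ≋ P) where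

        P·ℓ₀≈0 : dot P ℓ₀ ≈ 0#
        P·ℓ₀≈0 = trans (dot-comm P ℓ₀) (trans (dot-cong (≋-refl {x = ℓ₀}) (≋-sym k×ℓ₀≋P)) (dot-crossʳ k ℓ₀))

        tangent⇒isotropic : ∃ (TangentAt M P) → quad M ℓ₀ ≈ 0#
        tangent⇒isotropic (z , t) = trans (sym (+-identityʳ _)) (trans (+-congˡ (sym QT≈0)) (trans (sym (quad-+ M T ℓ₀)) (dot-0′ ℓ₀ (app-0ˡ (M +ᵥ T) ℓ₀ t))))
          where
          T : Vector Carrier 6
          T = tangent P (tail z) (head z)
          QT≈0 : quad T ℓ₀ ≈ 0#
          QT≈0 = trans (quad-tangent P (tail z) (head z) ℓ₀) (*0≈0 _ P·ℓ₀≈0)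

        -- With P · r = 1 the choice λ = - M r, μ = rᵗ M r makes N = M + T annihilate r. It also
        -- annihilates k and ℓ₀, and r, k, ℓ₀ form a basis because r · (k × ℓ₀) = r · P = 1.
        isotropic⇒tangent : quad M ℓ₀ ≈ 0# → ∃ (TangentAt M P)
        isotropic⇒tangent Qℓ₀≈0 = (quad M r ∷ κ) , N≋0
          where
          r : Vector Carrier 3
          r = proj₁ (dual P≉0)
          P·r≈1 : dot P r ≈ 1#
          P·r≈1 = proj₂ (dual P≉0)
          κ : Vector Carrier 3
          κ i = - app M r i
          κ· : ∀ x → dot κ x ≈ - bil M r x
          κ· x = trans (dot-cong {v = x} (λ i → sym (-1*x≈-x (app M r i))) ≋-refl) (trans (dot-comm ((- 1#) *ᵥ app M r) x)
            (trans (dot-*ʳ x (- 1#) (app M r)) (trans (-1*x≈-x _) (-‿cong (dot-comm x (app M r))))))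
          N : Vector Carrier 6
          N = M +ᵥ tangent P κ (quad M r)
          Nk≋0 : app N k ≋ 0ᵥ
          Nk≋0 i = trans (app-tangent M P κ (quad M r) k i) (0+0≈0
            (0+0≈0 (Mk≋0 i) (0*≈0 (P i) (trans (κ· k) (-0≈0 (bil-k≈0 r)))))
            (0+0≈0 (0*≈0 (κ i) P·k≈0) (0*≈0 (P i) (*0≈0 _ P·k≈0))))
          Nr≋0 : app N r ≋ 0ᵥ
          Nr≋0 i = trans (app-tangent M P κ (quad M r) r i) (trans
            (+-cong (+-congˡ (*-congʳ (κ· r))) (+-cong (*-congʳ P·r≈1) (*-congʳ (*-congˡ P·r≈1))))
            (identity (app M r i ∷ᵥ quad M r ∷ᵥ P i ∷ᵥ []ᵥ)
              ((var 0F :+ (:- var 1F) :* var 2F) :+ (con 1ℤ :* (:- var 0F) :+ (var 1F :* con 1ℤ) :* var 2F)) (con 0ℤ)))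
            where open Ring-Solver
          frame : dot r (cross k ℓ₀) ≈ 1#
          frame = trans (dot-cong (≋-refl {x = r}) k×ℓ₀≋P) (trans (dot-comm r P) P·r≈1)
          Nℓ₀≋0 : app N ℓ₀ ≋ 0ᵥ
          Nℓ₀≋0 i = trans (app-tangent M P κ (quad M r) ℓ₀ i) (trans
            (+-cong (+-congˡ (*-congʳ (κ· ℓ₀))) (0+0≈0 (0*≈0 (κ i) P·ℓ₀≈0) (0*≈0 (P i) (*0≈0 _ P·ℓ₀≈0))))
            (trans (+-identityʳ _) (w≋0 i)))
            where
            β : Carrier
            β = bil M r ℓ₀
            -- Since P · ℓ₀ = 0, N ℓ₀ reduces to M ℓ₀ - β P. This is orthogonal to r by the choice
            -- of β, to k because M k = 0, and to ℓ₀ because ℓ₀ is isotropic.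
            w : Vector Carrier 3
            w = app M ℓ₀ +ᵥ (- β) *ᵥ P
            w· : ∀ x → dot w x ≈ bil M ℓ₀ x + (- β) * dot P x
            w· x = trans (dot-comm w x) (trans (dot-+ʳ x (app M ℓ₀) ((- β) *ᵥ P))
              (+-cong (dot-comm x (app M ℓ₀)) (trans (dot-*ʳ x (- β) P) (*-congˡ (dot-comm x P)))))
            w≋0 : w ≋ 0ᵥ
            w≋0 = orthogonal-to-basis r k ℓ₀ w frame
              (trans (w· r) (trans (+-cong (bil-sym M ℓ₀ r) (trans (*-congˡ P·r≈1) (*-identityʳ _))) (-‿inverseʳ β)))
              (trans (w· k) (0+0≈0 (bil-k≈0 ℓ₀) (*0≈0 _ P·k≈0)))
              (trans (w· ℓ₀) (0+0≈0 Qℓ₀≈0 (*0≈0 _ P·ℓ₀≈0)))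
          row≋0 : ∀ i → dot (row N i) r ≈ 0# → dot (row N i) k ≈ 0# → dot (row N i) ℓ₀ ≈ 0# → row N i ≋ 0ᵥ
          row≋0 i = orthogonal-to-basis r k ℓ₀ (row N i) frame
          N≋0 : N ≋ 0ᵥ
          N≋0 = ≋-ext₆ (row₀ 0F) (row₀ 1F) (row₀ 2F) (row₁ 1F) (row₁ 2F) (row₂ 2F)
            where
            row₀ : row N 0F ≋ 0ᵥ
            row₀ = row≋0 0F (Nr≋0 0F) (Nk≋0 0F) (Nℓ₀≋0 0F)
            row₁ : row N 1F ≋ 0ᵥ
            row₁ = row≋0 1F (Nr≋0 1F) (Nk≋0 1F) (Nℓ₀≋0 1F)
            row₂ : row N 2F ≋ 0ᵥ
            row₂ = row≋0 2F (Nr≋0 2F) (Nk≋0 2F) (Nℓ₀≋0 2F)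

        fibre-orthogonal : Dec (quad M ℓ₀ ≈ 0#) → ∑[ ℓ ∈ 𝕍 3 ] 𝟙 (over? P ℓ) ≡ φ M P
        fibre-orthogonal (yes Qℓ₀≈0) = ≡.trans (line-over P ℓ₀ (k×ℓ₀≋P , Qℓ₀≈0))
          (≡.sym (φ-fibre M P (proj₁ (isotropic⇒tangent Qℓ₀≈0)) P≉0 (proj₂ (isotropic⇒tangent Qℓ₀≈0))))
        fibre-orthogonal (no Qℓ₀≉0) = ≡.trans (none-over P λ (ℓ , k×ℓ≋P , Qℓ≈0) →
            let s , ℓ≋ = same-cross ℓ ℓ₀ (≋-trans k×ℓ≋P (≋-sym k×ℓ₀≋P)) in
            Qℓ₀≉0 (trans (sym (quad-along-k ℓ₀ s)) (trans (quad-cong {M} {M} ≋-refl (≋-sym ℓ≋)) Qℓ≈0)))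
          (≡.sym (φ-empty M P λ t → Qℓ₀≉0 (tangent⇒isotropic t)))

      -- Over P = 0 lie the q multiples of k, while M ≠ 0 has no presentation there: this is the q
      -- by which ζ exceeds Φ. If P · k ≠ 0, then P is no cross product with k and both sides
      -- vanish.
      fibre : ∀ P (d : Dec (P ≋ 0ᵥ)) → Dec (dot P k ≈ 0#) → ∑[ ℓ ∈ 𝕍 3 ] 𝟙 (over? P ℓ) ≡ φ M P Z.+ 𝟙 d Z.* Q
      fibre P (yes P≋0) _ = ≡.trans
        (line-over P 0ᵥ (≋-trans (cross-0ʳ k (≋-refl {x = 0ᵥ})) (≋-sym P≋0) , dot-0 (app M 0ᵥ) (≋-refl {x = 0ᵥ})))
        (≡.sym (≡.trans (cong₂ Z._+_ (≡.trans (φ-at-0 M P≋0) (≡.trans (cong (Z._*_ (Q Z.^ 4)) (𝟙-no (M ≟ᵛ 0ᵥ) M≉0)) (Z.*-zeroʳ _))) (Z.*-identityˡ Q)) (Z.+-identityˡ Q)))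
      fibre P (no P≉0) (no P·k≉0) = ≡.trans
        (none-over P λ (ℓ , k×ℓ≋P , _) → P·k≉0 (trans (dot-comm P k) (trans (dot-cong (≋-refl {x = k}) (≋-sym k×ℓ≋P)) (dot-crossˡ k ℓ))))
        (≡.sym (≡.trans (cong₂ Z._+_ (φ-empty M P (not-tangent P P·k≉0)) (Z.*-zeroˡ Q)) (Z.+-identityˡ 0ℤ)))
      fibre P (no P≉0) (yes P·k≈0) = ≡.trans
        (fibre-orthogonal P P≉0 P·k≈0 ℓ₀ k×ℓ₀≋P (quad M ℓ₀ ≟ 0#))
        (≡.sym (≡.trans (cong (Z._+_ (φ M P)) (Z.*-zeroˡ Q)) (Z.+-identityʳ _)))
        where
        -- For k · r = 1 and P · k = 0, the expansion k × (P × r) = (k · r) P - (k · P) r equals P.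
        r ℓ₀ : Vector Carrier 3
        r = proj₁ (dual k≉0)
        ℓ₀ = cross P r
        k×ℓ₀≋P : cross k ℓ₀ ≋ P
        k×ℓ₀≋P i = trans (cross-cross k P r i) (trans
          (+-cong (trans (*-congʳ (proj₂ (dual k≉0))) (*-identityˡ (P i))) (-0≈0 (0*≈0 (r i) (trans (dot-comm k P) P·k≈0)))) (+-identityʳ _))

    Φ-singular : ζ M ≡ Φ M Z.+ Q
    Φ-singular = begin
      ζ M
        ≡⟨ ∑-cong (𝕍 3) (λ ℓ → ≡.sym (≡.trans (∑-*ʳ (𝕍 3) (𝟙 (quad M ℓ ≟ 0#)) _)
             (≡.trans (cong (Z._* 𝟙 (quad M ℓ ≟ 0#)) (Enumeration.once (𝕍-enumeration 3) (cross k ℓ))) (Z.*-identityˡ _)))) ⟩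
      ∑[ ℓ ∈ 𝕍 3 ] ∑[ P ∈ 𝕍 3 ] (𝟙 (P ≟ᵛ cross k ℓ) Z.* 𝟙 (quad M ℓ ≟ 0#))
        ≡⟨ ∑-cong (𝕍 3) (λ ℓ → ∑-cong (𝕍 3) λ P → ≡.trans
             (cong (Z._* 𝟙 (quad M ℓ ≟ 0#)) (𝟙-cong (P ≟ᵛ cross k ℓ) (cross k ℓ ≟ᵛ P) ≋-sym ≋-sym))
             (≡.sym (𝟙-× (cross k ℓ ≟ᵛ P) (quad M ℓ ≟ 0#)))) ⟩
      ∑[ ℓ ∈ 𝕍 3 ] ∑[ P ∈ 𝕍 3 ] 𝟙 (over? P ℓ)
        ≡⟨ ∑-swap (𝕍 3) (𝕍 3) _ ⟩
      ∑[ P ∈ 𝕍 3 ] ∑[ ℓ ∈ 𝕍 3 ] 𝟙 (over? P ℓ)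
        ≡⟨ ∑-cong (𝕍 3) (λ P → fibre P (P ≟ᵛ 0ᵥ) (dot P k ≟ 0#)) ⟩
      ∑[ P ∈ 𝕍 3 ] (φ M P Z.+ 𝟙 (P ≟ᵛ 0ᵥ) Z.* Q)
        ≡⟨ ∑-+ (𝕍 3) _ _ ⟩
      Φ M Z.+ (∑[ P ∈ 𝕍 3 ] (𝟙 (P ≟ᵛ 0ᵥ) Z.* Q))
        ≡⟨ cong (Z._+_ (Φ M)) (≡.trans (∑-*ʳ (𝕍 3) Q _) (≡.trans (cong (Z._* Q) (Enumeration.once (𝕍-enumeration 3) 0ᵥ)) (Z.*-identityˡ Q))) ⟩
      Φ M Z.+ Q
        ∎
      where open ≡-Reasoning

  -- The cases are merged into one formula in indicators so that it can be summed over the line. For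
  -- M = 0 one has Φ M = 2 q⁴ - q and ζ M = q³, whence the constant 2 q⁴ - q³.
  Φ-ζ : ∀ M → Φ M Z.+ (Q Z.* 𝟙 (det M ≟ 0#) Z.+ Q Z.^ 2 Z.* (1ℤ Z.- 𝟙 (det M ≟ 0#)))
            ≡ ζ M Z.+ (Q Z.^ 4 Z.+ Q Z.^ 4 Z.- Q Z.^ 3) Z.* 𝟙 (M ≟ᵛ 0ᵥ)
  Φ-ζ M = by (det M ≟ 0#) (M ≟ᵛ 0ᵥ)
    where
    open ≡-Reasoning
    open ℤ-Solver
    by : (d : Dec (det M ≈ 0#)) (o : Dec (M ≋ 0ᵥ)) →
      Φ M Z.+ (Q Z.* 𝟙 d Z.+ Q Z.^ 2 Z.* (1ℤ Z.- 𝟙 d)) ≡ ζ M Z.+ (Q Z.^ 4 Z.+ Q Z.^ 4 Z.- Q Z.^ 3) Z.* 𝟙 o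
    by (no det≉0) (yes M≋0) = contradiction (trans (det-cong {M} {0ᵥ} M≋0) det-0) det≉0
    by (no det≉0) (no _) = begin
      Φ M Z.+ (Q Z.* 0ℤ Z.+ Q Z.^ 2 Z.* (1ℤ Z.- 0ℤ))   ≡⟨ cong (Z._+ _) (Φ-nonsingular M det≉0) ⟩
      0ℤ Z.+ (Q Z.* 0ℤ Z.+ Q Z.^ 2 Z.* (1ℤ Z.- 0ℤ))    ≡⟨ identity (Q ∷ᵥ Q Z.^ 2 ∷ᵥ C ∷ᵥ []ᵥ)
                                                          (con 0ℤ :+ (var 0F :* con 0ℤ :+ var 1F :* (con 1ℤ :- con 0ℤ))) (var 1F :+ var 2F :* con 0ℤ) ⟩
      Q Z.^ 2 Z.+ C Z.* 0ℤ                             ≡⟨ cong (Z._+ C Z.* 0ℤ) (ζ-nonsingular M det≉0) ⟨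
      ζ M Z.+ C Z.* 0ℤ                                 ∎
      where
      C : ℤ
      C = Q Z.^ 4 Z.+ Q Z.^ 4 Z.- Q Z.^ 3
    by (yes det≈0) (no M≉0) = begin
      Φ M Z.+ (Q Z.* 1ℤ Z.+ Q Z.^ 2 Z.* (1ℤ Z.- 1ℤ))   ≡⟨ identity (Φ M ∷ᵥ Q ∷ᵥ Q Z.^ 2 ∷ᵥ C ∷ᵥ []ᵥ)
                                                          (var 0F :+ (var 1F :* con 1ℤ :+ var 2F :* (con 1ℤ :- con 1ℤ))) ((var 0F :+ var 1F) :+ var 3F :* con 0ℤ) ⟩
      (Φ M Z.+ Q) Z.+ C Z.* 0ℤ                         ≡⟨ cong (Z._+ C Z.* 0ℤ) (Φ-singular M M≉0 (proj₁ (kernel M det≈0)) (proj₁ (proj₂ (kernel M det≈0))) (proj₂ (proj₂ (kernel M det≈0)))) ⟨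
      ζ M Z.+ C Z.* 0ℤ                                 ∎
      where
      C : ℤ
      C = Q Z.^ 4 Z.+ Q Z.^ 4 Z.- Q Z.^ 3
    by (yes det≈0) (yes M≋0) = begin
      Φ M Z.+ (Q Z.* 1ℤ Z.+ Q Z.^ 2 Z.* (1ℤ Z.- 1ℤ))                               ≡⟨ cong (Z._+ _) (Φ-zero M M≋0) ⟩
      (Q Z.^ 3 Z.* Q Z.+ (Q Z.^ 4 Z.- Q)) Z.+ (Q Z.* 1ℤ Z.+ Q Z.^ 2 Z.* (1ℤ Z.- 1ℤ))
        ≡⟨ identity (Q ∷ᵥ []ᵥ)
             ((q^ 3 :* var 0F :+ (q^ 4 :- var 0F)) :+ (var 0F :* con 1ℤ :+ q^ 2 :* (con 1ℤ :- con 1ℤ)))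
             (q^ 3 :+ ((q^ 4 :+ q^ 4) :- q^ 3) :* con 1ℤ) ⟩
      Q Z.^ 3 Z.+ (Q Z.^ 4 Z.+ Q Z.^ 4 Z.- Q Z.^ 3) Z.* 1ℤ                         ≡⟨ cong (Z._+ _) ζ-zero ⟨
      ζ M Z.+ (Q Z.^ 4 Z.+ Q Z.^ 4 Z.- Q Z.^ 3) Z.* 1ℤ                             ∎
      where
      q^_ : ℕ → Polynomial 1
      q^ zero  = con 1ℤ
      q^ suc n = var 0F :* q^ n
      ζ-zero : ζ M ≡ Q Z.^ 3
      ζ-zero = ≡.trans (∑-cong (𝕍 3) λ ℓ → 𝟙-yes (quad M ℓ ≟ 0#) (dot-0′ ℓ (app-0ˡ M ℓ M≋0))) (∑ᵛ-1 3)

  -- Singular points of conics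

  -- The value is required besides the gradient: Euler's relation controls only twice the value,
  -- which says nothing in characteristic 2.
  Singular : QuadraticForm → Pred (Vector Carrier 3) ℓ₁
  Singular f P = eval f P ≈ 0# × grad f P ≋ 0ᵥ

  singular? : ∀ f → Decidable (Singular f)
  singular? f P = (eval f P ≟ 0#) ×-dec (grad f P ≟ᵛ 0ᵥ)

  Singular-resp : ∀ f {P R} → P ≋ R → Singular f P → Singular f R
  Singular-resp f P≋R (e , g) = trans (eval-cong {f} {f} ≋-refl (≋-sym P≋R)) e , ≋-trans (grad-cong {f} {f} ≋-refl (≋-sym P≋R)) g

  σ : QuadraticForm → ℤ
  σ f = ∑[ P ∈ 𝕍 3 ] 𝟙 (singular? f P)

  -- Double lines defined over the field, and the zero form. In odd characteristic the coefficient a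
  -- also admits the multiples of ℓ² by nonsquares.
  IsSquare : Pred QuadraticForm _
  IsSquare f = ∃[ a ] ∃[ ℓ ] f ≋ (a *ᵥ square ℓ)

  isSquare? : Decidable IsSquare
  isSquare? f = any𝔽? (λ a≈b (ℓ , f≋) → ℓ , λ i → trans (f≋ i) (*-congʳ a≈b))
    (λ a → any𝕍? (λ {ℓ} {m} ℓ≋m f≋ i → trans (f≋ i) (*-congˡ (square-cong {ℓ} {m} ℓ≋m i))) (λ ℓ → f ≟ᵛ (a *ᵥ square ℓ)))

  zero-isSquare : ∀ {f} → f ≋ 0ᵥ → IsSquare f
  zero-isSquare f≋0 = 0# , 0ᵥ , λ i → trans (f≋0 i) (sym (zeroˡ _))

  isSquare⇒disc≈0 : ∀ f → IsSquare f → disc f ≈ 0#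
  isSquare⇒disc≈0 f (a , ℓ , f≋) = trans (disc-cong {f} {a *ᵥ square ℓ} f≋) (disc-square a ℓ)

  square≋0 : ∀ {ℓ} → ℓ ≋ 0ᵥ → square ℓ ≋ 0ᵥ
  square≋0 {ℓ} ℓ≋0 = ≋-ext₆ (by 0F 0F) (0+0≈0 (by 0F 1F) (by 0F 1F)) (0+0≈0 (by 0F 2F) (by 0F 2F)) (by 1F 1F) (0+0≈0 (by 1F 2F) (by 1F 2F)) (by 2F 2F)
    where
    by : ∀ i j → ℓ i * ℓ j ≈ 0#
    by i j = *0≈0 (ℓ i) (ℓ≋0 j)

  square-nonzero : ∀ {f a ℓ} → ¬ f ≋ 0ᵥ → f ≋ (a *ᵥ square ℓ) → (¬ a ≈ 0#) × (¬ ℓ ≋ 0ᵥ)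
  square-nonzero {a = a} {ℓ} f≉0 f≋ =
    (λ a≈0 → f≉0 λ i → trans (f≋ i) (0*≈0 _ a≈0)) ,
    (λ ℓ≋0 → f≉0 λ i → trans (f≋ i) (*0≈0 a (square≋0 {ℓ} ℓ≋0 i)))

  σ-zero : ∀ f → f ≋ 0ᵥ → σ f ≡ Q Z.^ 3
  σ-zero f f≋0 = ≡.trans (∑-cong (𝕍 3) λ P → 𝟙-yes (singular? f P) (e P , g P)) (∑ᵛ-1 3)
    where
    f≋ : f ≋ (0# *ᵥ square 0ᵥ)
    f≋ i = trans (f≋0 i) (sym (zeroˡ (square 0ᵥ i)))
    e : ∀ P → eval f P ≈ 0#
    e P = trans (eval-cong {f} {0# *ᵥ square 0ᵥ} f≋ (≋-refl {x = P})) (trans (eval-square 0# 0ᵥ P) (zeroˡ _))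
    g : ∀ P → grad f P ≋ 0ᵥ
    g P i = trans (grad-cong {f} {0# *ᵥ square 0ᵥ} f≋ (≋-refl {x = P}) i) (trans (grad-square 0# 0ᵥ P i) (0*≈0 _ (zeroʳ _)))

  -- The value a (ℓ · P)² alone cuts out the plane ℓ · P = 0, and the gradient 2 a (ℓ · P) ℓ
  -- vanishes on it.
  σ-square : ∀ f a ℓ → ¬ f ≋ 0ᵥ → f ≋ (a *ᵥ square ℓ) → σ f ≡ Q Z.^ 2
  σ-square f a ℓ f≉0 f≋ = ≡.trans
    (∑-cong (𝕍 3) λ P → 𝟙-cong (singular? f P) (dot ℓ P ≟ 0#) (to P) (from P))
    (∑-orthogonal ℓ (proj₂ (square-nonzero f≉0 f≋)))
    where
    to : ∀ P → Singular f P → dot ℓ P ≈ 0#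
    to P (e , _) = xx≈0⇒x≈0 (xy≈0⇒y≈0 (proj₁ (square-nonzero {ℓ = ℓ} f≉0 f≋))
      (trans (sym (trans (eval-cong {f} {a *ᵥ square ℓ} f≋ (≋-refl {x = P})) (eval-square a ℓ P))) e))
    from : ∀ P → dot ℓ P ≈ 0# → Singular f P
    from P ℓ·P≈0 =
      trans (eval-cong {f} {a *ᵥ square ℓ} f≋ (≋-refl {x = P})) (trans (eval-square a ℓ P) (*0≈0 a (*0≈0 _ ℓ·P≈0))) ,
      λ i → trans (grad-cong {f} {a *ᵥ square ℓ} f≋ (≋-refl {x = P}) i) (trans (grad-square a ℓ P i) (*0≈0 _ ℓ·P≈0))

  -- In a basis P, R, r all terms involving the coordinates along P and R vanish. What remains is
  -- f(r) times the square of the coordinate along r, which is the linear form of P × R.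
  two-singular⇒isSquare : ∀ f P R → Singular f P → Singular f R → ¬ cross P R ≋ 0ᵥ → IsSquare f
  two-singular⇒isSquare f P R (eP , gP) (eR , gR) ℓ≉0 = eval f r , ℓ , eval-injective f (eval f r *ᵥ square ℓ) same
    where
    ℓ r : Vector Carrier 3
    ℓ = cross P R
    r = proj₁ (dual ℓ≉0)
    D≈1 : dot P (cross R r) ≈ 1#
    D≈1 = trans (triple-cyclic P R r) (proj₂ (dual ℓ≉0))
    same : ∀ X → eval f X ≈ eval (eval f r *ᵥ square ℓ) X
    same X = begin
      eval f X
        ≈⟨ eval-cong {f} {f} ≋-refl (coordinates P R r X D≈1) ⟩
      eval f ((α *ᵥ P +ᵥ β *ᵥ R) +ᵥ γ *ᵥ r)
        ≈⟨ eval-combine f α β γ P R r ⟩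
      (((α * α) * eval f P + (β * β) * eval f R) + (γ * γ) * eval f r) +
      (((α * β) * dot R (grad f P) + (α * γ) * dot r (grad f P)) + (β * γ) * dot r (grad f R))
        ≈⟨ +-cong (trans (+-congʳ (0+0≈0 (*0≈0 _ eP) (*0≈0 _ eR))) (+-identityˡ _))
             (0+0≈0 (0+0≈0 (*0≈0 _ (dot-0 R gP)) (*0≈0 _ (dot-0 r gP))) (*0≈0 _ (dot-0 r gR))) ⟩
      (γ * γ) * eval f r + 0#
        ≈⟨ trans (+-identityʳ _) (*-comm _ _) ⟩
      eval f r * (γ * γ)
        ≈⟨ *-congˡ (*-cong (dot-comm X ℓ) (dot-comm X ℓ)) ⟩
      eval f r * (dot ℓ X * dot ℓ X)
        ≈⟨ eval-square (eval f r) ℓ X ⟨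
      eval (eval f r *ᵥ square ℓ) X
        ∎
      where
      open ≈-Reasoning setoid
      α β γ : Carrier
      α = dot X (cross R r)
      β = dot X (cross r P)
      γ = dot X (cross P R)

  singular-point : ∀ f → disc f ≈ 0# → ∃[ P ] ¬ P ≋ 0ᵥ × Singular f P
  singular-point f Δ≈0 = by (1# + 1# ≟ 0#)
    where
    nucleus : Vector Carrier 3
    nucleus = f 4F ∷ f 2F ∷ f 1F ∷ []
    -- In characteristic 2 the polar form is alternating and f is singular at its
    -- kernel vector, unless it vanishes and f is diagonal.
    even : 2≈0 → Dec (nucleus ≋ 0ᵥ) → ∃[ P ] ¬ P ≋ 0ᵥ × Singular f P
    even 2≈0 (no n≉0) = nucleus , n≉0 ,
      trans (eval-nucleus f) (0+0≈0 (-0≈0 Δ≈0) (double 2≈0 _)) ,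
      λ i → trans (grad-nucleus f i) (0+0≈0 (double 2≈0 _) (double 2≈0 _))
    even 2≈0 (yes n≋0) = let P , P≉0 , QP≈0 = isotropic (f 0F ∷ 0# ∷ 0# ∷ f 3F ∷ 0# ∷ f 5F ∷ []) in P , P≉0 ,
      trans (eval-diagonal f P) (0+0≈0 QP≈0 (dot-0′ (P 1F * P 2F ∷ P 0F * P 2F ∷ P 0F * P 1F ∷ []) n≋0)) ,
      λ i → trans (grad-diagonal f P i) (0+0≈0 (double 2≈0 _)
        (dot-0′ (((0# ∷ P 2F ∷ P 1F ∷ []) ∷ (P 2F ∷ 0# ∷ P 0F ∷ []) ∷ (P 1F ∷ P 0F ∷ 0# ∷ []) ∷ []) i) n≋0))
    by : Dec 2≈0 → ∃[ P ] ¬ P ≋ 0ᵥ × Singular f P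
    by (yes 2≈0) = even 2≈0 (nucleus ≟ᵛ 0ᵥ)
    -- The polar matrix has determinant 2 Δ = 0, and by Euler's relation f vanishes at its kernel
    -- vector.
    by (no 2≉0) =
      let P , P≉0 , g = kernel (polar f) (trans (det-polar f) (0+0≈0 Δ≈0 Δ≈0)) in
      P , P≉0 , x+x≈0⇒x≈0 2≉0 (trans (sym (euler f P)) (dot-0 P g)) , g

  -- A singular vector outside the line of P would make f a square by `two-singular⇒isSquare`.
  σ-line : ∀ f → ¬ IsSquare f → disc f ≈ 0# → σ f ≡ Q
  σ-line f not-square Δ≈0 = ∑-line (singular? f) (Singular-resp f) 0ᵥ P≉0
    (λ s → trans (eval-multiple f s P) (*0≈0 _ (proj₁ P-singular)) , λ i → trans (grad-multiple f s P i) (*0≈0 s (proj₂ P-singular i)))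
    (λ {R} R-singular → param R R-singular (cross P R ≟ᵛ 0ᵥ))
    where
    P : Vector Carrier 3
    P = proj₁ (singular-point f Δ≈0)
    P≉0 : ¬ P ≋ 0ᵥ
    P≉0 = proj₁ (proj₂ (singular-point f Δ≈0))
    P-singular : Singular f P
    P-singular = proj₂ (proj₂ (singular-point f Δ≈0))
    param : ∀ R → Singular f R → Dec (cross P R ≋ 0ᵥ) → ∃[ s ] R ≋ (0ᵥ +ᵥ s *ᵥ P)
    param R _ (yes P×R≋0) = let r , P·r≈1 = dual P≉0 in dot R r , λ i → trans (parallel P R r P·r≈1 P×R≋0 i) (sym (+-identityˡ _))
    param R R-singular (no P×R≉0) = contradiction (two-singular⇒isSquare f P R P-singular R-singular P×R≉0) not-square

  σ-nonsingular : ∀ f → ¬ disc f ≈ 0# → σ f ≡ 1ℤ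
  σ-nonsingular f Δ≉0 = ≡.trans (∑-cong (𝕍 3) λ P → 𝟙-cong (singular? f P) (P ≟ᵛ 0ᵥ) (to P) (from P)) (Enumeration.once (𝕍-enumeration 3) 0ᵥ)
    where
    to : ∀ P → Singular f P → P ≋ 0ᵥ
    to P (e , g) = ≋-ext₃ (by 0F (disc-eval₀ f P) (g 1F) (g 2F)) (by 1F (disc-eval₁ f P) (g 0F) (g 2F)) (by 2F (disc-eval₂ f P) (g 0F) (g 1F))
      where
      by : ∀ i {x y z u v w} → disc f * (P i * P i) ≈ (x * eval f P + y * (u * v)) + (- (z * (u * u)) - w * (v * v)) → u ≈ 0# → v ≈ 0# → P i ≈ 0#
      by i {x} {y} {z} {u} {v} {w} eq u≈0 v≈0 = xx≈0⇒x≈0 (xy≈0⇒y≈0 Δ≉0 (trans eq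
        (0+0≈0 (0+0≈0 (*0≈0 x e) (*0≈0 y (*0≈0 u v≈0))) (0+0≈0 (-0≈0 (*0≈0 z (*0≈0 u u≈0))) (-0≈0 (*0≈0 w (*0≈0 v v≈0)))))))
    from : ∀ P → P ≋ 0ᵥ → Singular f P
    from P P≋0 = Singular-resp f {0ᵥ +ᵥ 0# *ᵥ P} (λ i → trans (+-identityˡ _) (trans (zeroˡ (P i)) (sym (P≋0 i))))
      (trans (eval-multiple f 0# P) (0*≈0 _ (zeroˡ 0#)) , λ i → trans (grad-multiple f 0# P i) (zeroˡ _))

  -- The conditions are nested: zero implies square, and square implies Δ = 0. Each indicator
  -- therefore adds the increment to the next of the values 1, q, q², q³.
  σ-value : ∀ f → σ f ≡ ((1ℤ Z.+ (Q Z.- 1ℤ) Z.* 𝟙 (disc f ≟ 0#)) Z.+ (Q Z.^ 2 Z.- Q) Z.* 𝟙 (isSquare? f)) Z.+ (Q Z.^ 3 Z.- Q Z.^ 2) Z.* 𝟙 (f ≟ᵛ 0ᵥ)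
  σ-value f = by (disc f ≟ 0#) (isSquare? f) (f ≟ᵛ 0ᵥ)
    where
    open ℤ-Solver
    formula : Polynomial 3 → Polynomial 3 → Polynomial 3 → Polynomial 3
    formula d w o = ((con 1ℤ :+ (var 0F :- con 1ℤ) :* d) :+ (var 1F :- var 0F) :* w) :+ (var 2F :- var 1F) :* o
    ρ : Vec ℤ 3
    ρ = Q ∷ᵥ Q Z.^ 2 ∷ᵥ Q Z.^ 3 ∷ᵥ []ᵥ
    by : (d : Dec (disc f ≈ 0#)) (w : Dec (IsSquare f)) (o : Dec (f ≋ 0ᵥ)) →
      σ f ≡ ((1ℤ Z.+ (Q Z.- 1ℤ) Z.* 𝟙 d) Z.+ (Q Z.^ 2 Z.- Q) Z.* 𝟙 w) Z.+ (Q Z.^ 3 Z.- Q Z.^ 2) Z.* 𝟙 o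
    by (no Δ≉0) (yes sq) _ = contradiction (isSquare⇒disc≈0 f sq) Δ≉0
    by _ (no ¬sq) (yes f≋0) = contradiction (zero-isSquare f≋0) ¬sq
    by (yes _) (yes _) (yes f≋0) = ≡.trans (σ-zero f f≋0) (identity ρ (var 2F) (formula (con 1ℤ) (con 1ℤ) (con 1ℤ)))
    by (yes _) (yes (a , ℓ , f≋)) (no f≉0) = ≡.trans (σ-square f a ℓ f≉0 f≋) (identity ρ (var 1F) (formula (con 1ℤ) (con 1ℤ) (con 0ℤ)))
    by (yes Δ≈0) (no ¬sq) (no _) = ≡.trans (σ-line f ¬sq Δ≈0) (identity ρ (var 0F) (formula (con 1ℤ) (con 0ℤ) (con 0ℤ)))
    by (no Δ≉0) (no _) (no _) = ≡.trans (σ-nonsingular f Δ≉0) (identity ρ (con 1ℤ) (formula (con 0ℤ) (con 0ℤ) (con 0ℤ)))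

  -- A square a ℓ² ≉ 0 is presented by exactly the pairs (t⁻² a , t ℓ) with t ≉ 0.
  ∑-presentations : ∀ f → ∑[ a ∈ 𝔽 ] ∑[ ℓ ∈ 𝕍 3 ] 𝟙 (¬? (a ≟ 0#) ×-dec (f ≟ᵛ (a *ᵥ square ℓ))) ≡ (Q Z.- 1ℤ) Z.* 𝟙 (isSquare? f)
  ∑-presentations f = by (isSquare? f) (f ≟ᵛ 0ᵥ)
    where
    open ≡-Reasoning
    Presents : Carrier → Vector Carrier 3 → Set _
    Presents a ℓ = ¬ a ≈ 0# × f ≋ (a *ᵥ square ℓ)
    presents? : ∀ a ℓ → Dec (Presents a ℓ)
    presents? a ℓ = ¬? (a ≟ 0#) ×-dec (f ≟ᵛ (a *ᵥ square ℓ))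

    module _ (f≉0 : ¬ f ≋ 0ᵥ) (a₀ : Carrier) (ℓ₀ : Vector Carrier 3) (f≋ : f ≋ (a₀ *ᵥ square ℓ₀)) where
      a₀≉0 : ¬ a₀ ≈ 0#
      a₀≉0 = proj₁ (square-nonzero {ℓ = ℓ₀} f≉0 f≋)
      ℓ₀≉0 : ¬ ℓ₀ ≋ 0ᵥ
      ℓ₀≉0 = proj₂ (square-nonzero {a = a₀} f≉0 f≋)
      r : Vector Carrier 3
      r = proj₁ (dual ℓ₀≉0)
      ℓ₀·r≈1 : dot ℓ₀ r ≈ 1#
      ℓ₀·r≈1 = proj₂ (dual ℓ₀≉0)

      Scaled : Carrier → Carrier → Vector Carrier 3 → Set _
      Scaled t a ℓ = (¬ t ≈ 0#) × (ℓ ≋ (t *ᵥ ℓ₀)) × (a * (t * t) ≈ a₀)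
      scaled? : ∀ t a ℓ → Dec (Scaled t a ℓ)
      scaled? t a ℓ = ¬? (t ≟ 0#) ×-dec ((ℓ ≟ᵛ (t *ᵥ ℓ₀)) ×-dec (a * (t * t) ≟ a₀))

      scaled⇒presents : ∀ t a ℓ → Scaled t a ℓ → Presents a ℓ
      scaled⇒presents t a ℓ (t≉0 , ℓ≋ , att≈a₀) =
        (λ a≈0 → a₀≉0 (trans (sym att≈a₀) (0*≈0 _ a≈0))) ,
        λ i → trans (f≋ i) (trans (*-congʳ (sym att≈a₀)) (trans (*-assoc a (t * t) _) (*-congˡ
          (trans (sym (square-multiple t ℓ₀ i)) (square-cong {t *ᵥ ℓ₀} {ℓ} (≋-sym ℓ≋) i)))))

      presents⇒scaled : ∀ a ℓ → Presents a ℓ → Scaled (dot ℓ r) a ℓ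
      presents⇒scaled a ℓ (a≉0 , f≋′) = t≉0 , ℓ≋ , att≈a₀
        where
        same : ∀ X → a * (dot ℓ X * dot ℓ X) ≈ a₀ * (dot ℓ₀ X * dot ℓ₀ X)
        same X = trans (sym (eval-square a ℓ X)) (trans
          (eval-cong {a *ᵥ square ℓ} {a₀ *ᵥ square ℓ₀} (≋-trans (≋-sym f≋′) f≋) (≋-refl {x = X})) (eval-square a₀ ℓ₀ X))
        t : Carrier
        t = dot ℓ r
        att≈a₀ : a * (t * t) ≈ a₀
        att≈a₀ = trans (same r) (trans (*-congˡ (trans (*-cong ℓ₀·r≈1 ℓ₀·r≈1) (*-identityˡ 1#))) (*-identityʳ a₀))
        t≉0 : ¬ t ≈ 0#
        t≉0 t≈0 = a₀≉0 (trans (sym att≈a₀) (*0≈0 a (*0≈0 t t≈0)))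
        -- The vector X = y - (ℓ₀ · y) r is annihilated by ℓ₀, hence also by ℓ, since a (ℓ · X)² =
        -- a₀ (ℓ₀ · X)² and a ≠ 0.
        value : ∀ y → dot ℓ y ≈ t * dot ℓ₀ y
        value y = x-y≈0⇒x≈y (trans (sym (expand ℓ)) (xx≈0⇒x≈0 (xy≈0⇒y≈0 a≉0 (trans (same X)
          (*0≈0 a₀ (*0≈0 _ (trans (expand ℓ₀) (x≈y⇒x-y≈0 (sym (trans (*-congʳ ℓ₀·r≈1) (*-identityˡ _)))))))))))
          where
          X : Vector Carrier 3
          X = y +ᵥ (- dot ℓ₀ y) *ᵥ r
          expand : ∀ m → dot m X ≈ dot m y - dot m r * dot ℓ₀ y
          expand m = trans (dot-+ʳ m y ((- dot ℓ₀ y) *ᵥ r)) (+-congˡ (trans (dot-*ʳ m (- dot ℓ₀ y) r)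
            (trans (sym (-‿distribˡ-* _ _)) (-‿cong (*-comm _ _)))))
        ℓ≋ : ℓ ≋ (t *ᵥ ℓ₀)
        ℓ≋ = ≋-ext₃ (at 0F e₀ (dot-e ℓ 0F) (dot-e ℓ₀ 0F)) (at 1F e₁ (dot-e ℓ 1F) (dot-e ℓ₀ 1F)) (at 2F e₂ (dot-e ℓ 2F) (dot-e ℓ₀ 2F))
          where
          at : ∀ i e → ℓ i ≈ dot ℓ e → ℓ₀ i ≈ dot ℓ₀ e → ℓ i ≈ t * ℓ₀ i
          at i e eq eq₀ = trans eq (trans (value e) (*-congˡ (sym eq₀)))

      unique-scale : ∀ a ℓ (d : Dec (Presents a ℓ)) → 𝟙 d ≡ ∑[ t ∈ 𝔽 ] 𝟙 (scaled? t a ℓ)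
      unique-scale a ℓ (no ¬p) = ≡.sym (≡.trans (∑-cong 𝔽 λ t → 𝟙-no (scaled? t a ℓ) λ s → ¬p (scaled⇒presents t a ℓ s)) (∑-0 𝔽))
      unique-scale a ℓ (yes p) = let s@(t≉0 , ℓ≋ , att≈a₀) = presents⇒scaled a ℓ p in ≡.sym (∑-unique (λ t → scaled? t a ℓ) (dot ℓ r)
        (λ {t} (_ , ℓ≋′ , _) → scalar-unique ℓ₀≉0 (≋-trans (≋-sym ℓ≋′) ℓ≋))
        (λ {t} t≈ → (λ t≈0 → t≉0 (trans (sym t≈) t≈0)) , (λ i → trans (ℓ≋ i) (*-congʳ (sym t≈))) , trans (*-congˡ (*-cong t≈ t≈)) att≈a₀))

      one : ∀ t (d : Dec (t ≈ 0#)) → ∑[ a ∈ 𝔽 ] ∑[ ℓ ∈ 𝕍 3 ] 𝟙 (scaled? t a ℓ) ≡ 𝟙 (¬? d)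
      one t (yes t≈0) = ≡.trans (∑-cong 𝔽 λ a → ≡.trans (∑-cong (𝕍 3) λ ℓ → 𝟙-no (scaled? t a ℓ) λ s → proj₁ s t≈0) (∑-0 (𝕍 3))) (∑-0 𝔽)
      one t (no t≉0) = begin
        ∑[ a ∈ 𝔽 ] ∑[ ℓ ∈ 𝕍 3 ] 𝟙 (scaled? t a ℓ)
          ≡⟨ ∑-cong 𝔽 (λ a → ∑-cong (𝕍 3) λ ℓ → ≡.trans
               (𝟙-cong (scaled? t a ℓ) ((ℓ ≟ᵛ (t *ᵥ ℓ₀)) ×-dec (a * (t * t) ≟ a₀)) proj₂ (t≉0 ,_)) (𝟙-× (ℓ ≟ᵛ (t *ᵥ ℓ₀)) (a * (t * t) ≟ a₀))) ⟩
        ∑[ a ∈ 𝔽 ] ∑[ ℓ ∈ 𝕍 3 ] (𝟙 (ℓ ≟ᵛ (t *ᵥ ℓ₀)) Z.* 𝟙 (a * (t * t) ≟ a₀))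
          ≡⟨ ∑-cong 𝔽 (λ a → ≡.trans (∑-*ʳ (𝕍 3) _ _) (≡.trans (cong (Z._* 𝟙 (a * (t * t) ≟ a₀)) (Enumeration.once (𝕍-enumeration 3) (t *ᵥ ℓ₀))) (Z.*-identityˡ _))) ⟩
        ∑[ a ∈ 𝔽 ] 𝟙 (a * (t * t) ≟ a₀)
          ≡⟨ ∑-unique (λ a → a * (t * t) ≟ a₀) (u * a₀)
               (λ {a} eq → trans (sym (inverse-cancel ttu≈1 a)) (*-congˡ (trans (*-comm (t * t) a) eq)))
               (λ {a} eq → trans (*-congʳ eq) (trans (*-comm _ _) (trans (sym (*-assoc (t * t) u a₀)) (trans (*-congʳ ttu≈1) (*-identityˡ a₀))))) ⟩
        1ℤ ∎
        where
        u : Carrier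
        u = proj₁ (inverse (xy≉0 t≉0 t≉0))
        ttu≈1 : (t * t) * u ≈ 1#
        ttu≈1 = proj₂ (inverse (xy≉0 t≉0 t≉0))

      count : ∑[ a ∈ 𝔽 ] ∑[ ℓ ∈ 𝕍 3 ] 𝟙 (presents? a ℓ) ≡ Q Z.- 1ℤ
      count = begin
        ∑[ a ∈ 𝔽 ] ∑[ ℓ ∈ 𝕍 3 ] 𝟙 (presents? a ℓ)                      ≡⟨ ∑-cong 𝔽 (λ a → ∑-cong (𝕍 3) λ ℓ → unique-scale a ℓ (presents? a ℓ)) ⟩
        ∑[ a ∈ 𝔽 ] ∑[ ℓ ∈ 𝕍 3 ] ∑[ t ∈ 𝔽 ] 𝟙 (scaled? t a ℓ)           ≡⟨ ∑-cong 𝔽 (λ a → ∑-swap (𝕍 3) 𝔽 _) ⟩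
        ∑[ a ∈ 𝔽 ] ∑[ t ∈ 𝔽 ] ∑[ ℓ ∈ 𝕍 3 ] 𝟙 (scaled? t a ℓ)           ≡⟨ ∑-swap 𝔽 𝔽 _ ⟩
        ∑[ t ∈ 𝔽 ] ∑[ a ∈ 𝔽 ] ∑[ ℓ ∈ 𝕍 3 ] 𝟙 (scaled? t a ℓ)           ≡⟨ ∑-cong 𝔽 (λ t → one t (t ≟ 0#)) ⟩
        ∑[ t ∈ 𝔽 ] 𝟙 (¬? (t ≟ 0#))                                     ≡⟨ ∑-nonzero ⟩
        Q Z.- 1ℤ                                                       ∎

    -- The presentations of 0 are (a , 0) with a ≠ 0, again q - 1 in number, so zero fits the same
    -- formula.
    zero-count : f ≋ 0ᵥ → ∑[ a ∈ 𝔽 ] ∑[ ℓ ∈ 𝕍 3 ] 𝟙 (presents? a ℓ) ≡ Q Z.- 1ℤ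
    zero-count f≋0 = begin
      ∑[ a ∈ 𝔽 ] ∑[ ℓ ∈ 𝕍 3 ] 𝟙 (presents? a ℓ)                        ≡⟨ ∑-cong 𝔽 (λ a → ∑-cong (𝕍 3) λ ℓ → ≡.trans
                                                                            (𝟙-cong (presents? a ℓ) (¬? (a ≟ 0#) ×-dec (ℓ ≟ᵛ 0ᵥ)) (to a ℓ) (from a ℓ)) (𝟙-× (¬? (a ≟ 0#)) (ℓ ≟ᵛ 0ᵥ))) ⟩
      ∑[ a ∈ 𝔽 ] ∑[ ℓ ∈ 𝕍 3 ] (𝟙 (¬? (a ≟ 0#)) Z.* 𝟙 (ℓ ≟ᵛ 0ᵥ))        ≡⟨ ∑-cong 𝔽 (λ a → ≡.trans (∑-*ˡ (𝕍 3) _ _) (≡.trans (cong (Z._*_ (𝟙 (¬? (a ≟ 0#)))) (Enumeration.once (𝕍-enumeration 3) 0ᵥ)) (Z.*-identityʳ _))) ⟩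
      ∑[ a ∈ 𝔽 ] 𝟙 (¬? (a ≟ 0#))                                       ≡⟨ ∑-nonzero ⟩
      Q Z.- 1ℤ                                                         ∎
      where
      to : ∀ a ℓ → Presents a ℓ → ¬ a ≈ 0# × ℓ ≋ 0ᵥ
      to a ℓ (a≉0 , f≋) = a≉0 , ≋-ext₃ (root 0F (ℓ 0F) refl) (root 3F (ℓ 1F) refl) (root 5F (ℓ 2F) refl)
        where
        root : ∀ k x → a * (x * x) ≈ a * square ℓ k → x ≈ 0#
        root k x eq = xx≈0⇒x≈0 (xy≈0⇒y≈0 a≉0 (trans eq (trans (sym (f≋ k)) (f≋0 k))))
      from : ∀ a ℓ → ¬ a ≈ 0# × ℓ ≋ 0ᵥ → Presents a ℓ
      from a ℓ (a≉0 , ℓ≋0) = a≉0 , λ i → trans (f≋0 i) (sym (*0≈0 a (square≋0 {ℓ} ℓ≋0 i)))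

    by : (w : Dec (IsSquare f)) → Dec (f ≋ 0ᵥ) → ∑[ a ∈ 𝔽 ] ∑[ ℓ ∈ 𝕍 3 ] 𝟙 (presents? a ℓ) ≡ (Q Z.- 1ℤ) Z.* 𝟙 w
    by (no ¬sq) _ = ≡.trans (≡.trans (∑-cong 𝔽 λ a → ≡.trans (∑-cong (𝕍 3) λ ℓ → 𝟙-no (presents? a ℓ) λ (_ , f≋) → ¬sq (a , ℓ , f≋)) (∑-0 (𝕍 3))) (∑-0 𝔽)) (≡.sym (Z.*-zeroʳ _))
    by (yes _) (yes f≋0) = ≡.trans (zero-count f≋0) (≡.sym (Z.*-identityʳ _))
    by (yes (a₀ , ℓ₀ , f≋)) (no f≉0) = ≡.trans (count f≉0 a₀ ℓ₀ f≋) (≡.sym (Z.*-identityʳ _))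

  -- Rank and determinant

  dot-lc : ∀ {k n} a (b : Vector (Vector Carrier n) k) v → dot (linearCombination a b) v ≈ sum (λ i → a i * dot (b i) v)
  dot-lc a b v = begin
    sum (λ j → sum (λ i → a i * b i j) * v j)        ≈⟨ sum-cong-≋ (λ j → *-distribʳ-sum (v j) (λ i → a i * b i j)) ⟩
    sum (λ j → sum (λ i → (a i * b i j) * v j))      ≈⟨ sum-comm (λ j i → (a i * b i j) * v j) ⟩
    sum (λ i → sum (λ j → (a i * b i j) * v j))      ≈⟨ sum-cong-≋ (λ i → trans (sum-cong-≋ λ j → *-assoc (a i) (b i j) (v j)) (sym (*-distribˡ-sum (a i) (λ j → b i j * v j)))) ⟩
    sum (λ i → a i * dot (b i) v)                    ∎
    where open ≈-Reasoning setoid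

  module _ {k n} (b : Vector (Vector Carrier n) (suc k)) (a : Vector Carrier (suc k)) (j : Fin (suc k))
    (aⱼ≉0 : ¬ a j ≈ 0#) (relation : linearCombination a b ≋ 0ᵥ) where

    private
      split : ∀ c i → linearCombination c b i ≈ c j * b j i + linearCombination (removeAt c j) (removeAt b j) i
      split c i = sum-remove {i = j} (λ m → c m * b m i)

    -- Subtracting the multiple of the relation by c j / a j from the coefficients c makes the one
    -- at j vanish.
    Span-removeAt : ∀ v → Span b v ⇔ Span (removeAt b j) v
    Span-removeAt v = mk⇔ to from
      where
      to : Span b v → Span (removeAt b j) v
      to (c , v≋) = removeAt c′ j , λ i → begin
        v i                                                       ≈⟨ v≋ i ⟩
        linearCombination c b i                                   ≈⟨ trans (+-congˡ (-0≈0 (trans (lc-scale i) (*0≈0 s (relation i))))) (+-identityʳ _) ⟨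
        linearCombination c b i - linearCombination (s *ᵥ a) b i  ≈⟨ lc-- b c (s *ᵥ a) i ⟨
        linearCombination c′ b i                                  ≈⟨ split c′ i ⟩
        c′ j * b j i + linearCombination (removeAt c′ j) (removeAt b j) i  ≈⟨ trans (+-congʳ (0*≈0 (b j i) c′ⱼ≈0)) (+-identityˡ _) ⟩
        linearCombination (removeAt c′ j) (removeAt b j) i        ∎
        where
        open ≈-Reasoning setoid
        s : Carrier
        s = c j * proj₁ (inverse aⱼ≉0)
        c′ : Vector Carrier (suc k)
        c′ m = c m - s * a m
        c′ⱼ≈0 : c′ j ≈ 0#
        c′ⱼ≈0 = x≈y⇒x-y≈0 (sym (trans (*-assoc _ _ _) (trans (*-congˡ (trans (*-comm _ (a j)) (proj₂ (inverse aⱼ≉0)))) (*-identityʳ (c j)))))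
        lc-scale : ∀ i → linearCombination (s *ᵥ a) b i ≈ s * linearCombination a b i
        lc-scale i = trans (dot-comm (s *ᵥ a) (λ m → b m i)) (trans (dot-*ʳ (λ m → b m i) s a) (*-congˡ (dot-comm (λ m → b m i) a)))
      from : Span (removeAt b j) v → Span b v
      from (c , v≋) = insertAt c j 0# , λ i → trans (v≋ i) (sym (trans (split (insertAt c j 0#) i)
        (trans (+-cong (0*≈0 (b j i) (reflexive (Vector.insertAt-lookup c j 0#))) (sum-cong-≋ λ m → *-congʳ (reflexive (Vector.insertAt-punchIn c j 0# m)))) (+-identityˡ _))))

  nonzero-entry : ∀ {n} {a : Vector Carrier n} → ¬ a ≋ 0ᵥ → ∃[ j ] ¬ a j ≈ 0#
  nonzero-entry {a = a} a≉0 = by (Fin.any? λ j → ¬? (a j ≟ 0#))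
    where
    by : Dec (∃[ j ] ¬ a j ≈ 0#) → ∃[ j ] ¬ a j ≈ 0#
    by (yes entry) = entry
    by (no ∄)      = contradiction (λ j → zero-at j (a j ≟ 0#)) a≉0
      where
      zero-at : ∀ j → Dec (a j ≈ 0#) → a j ≈ 0#
      zero-at j (yes aⱼ≈0) = aⱼ≈0
      zero-at j (no aⱼ≉0)  = contradiction (j , aⱼ≉0) ∄

  HasDimension-resp : ∀ {n r p p′} {U : Pred (Vector Carrier n) p} {U′ : Pred (Vector Carrier n) p′} →
    (∀ v → U v ⇔ U′ v) → HasDimension U′ r → HasDimension U r
  HasDimension-resp U⇔U′ (b , independent , spans) = b , independent , λ v →
    mk⇔ (Equivalence.to (spans v) ∘ Equivalence.to (U⇔U′ v)) (Equivalence.from (U⇔U′ v) ∘ Equivalence.from (spans v))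

  Dependent : ∀ {k n} → Vector (Vector Carrier n) k → Set _
  Dependent b = ∃[ a ] ¬ a ≋ 0ᵥ × linearCombination a b ≋ 0ᵥ

  dependent? : ∀ {k n} (b : Vector (Vector Carrier n) k) → Dec (Dependent b)
  dependent? b = any𝕍? (λ a≋c (a≉0 , relation) → (λ c≋0 → a≉0 (≋-trans a≋c c≋0)) , ≋-trans (lc-cong b (≋-sym a≋c)) relation)
    (λ a → ¬? (a ≟ᵛ 0ᵥ) ×-dec (linearCombination a b ≟ᵛ 0ᵥ))

  -- As long as the family is dependent, a vector with nonzero coefficient in some relation is
  -- discarded; the span does not change.
  Span-dimension : ∀ k {n} (b : Vector (Vector Carrier n) k) → ∃[ r ] r ℕ.≤ k × HasDimension (Span b) r
  Span-dimension k b = by k b (dependent? b)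
    where
    by : ∀ k {n} (b : Vector (Vector Carrier n) k) → Dec (Dependent b) → ∃[ r ] r ℕ.≤ k × HasDimension (Span b) r
    by k b (no ¬dependent) = k , ℕ.≤-refl , b , (λ a relation → zero-coefficients a relation (a ≟ᵛ 0ᵥ)) , λ v → mk⇔ id id
      where
      zero-coefficients : ∀ a → linearCombination a b ≋ 0ᵥ → Dec (a ≋ 0ᵥ) → a ≋ 0ᵥ
      zero-coefficients a relation (yes a≋0) = a≋0
      zero-coefficients a relation (no a≉0)  = contradiction (a , a≉0 , relation) ¬dependent
    by zero b (yes (a , a≉0 , _)) = contradiction (λ ()) a≉0
    by (suc k) b (yes (a , a≉0 , relation)) =
      let j , aⱼ≉0 = nonzero-entry a≉0
          r , r≤k , dim = by k (removeAt b j) (dependent? (removeAt b j))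
      in r , ℕ.m≤n⇒m≤1+n r≤k , HasDimension-resp (Span-removeAt b a j aⱼ≉0 relation) dim

  -- By symmetry a kernel vector is a linear relation among the rows, so two of the three rows
  -- already span the row space.
  det≈0⇒secant : ∀ y → det y ≈ 0# → SecantVariety y
  det≈0⇒secant y det≈0 =
    let k , k≉0 , yk≋0 = kernel y det≈0
        relation = λ j → trans (transpose k j) (yk≋0 j)
        j , kⱼ≉0 = nonzero-entry k≉0
        r , r≤2 , dim = Span-dimension 2 (removeAt (symmetricMatrix y) j)
    in r , r≤2 , HasDimension-resp (Span-removeAt (symmetricMatrix y) k j kⱼ≉0 relation) dim
    where
    transpose : ∀ k → linearCombination k (symmetricMatrix y) ≋ app y k
    transpose k = ≋-ext₃ (dot-comm k (row y 0F)) (dot-comm k (row y 1F)) (dot-comm k (row y 2F))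

  orthogonal-to-few : ∀ r → r ℕ.≤ 2 → (b : Vector (Vector Carrier 3) r) → ∃[ v ] ¬ v ≋ 0ᵥ × (∀ i → dot (b i) v ≈ 0#)
  orthogonal-to-few 0 _ b = e₀ , (λ eq → 0≉1 (sym (eq 0F))) , λ ()
  orthogonal-to-few 1 _ b = let v , v≉0 , b₀·v = orthogonal₁ (b 0F) in v , v≉0 , λ { 0F → b₀·v }
  orthogonal-to-few 2 _ b = let v , v≉0 , b₀·v , b₁·v = orthogonal₂ (b 0F) (b 1F) in v , v≉0 , λ { 0F → b₀·v ; 1F → b₁·v }
  orthogonal-to-few (suc (suc (suc _))) (ℕ.s≤s (ℕ.s≤s ())) b

  -- At most two vectors spanning the row space have a common nonzero orthogonal vector in three
  -- dimensions, and it lies in the kernel.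
  secant⇒det≈0 : ∀ y → SecantVariety y → det y ≈ 0#
  secant⇒det≈0 y (r , r≤2 , b , _ , spans) = by (det y ≟ 0#)
    where
    v : Vector Carrier 3
    v = proj₁ (orthogonal-to-few r r≤2 b)
    b·v≈0 : ∀ i → dot (b i) v ≈ 0#
    b·v≈0 = proj₂ (proj₂ (orthogonal-to-few r r≤2 b))
    span·v≈0 : ∀ u → Span (symmetricMatrix y) u → dot u v ≈ 0#
    span·v≈0 u u∈ = let a , u≋ = Equivalence.to (spans u) u∈ in
      trans (dot-cong u≋ (≋-refl {x = v})) (trans (dot-lc a b v) (trans (sum-cong-≋ λ i → *0≈0 (a i) (b·v≈0 i)) (sum-zero r)))
    pick₀ : ∀ x₀ x₁ x₂ → x₀ ≈ 1# * x₀ + (0# * x₁ + (0# * x₂ + 0#))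
    pick₀ x₀ x₁ x₂ = identity (x₀ ∷ᵥ x₁ ∷ᵥ x₂ ∷ᵥ []ᵥ) (var 0F) (con 1ℤ :* var 0F :+ (con 0ℤ :* var 1F :+ (con 0ℤ :* var 2F :+ con 0ℤ)))
      where open Ring-Solver
    pick₁ : ∀ x₀ x₁ x₂ → x₁ ≈ 0# * x₀ + (1# * x₁ + (0# * x₂ + 0#))
    pick₁ x₀ x₁ x₂ = identity (x₀ ∷ᵥ x₁ ∷ᵥ x₂ ∷ᵥ []ᵥ) (var 1F) (con 0ℤ :* var 0F :+ (con 1ℤ :* var 1F :+ (con 0ℤ :* var 2F :+ con 0ℤ)))
      where open Ring-Solver
    pick₂ : ∀ x₀ x₁ x₂ → x₂ ≈ 0# * x₀ + (0# * x₁ + (1# * x₂ + 0#))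
    pick₂ x₀ x₁ x₂ = identity (x₀ ∷ᵥ x₁ ∷ᵥ x₂ ∷ᵥ []ᵥ) (var 2F) (con 0ℤ :* var 0F :+ (con 0ℤ :* var 1F :+ (con 1ℤ :* var 2F :+ con 0ℤ)))
      where open Ring-Solver
    M : Vector (Vector Carrier 3) 3
    M = symmetricMatrix y
    yv≋0 : app y v ≋ 0ᵥ
    yv≋0 = ≋-ext₃
      (span·v≈0 (M 0F) (e₀ , λ j → pick₀ (M 0F j) (M 1F j) (M 2F j)))
      (span·v≈0 (M 1F) (e₁ , λ j → pick₁ (M 0F j) (M 1F j) (M 2F j)))
      (span·v≈0 (M 2F) (e₂ , λ j → pick₂ (M 0F j) (M 1F j) (M 2F j)))
    by : Dec (det y ≈ 0#) → det y ≈ 0#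
    by (yes det≈0) = det≈0
    by (no det≉0)  = contradiction (det≉0⇒kernel≋0 y v det≉0 yv≋0) (proj₁ (proj₂ (orthogonal-to-few r r≤2 b)))

  -- The double count for a line and its web

  module LineAndWeb {ℓ} (L : Pred (Vector Carrier 6) ℓ) (M : Vector (Vector Carrier 6) 2) (L-basis : IsBasis M L)
    (w : Vector QuadraticForm 4) (W-basis : IsBasis w (Web L)) where

    open ≡-Reasoning

    point : Vector Carrier 2 → Vector Carrier 6
    point m = linearCombination m M

    form : Vector Carrier 4 → QuadraticForm
    form x = linearCombination x w

    W? : Decidable (Web L)
    W? = ∈-basis? w W-basis

    L? : Decidable L
    L? = ∈-basis? M L-basis

    dot-point : ∀ v m → dot v (point m) ≈ m 0F * dot v (M 0F) + (m 1F * dot v (M 1F) + 0#)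
    dot-point v m = trans (dot-comm v (point m)) (trans (dot-lc m M v)
      (+-cong (*-congˡ (dot-comm (M 0F) v)) (+-congʳ (*-congˡ (dot-comm (M 1F) v)))))

    web⇒orthogonal : ∀ v → Web L v → dot v (M 0F) ≈ 0# × dot v (M 1F) ≈ 0#
    web⇒orthogonal v v∈W =
      trans (pick₀ _ _) (trans (sym (dot-point v (1# ∷ 0# ∷ []))) (v∈W _ (∈-basis-lc M L-basis (1# ∷ 0# ∷ [])))) ,
      trans (pick₁ _ _) (trans (sym (dot-point v (0# ∷ 1# ∷ []))) (v∈W _ (∈-basis-lc M L-basis (0# ∷ 1# ∷ []))))
      where
      open Ring-Solver
      pick₀ : ∀ x y → x ≈ 1# * x + (0# * y + 0#)
      pick₀ x y = identity (x ∷ᵥ y ∷ᵥ []ᵥ) (var 0F) (con 1ℤ :* var 0F :+ (con 0ℤ :* var 1F :+ con 0ℤ))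
      pick₁ : ∀ x y → y ≈ 0# * x + (1# * y + 0#)
      pick₁ x y = identity (x ∷ᵥ y ∷ᵥ []ᵥ) (var 1F) (con 0ℤ :* var 0F :+ (con 1ℤ :* var 1F :+ con 0ℤ))

    orthogonal⇒web : ∀ v → dot v (M 0F) ≈ 0# → dot v (M 1F) ≈ 0# → Web L v
    orthogonal⇒web v v·M₀ v·M₁ y y∈L = let m , y≋ = Equivalence.to (proj₂ L-basis y) y∈L in
      trans (dot-cong (≋-refl {x = v}) y≋) (trans (dot-point v m) (0+0≈0 (*0≈0 _ v·M₀) (0+0≈0 (*0≈0 _ v·M₁) refl)))

    W-cong : ∀ {u v} → u ≋ v → 𝟙 (W? u) ≡ 𝟙 (W? v)
    W-cong {u} {v} u≋v = 𝟙-cong (W? u) (W? v) (∈-basis-resp w W-basis u≋v) (∈-basis-resp w W-basis (≋-sym u≋v))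

    W-0 : Web L 0ᵥ
    W-0 = orthogonal⇒web 0ᵥ (dot-0′ (M 0F) (≋-refl {x = 0ᵥ})) (dot-0′ (M 1F) (≋-refl {x = 0ᵥ}))

    W-scale : ∀ a {v} → Web L v → Web L (a *ᵥ v)
    W-scale a {v} v∈W y y∈L = trans (dot-comm (a *ᵥ v) y) (trans (dot-*ʳ y a v) (*0≈0 a (trans (dot-comm y v) (v∈W y y∈L))))

    W-unscale : ∀ {a v} → ¬ a ≈ 0# → Web L (a *ᵥ v) → Web L v
    W-unscale {a} {v} a≉0 av∈W y y∈L = xy≈0⇒y≈0 a≉0 (trans (*-congˡ (dot-comm v y)) (trans (sym (dot-*ʳ y a v)) (trans (dot-comm y (a *ᵥ v)) (av∈W y y∈L))))

    C I B D E : ℤ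
    C = ∑[ x ∈ 𝕍 4 ] 𝟙 (disc (form x) ≟ 0#)
    I = ∑[ m ∈ 𝕍 2 ] 𝟙 (det (point m) ≟ 0#)
    B = ∑[ ℓ ∈ 𝕍 3 ] 𝟙 (W? (square ℓ))
    D = ∑[ v ∈ 𝕍 6 ] (𝟙 (W? v) Z.* σ v)
    E = ∑[ m ∈ 𝕍 2 ] ζ (point m)

    -- Each square form in W is replaced by its q - 1 presentations (a , ℓ). As W is closed under
    -- scaling, these are the pairs with a ≠ 0 and ℓ² ∈ W, and q - 1 cancels.
    squares-in-web : ∑[ v ∈ 𝕍 6 ] (𝟙 (W? v) Z.* 𝟙 (isSquare? v)) ≡ B
    squares-in-web = cancel-Q-1 _ _ (begin
      (Q Z.- 1ℤ) Z.* (∑[ v ∈ 𝕍 6 ] (𝟙 (W? v) Z.* 𝟙 (isSquare? v)))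
        ≡⟨ ∑-*ˡ (𝕍 6) _ _ ⟨
      ∑[ v ∈ 𝕍 6 ] ((Q Z.- 1ℤ) Z.* (𝟙 (W? v) Z.* 𝟙 (isSquare? v)))
        ≡⟨ ∑-cong (𝕍 6) expand ⟩
      ∑[ v ∈ 𝕍 6 ] ∑[ a ∈ 𝔽 ] ∑[ ℓ ∈ 𝕍 3 ] (𝟙 (¬? (a ≟ 0#)) Z.* (𝟙 (v ≟ᵛ (a *ᵥ square ℓ)) Z.* 𝟙 (W? v)))
        ≡⟨ ≡.trans (∑-swap (𝕍 6) 𝔽 _) (∑-cong 𝔽 λ a → ∑-swap (𝕍 6) (𝕍 3) _) ⟩
      ∑[ a ∈ 𝔽 ] ∑[ ℓ ∈ 𝕍 3 ] ∑[ v ∈ 𝕍 6 ] (𝟙 (¬? (a ≟ 0#)) Z.* (𝟙 (v ≟ᵛ (a *ᵥ square ℓ)) Z.* 𝟙 (W? v)))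
        ≡⟨ ∑-cong 𝔽 (λ a → ∑-cong (𝕍 3) λ ℓ → ≡.trans (∑-*ˡ (𝕍 6) _ _) (≡.trans
             (cong (Z._*_ (𝟙 (¬? (a ≟ 0#)))) (Enumeration.∑-pick (𝕍-enumeration 6) W-cong (a *ᵥ square ℓ)))
             (𝟙-*-cong (¬? (a ≟ 0#)) λ a≉0 → 𝟙-cong (W? (a *ᵥ square ℓ)) (W? (square ℓ)) (W-unscale {a} {square ℓ} a≉0) (W-scale a {square ℓ})))) ⟩
      ∑[ a ∈ 𝔽 ] ∑[ ℓ ∈ 𝕍 3 ] (𝟙 (¬? (a ≟ 0#)) Z.* 𝟙 (W? (square ℓ)))
        ≡⟨ ∑-cong 𝔽 (λ a → ∑-*ˡ (𝕍 3) _ _) ⟩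
      ∑[ a ∈ 𝔽 ] (𝟙 (¬? (a ≟ 0#)) Z.* B)
        ≡⟨ ≡.trans (∑-*ʳ 𝔽 B _) (cong (Z._* B) ∑-nonzero) ⟩
      (Q Z.- 1ℤ) Z.* B
        ∎)
      where
      rotate : ∀ x y z → x Z.* (y Z.* z) ≡ (x Z.* z) Z.* y
      rotate x y z = identity (x ∷ᵥ y ∷ᵥ z ∷ᵥ []ᵥ) (var 0F :* (var 1F :* var 2F)) ((var 0F :* var 2F) :* var 1F)
        where open ℤ-Solver
      expand : ∀ v → (Q Z.- 1ℤ) Z.* (𝟙 (W? v) Z.* 𝟙 (isSquare? v)) ≡
        ∑[ a ∈ 𝔽 ] ∑[ ℓ ∈ 𝕍 3 ] (𝟙 (¬? (a ≟ 0#)) Z.* (𝟙 (v ≟ᵛ (a *ᵥ square ℓ)) Z.* 𝟙 (W? v)))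
      expand v = begin
        (Q Z.- 1ℤ) Z.* (𝟙 (W? v) Z.* 𝟙 (isSquare? v))
          ≡⟨ rotate (Q Z.- 1ℤ) (𝟙 (W? v)) (𝟙 (isSquare? v)) ⟩
        ((Q Z.- 1ℤ) Z.* 𝟙 (isSquare? v)) Z.* 𝟙 (W? v)
          ≡⟨ cong (Z._* 𝟙 (W? v)) (∑-presentations v) ⟨
        (∑[ a ∈ 𝔽 ] ∑[ ℓ ∈ 𝕍 3 ] 𝟙 (¬? (a ≟ 0#) ×-dec (v ≟ᵛ (a *ᵥ square ℓ)))) Z.* 𝟙 (W? v)
          ≡⟨ ≡.trans (∑-cong 𝔽 λ a → ∑-*ʳ (𝕍 3) _ _) (∑-*ʳ 𝔽 _ _) ⟨
        ∑[ a ∈ 𝔽 ] ∑[ ℓ ∈ 𝕍 3 ] (𝟙 (¬? (a ≟ 0#) ×-dec (v ≟ᵛ (a *ᵥ square ℓ))) Z.* 𝟙 (W? v))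
          ≡⟨ ∑-cong 𝔽 (λ a → ∑-cong (𝕍 3) λ ℓ → ≡.trans
               (cong (Z._* 𝟙 (W? v)) (𝟙-× (¬? (a ≟ 0#)) (v ≟ᵛ (a *ᵥ square ℓ)))) (Z.*-assoc _ _ _)) ⟩
        ∑[ a ∈ 𝔽 ] ∑[ ℓ ∈ 𝕍 3 ] (𝟙 (¬? (a ≟ 0#)) Z.* (𝟙 (v ≟ᵛ (a *ᵥ square ℓ)) Z.* 𝟙 (W? v)))
          ∎

    disc-in-web : ∑[ v ∈ 𝕍 6 ] (𝟙 (W? v) Z.* 𝟙 (disc v ≟ 0#)) ≡ C
    disc-in-web = ≡.sym (∑-basis w W-basis λ {u} {v} u≋v →
      𝟙-cong (disc u ≟ 0#) (disc v ≟ 0#) (trans (disc-cong {v} {u} (≋-sym u≋v))) (trans (disc-cong {u} {v} u≋v)))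

    D-singular : D ≡ ((Q Z.^ 4 Z.+ (Q Z.- 1ℤ) Z.* C) Z.+ (Q Z.^ 2 Z.- Q) Z.* B) Z.+ (Q Z.^ 3 Z.- Q Z.^ 2)
    D-singular = begin
      D
        ≡⟨ ∑-cong (𝕍 6) (λ v → ≡.trans (cong (Z._*_ (𝟙 (W? v))) (σ-value v)) (distribute (𝟙 (W? v)) _ _ _)) ⟩
      ∑[ v ∈ 𝕍 6 ] (((𝟙 (W? v) Z.* 1ℤ Z.+ (Q Z.- 1ℤ) Z.* (𝟙 (W? v) Z.* 𝟙 (disc v ≟ 0#)))
        Z.+ (Q Z.^ 2 Z.- Q) Z.* (𝟙 (W? v) Z.* 𝟙 (isSquare? v))) Z.+ (Q Z.^ 3 Z.- Q Z.^ 2) Z.* (𝟙 (v ≟ᵛ 0ᵥ) Z.* 𝟙 (W? v)))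
        ≡⟨ ≡.trans (∑-+ (𝕍 6) _ _) (cong₂ Z._+_ (≡.trans (∑-+ (𝕍 6) _ _) (cong₂ Z._+_ (∑-+ (𝕍 6) _ _) ≡.refl)) ≡.refl) ⟩
      (((∑[ v ∈ 𝕍 6 ] (𝟙 (W? v) Z.* 1ℤ)) Z.+ (∑[ v ∈ 𝕍 6 ] ((Q Z.- 1ℤ) Z.* (𝟙 (W? v) Z.* 𝟙 (disc v ≟ 0#)))))
        Z.+ (∑[ v ∈ 𝕍 6 ] ((Q Z.^ 2 Z.- Q) Z.* (𝟙 (W? v) Z.* 𝟙 (isSquare? v))))) Z.+ (∑[ v ∈ 𝕍 6 ] ((Q Z.^ 3 Z.- Q Z.^ 2) Z.* (𝟙 (v ≟ᵛ 0ᵥ) Z.* 𝟙 (W? v))))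
        ≡⟨ cong₂ Z._+_ (cong₂ Z._+_ (cong₂ Z._+_
             (≡.trans (≡.sym (∑-basis w W-basis {λ _ → 1ℤ} (λ _ → ≡.refl))) (∑ᵛ-1 4))
             (≡.trans (∑-*ˡ (𝕍 6) _ _) (cong (Z._*_ (Q Z.- 1ℤ)) disc-in-web)))
             (≡.trans (∑-*ˡ (𝕍 6) _ _) (cong (Z._*_ (Q Z.^ 2 Z.- Q)) squares-in-web)))
             (≡.trans (∑-*ˡ (𝕍 6) _ _) (≡.trans (cong (Z._*_ (Q Z.^ 3 Z.- Q Z.^ 2))
               (≡.trans (Enumeration.∑-pick (𝕍-enumeration 6) W-cong 0ᵥ) (𝟙-yes (W? 0ᵥ) W-0))) (Z.*-identityʳ _))) ⟩
      ((Q Z.^ 4 Z.+ (Q Z.- 1ℤ) Z.* C) Z.+ (Q Z.^ 2 Z.- Q) Z.* B) Z.+ (Q Z.^ 3 Z.- Q Z.^ 2)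
        ∎
      where
      distribute : ∀ x d s o → x Z.* (((1ℤ Z.+ (Q Z.- 1ℤ) Z.* d) Z.+ (Q Z.^ 2 Z.- Q) Z.* s) Z.+ (Q Z.^ 3 Z.- Q Z.^ 2) Z.* o) ≡
        ((x Z.* 1ℤ Z.+ (Q Z.- 1ℤ) Z.* (x Z.* d)) Z.+ (Q Z.^ 2 Z.- Q) Z.* (x Z.* s)) Z.+ (Q Z.^ 3 Z.- Q Z.^ 2) Z.* (o Z.* x)
      distribute x d s o = identity (x ∷ᵥ d ∷ᵥ s ∷ᵥ o ∷ᵥ Q ∷ᵥ Q Z.^ 2 ∷ᵥ Q Z.^ 3 ∷ᵥ []ᵥ)
        (var 0F :* (((con 1ℤ :+ (var 4F :- con 1ℤ) :* var 1F) :+ (var 5F :- var 4F) :* var 2F) :+ (var 6F :- var 5F) :* var 3F))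
        (((var 0F :* con 1ℤ :+ (var 4F :- con 1ℤ) :* (var 0F :* var 1F)) :+ (var 5F :- var 4F) :* (var 0F :* var 2F)) :+ (var 6F :- var 5F) :* (var 3F :* var 0F))
        where open ℤ-Solver

    cancel-Q^ : ∀ n x y → Q Z.^ n Z.* x ≡ Q Z.^ n Z.* y → x ≡ y
    cancel-Q^ zero    x y eq = ≡.trans (≡.sym (Z.*-identityˡ x)) (≡.trans eq (Z.*-identityˡ y))
    cancel-Q^ (suc n) x y eq = cancel-Q^ n x y (cancel-Q _ _ (≡.trans (≡.sym (Z.*-assoc Q (Q Z.^ n) x)) (≡.trans eq (Z.*-assoc Q (Q Z.^ n) y))))

    -- The conditions on v to lie in the web and to be singular at P, and their transpose.
    module _ (P : Vector Carrier 3) where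
      conditions : QuadraticForm → Vector Carrier 6
      conditions v = dot v (M 0F) ∷ dot v (M 1F) ∷ eval v P ∷ grad v P

      combination : Vector Carrier 6 → Vector Carrier 6
      combination y = point (y 0F ∷ y 1F ∷ []) +ᵥ tangent P (tail (tail (tail y))) (y 2F)

      adjoint : ∀ v y → dot (conditions v) y ≈ dot v (combination y)
      adjoint v y = sym (trans (dot-+ʳ v (point (y 0F ∷ y 1F ∷ [])) (tangent P (tail (tail (tail y))) (y 2F)))
        (trans (+-cong (dot-point v (y 0F ∷ y 1F ∷ [])) (dot-tangent v P (tail (tail (tail y))) (y 2F)))
          (regroup (dot v (M 0F)) (dot v (M 1F)) (eval v P) (dot (grad v P) (tail (tail (tail y)))) (y 0F) (y 1F) (y 2F))))
        where
        regroup : ∀ a b e g y₀ y₁ y₂ → (y₀ * a + (y₁ * b + 0#)) + (y₂ * e + g) ≈ a * y₀ + (b * y₁ + (e * y₂ + g))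
        regroup a b e g y₀ y₁ y₂ = identity (a ∷ᵥ b ∷ᵥ e ∷ᵥ g ∷ᵥ y₀ ∷ᵥ y₁ ∷ᵥ y₂ ∷ᵥ []ᵥ)
          ((var 4F :* var 0F :+ (var 5F :* var 1F :+ con 0ℤ)) :+ (var 6F :* var 2F :+ var 3F))
          (var 0F :* var 4F :+ (var 1F :* var 5F :+ (var 2F :* var 6F :+ var 3F)))
          where open Ring-Solver

      web-singular : ∀ v → 𝟙 (W? v) Z.* 𝟙 (singular? v P) ≡ 𝟙 (conditions v ≟ᵛ 0ᵥ)
      web-singular v = ≡.trans (≡.sym (𝟙-× (W? v) (singular? v P))) (𝟙-cong (W? v ×-dec singular? v P) (conditions v ≟ᵛ 0ᵥ)
        (λ { (v∈W , e , g) 0F → proj₁ (web⇒orthogonal v v∈W)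
           ; (v∈W , e , g) 1F → proj₂ (web⇒orthogonal v v∈W)
           ; (v∈W , e , g) 2F → e
           ; (v∈W , e , g) (Fin.suc (Fin.suc (Fin.suc i))) → g i })
        (λ c≋0 → orthogonal⇒web v (c≋0 0F) (c≋0 1F) , c≋0 2F , λ i → c≋0 (Fin.suc (Fin.suc (Fin.suc i)))))

      split-combination : ∑[ y ∈ 𝕍 6 ] 𝟙 (combination y ≟ᵛ 0ᵥ) ≡ ∑[ m ∈ 𝕍 2 ] φ (point m) P
      split-combination = begin
        ∑[ y ∈ 𝕍 6 ] 𝟙 (combination y ≟ᵛ 0ᵥ)
          ≡⟨ ≡.trans (∑-suc 5 _) (∑-cong 𝔽 λ a → ∑-suc 4 _) ⟩
        ∑[ a ∈ 𝔽 ] ∑[ b ∈ 𝔽 ] ∑[ z ∈ 𝕍 4 ] 𝟙 (combination (a ∷ b ∷ z) ≟ᵛ 0ᵥ)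
          -- The first two coordinates of y are m and the last four are (μ , λ). Once they are
          -- separated the two predicates agree by computation.
          ≡⟨ ∑-cong 𝔽 (λ a → ∑-cong 𝔽 λ b → ∑-cong (𝕍 4) λ z → 𝟙-cong (combination (a ∷ b ∷ z) ≟ᵛ 0ᵥ) (tangentAt? (point (a ∷ b ∷ [])) P z) id id) ⟩
        ∑[ a ∈ 𝔽 ] ∑[ b ∈ 𝔽 ] φ (point (a ∷ b ∷ [])) P
          ≡⟨ ≡.trans (∑-suc 1 _) (∑-cong 𝔽 λ a → ≡.trans (∑-suc 0 _) (∑-cong 𝔽 λ b → ∑-empty _)) ⟨
        ∑[ m ∈ 𝕍 2 ] φ (point m) P
          ∎

      web-singular-count : ∑[ v ∈ 𝕍 6 ] (𝟙 (W? v) Z.* 𝟙 (singular? v P)) ≡ ∑[ m ∈ 𝕍 2 ] φ (point m) P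
      web-singular-count = begin
        ∑[ v ∈ 𝕍 6 ] (𝟙 (W? v) Z.* 𝟙 (singular? v P))   ≡⟨ ∑-cong (𝕍 6) web-singular ⟩
        ∑[ v ∈ 𝕍 6 ] 𝟙 (conditions v ≟ᵛ 0ᵥ)             ≡⟨ cancel-Q^ 6 _ _ (∑-adjoint-kernels conditions combination adjoint) ⟩
        ∑[ y ∈ 𝕍 6 ] 𝟙 (combination y ≟ᵛ 0ᵥ)            ≡⟨ split-combination ⟩
        ∑[ m ∈ 𝕍 2 ] φ (point m) P                      ∎

    D-tangent : D ≡ ∑[ m ∈ 𝕍 2 ] Φ (point m)
    D-tangent = begin
      D                                                                  ≡⟨ ∑-cong (𝕍 6) (λ v → ≡.sym (∑-*ˡ (𝕍 3) (𝟙 (W? v)) _)) ⟩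
      ∑[ v ∈ 𝕍 6 ] ∑[ P ∈ 𝕍 3 ] (𝟙 (W? v) Z.* 𝟙 (singular? v P))         ≡⟨ ∑-swap (𝕍 6) (𝕍 3) _ ⟩
      ∑[ P ∈ 𝕍 3 ] ∑[ v ∈ 𝕍 6 ] (𝟙 (W? v) Z.* 𝟙 (singular? v P))         ≡⟨ ∑-cong (𝕍 3) web-singular-count ⟩
      ∑[ P ∈ 𝕍 3 ] ∑[ m ∈ 𝕍 2 ] φ (point m) P                            ≡⟨ ∑-swap (𝕍 3) (𝕍 2) _ ⟩
      ∑[ m ∈ 𝕍 2 ] Φ (point m)                                           ∎

    point≋0 : ∑[ m ∈ 𝕍 2 ] 𝟙 (point m ≟ᵛ 0ᵥ) ≡ 1ℤ
    point≋0 = ≡.trans (∑-cong (𝕍 2) λ m → 𝟙-cong (point m ≟ᵛ 0ᵥ) (m ≟ᵛ 0ᵥ) (proj₁ L-basis m)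
      (λ m≋0 j → dot-0′ (λ i → M i j) m≋0)) (Enumeration.once (𝕍-enumeration 2) 0ᵥ)

    -- The identity `Φ-ζ` summed over the q² vectors m. The correction for the zero matrix enters
    -- once, at m = 0, because the basis of the line is independent.
    D-E : D Z.+ (Q Z.* I Z.+ Q Z.^ 2 Z.* (Q Z.^ 2 Z.- I)) ≡ E Z.+ (Q Z.^ 4 Z.+ Q Z.^ 4 Z.- Q Z.^ 3)
    D-E = begin
      D Z.+ (Q Z.* I Z.+ Q Z.^ 2 Z.* (Q Z.^ 2 Z.- I))
        ≡⟨ cong₂ Z._+_ D-tangent (cong₂ Z._+_ (≡.sym (∑-*ˡ (𝕍 2) Q _))
             (≡.trans (cong (λ z → Q Z.^ 2 Z.* (z Z.- I)) (≡.sym (∑ᵛ-1 2))) (≡.trans (cong (Z._*_ (Q Z.^ 2)) (≡.trans (≡.sym (∑-¬ (𝕍 2) (λ m → det (point m) ≟ 0#)))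
               (∑-cong (𝕍 2) λ m → 𝟙-¬ (det (point m) ≟ 0#)))) (≡.sym (∑-*ˡ (𝕍 2) _ _))))) ⟩
      (∑[ m ∈ 𝕍 2 ] Φ (point m)) Z.+ ((∑[ m ∈ 𝕍 2 ] (Q Z.* 𝟙 (det (point m) ≟ 0#))) Z.+ (∑[ m ∈ 𝕍 2 ] (Q Z.^ 2 Z.* (1ℤ Z.- 𝟙 (det (point m) ≟ 0#)))))
        ≡⟨ ≡.trans (∑-+ (𝕍 2) _ _) (cong (Z._+_ (∑[ m ∈ 𝕍 2 ] Φ (point m))) (∑-+ (𝕍 2) _ _)) ⟨
      ∑[ m ∈ 𝕍 2 ] (Φ (point m) Z.+ (Q Z.* 𝟙 (det (point m) ≟ 0#) Z.+ Q Z.^ 2 Z.* (1ℤ Z.- 𝟙 (det (point m) ≟ 0#))))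
        ≡⟨ ∑-cong (𝕍 2) (λ m → Φ-ζ (point m)) ⟩
      ∑[ m ∈ 𝕍 2 ] (ζ (point m) Z.+ (Q Z.^ 4 Z.+ Q Z.^ 4 Z.- Q Z.^ 3) Z.* 𝟙 (point m ≟ᵛ 0ᵥ))
        ≡⟨ ≡.trans (∑-+ (𝕍 2) _ _) (cong (Z._+_ E) (≡.trans (∑-*ˡ (𝕍 2) _ _) (≡.trans (cong (Z._*_ (Q Z.^ 4 Z.+ Q Z.^ 4 Z.- Q Z.^ 3)) point≋0) (Z.*-identityʳ _)))) ⟩
      E Z.+ (Q Z.^ 4 Z.+ Q Z.^ 4 Z.- Q Z.^ 3)
        ∎

    -- For fixed ℓ, isotropy of ℓ for M_m is a linear condition on m. Its two coefficients are the
    -- pairings of ℓ² with the basis of the line, and both vanish exactly when ℓ² ∈ W.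
    E-count : Q Z.* E ≡ Q Z.^ 2 Z.* Q Z.^ 3 Z.+ (Q Z.* Q Z.^ 2 Z.- Q Z.^ 2) Z.* B
    E-count = begin
      Q Z.* E
        ≡⟨ cong (Z._*_ Q) (∑-swap (𝕍 2) (𝕍 3) _) ⟩
      Q Z.* (∑[ ℓ ∈ 𝕍 3 ] ∑[ m ∈ 𝕍 2 ] 𝟙 (quad (point m) ℓ ≟ 0#))
        ≡⟨ ∑-*ˡ (𝕍 3) Q _ ⟨
      ∑[ ℓ ∈ 𝕍 3 ] (Q Z.* (∑[ m ∈ 𝕍 2 ] 𝟙 (quad (point m) ℓ ≟ 0#)))
        ≡⟨ ∑-cong (𝕍 3) at ⟩
      ∑[ ℓ ∈ 𝕍 3 ] (Q Z.^ 2 Z.* 1ℤ Z.+ (Q Z.* Q Z.^ 2 Z.- Q Z.^ 2) Z.* 𝟙 (W? (square ℓ)))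
        ≡⟨ ≡.trans (∑-+ (𝕍 3) _ _) (cong₂ Z._+_ (≡.trans (∑-*ˡ (𝕍 3) _ _) (cong (Z._*_ (Q Z.^ 2)) (∑ᵛ-1 3))) (∑-*ˡ (𝕍 3) _ _)) ⟩
      Q Z.^ 2 Z.* Q Z.^ 3 Z.+ (Q Z.* Q Z.^ 2 Z.- Q Z.^ 2) Z.* B
        ∎
      where
      at : ∀ ℓ → Q Z.* (∑[ m ∈ 𝕍 2 ] 𝟙 (quad (point m) ℓ ≟ 0#)) ≡ Q Z.^ 2 Z.* 1ℤ Z.+ (Q Z.* Q Z.^ 2 Z.- Q Z.^ 2) Z.* 𝟙 (W? (square ℓ))
      at ℓ = begin
        Q Z.* (∑[ m ∈ 𝕍 2 ] 𝟙 (quad (point m) ℓ ≟ 0#))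
          ≡⟨ cong (Z._*_ Q) (∑-cong (𝕍 2) λ m → 𝟙-cong (quad (point m) ℓ ≟ 0#) (dot u m ≟ 0#) (trans (pairing m)) (trans (sym (pairing m)))) ⟩
        Q Z.* (∑[ m ∈ 𝕍 2 ] 𝟙 (dot u m ≟ 0#))
          ≡⟨ ∑-linear u ⟩
        Q Z.^ 2 Z.+ (Q Z.* Q Z.^ 2 Z.- Q Z.^ 2) Z.* 𝟙 (u ≟ᵛ 0ᵥ)
          ≡⟨ cong₂ Z._+_ (≡.sym (Z.*-identityʳ (Q Z.^ 2))) (cong (Z._*_ (Q Z.* Q Z.^ 2 Z.- Q Z.^ 2)) (𝟙-cong (u ≟ᵛ 0ᵥ) (W? (square ℓ))
               (λ u≋0 → orthogonal⇒web (square ℓ) (u≋0 0F) (u≋0 1F))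
               (λ sq∈W → λ { 0F → proj₁ (web⇒orthogonal (square ℓ) sq∈W) ; 1F → proj₂ (web⇒orthogonal (square ℓ) sq∈W) }))) ⟩
        Q Z.^ 2 Z.* 1ℤ Z.+ (Q Z.* Q Z.^ 2 Z.- Q Z.^ 2) Z.* 𝟙 (W? (square ℓ))
          ∎
        where
        u : Vector Carrier 2
        u = dot (square ℓ) (M 0F) ∷ dot (square ℓ) (M 1F) ∷ []
        pairing : ∀ m → dot u m ≈ quad (point m) ℓ
        pairing m = trans (dot-comm u m) (trans (sym (dot-point (square ℓ) m)) (dot-square ℓ (point m)))

    C-I : C Z.+ Q Z.^ 2 ≡ Q Z.^ 3 Z.+ Q Z.* I
    C-I = cancel-Q-1 _ _ (begin
      (Q Z.- 1ℤ) Z.* (C Z.+ Q Z.^ 2)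
        ≡⟨ identity ρ ((x :- con 1ℤ) :* (c :+ x^ 2)) ((((x^ 4 :+ (x :- con 1ℤ) :* c) :+ (x^ 2 :- x) :* b) :+ (x^ 3 :- x^ 2)) :- rest) ⟩
      (((Q Z.^ 4 Z.+ (Q Z.- 1ℤ) Z.* C) Z.+ (Q Z.^ 2 Z.- Q) Z.* B) Z.+ (Q Z.^ 3 Z.- Q Z.^ 2)) Z.- K
        ≡⟨ cong (Z._- K) D-singular ⟨
      D Z.- K
        ≡⟨ identity ρ (d :- rest) ((d :+ (x :* i :+ x^ 2 :* (x^ 2 :- i))) :- ((x :* i :+ x^ 2 :* (x^ 2 :- i)) :+ rest)) ⟩
      (D Z.+ (Q Z.* I Z.+ Q Z.^ 2 Z.* (Q Z.^ 2 Z.- I))) Z.- ((Q Z.* I Z.+ Q Z.^ 2 Z.* (Q Z.^ 2 Z.- I)) Z.+ K)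
        ≡⟨ cong (Z._- ((Q Z.* I Z.+ Q Z.^ 2 Z.* (Q Z.^ 2 Z.- I)) Z.+ K)) (≡.trans D-E (cong (Z._+ (Q Z.^ 4 Z.+ Q Z.^ 4 Z.- Q Z.^ 3)) E≡)) ⟩
      ((Q Z.^ 4 Z.+ (Q Z.^ 2 Z.- Q) Z.* B) Z.+ (Q Z.^ 4 Z.+ Q Z.^ 4 Z.- Q Z.^ 3)) Z.- ((Q Z.* I Z.+ Q Z.^ 2 Z.* (Q Z.^ 2 Z.- I)) Z.+ K)
        ≡⟨ identity ρ (((x^ 4 :+ (x^ 2 :- x) :* b) :+ ((x^ 4 :+ x^ 4) :- x^ 3)) :- ((x :* i :+ x^ 2 :* (x^ 2 :- i)) :+ rest)) ((x :- con 1ℤ) :* (x^ 3 :+ x :* i)) ⟩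
      (Q Z.- 1ℤ) Z.* (Q Z.^ 3 Z.+ Q Z.* I)
        ∎)
      where
      open ℤ-Solver
      -- K has the value of E, the part that cancels. Subtracting it from `D-singular` leaves (q -
      -- 1)(C + q²), because q³ - q² = (q - 1) q².
      K : ℤ
      K = (Q Z.^ 4 Z.+ (Q Z.^ 2 Z.- Q) Z.* B) Z.+ (Q Z.^ 2 Z.- Q Z.^ 2)
      ρ : Vec ℤ 5
      ρ = Q ∷ᵥ C ∷ᵥ I ∷ᵥ B ∷ᵥ D ∷ᵥ []ᵥ
      x c i b d : Polynomial 5
      x = var 0F
      c = var 1F
      i = var 2F
      b = var 3F
      d = var 4F
      x^_ : ℕ → Polynomial 5
      x^ zero  = con 1ℤ
      x^ suc n = x :* x^ n
      rest : Polynomial 5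
      rest = (x^ 4 :+ (x^ 2 :- x) :* b) :+ (x^ 2 :- x^ 2)
      E≡ : E ≡ Q Z.^ 4 Z.+ (Q Z.^ 2 Z.- Q) Z.* B
      E≡ = cancel-Q _ _ (≡.trans E-count (identity ρ (x^ 2 :* x^ 3 :+ (x :* x^ 2 :- x^ 2) :* b) (x :* (x^ 4 :+ (x^ 2 :- x) :* b))))

    lc-scale : ∀ {k n} (b : Vector (Vector Carrier n) k) a c → linearCombination (a *ᵥ c) b ≋ (a *ᵥ linearCombination c b)
    lc-scale b a c j = trans (dot-comm (a *ᵥ c) (λ i → b i j)) (trans (dot-*ʳ (λ i → b i j) a c) (*-congˡ (dot-comm (λ i → b i j) c)))

    secant-points⇔ : ∀ n → HasSize (PG 5 (L ∩ SecantVariety)) n ⇔ (I ≡ (Q Z.- 1ℤ) Z.* + n Z.+ 1ℤ)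
    secant-points⇔ n = mk⇔ (λ s → ≡.trans (≡.sym counted) (Equivalence.to sized s)) (λ eq → Equivalence.from sized (≡.trans counted eq))
      where
      P? : Decidable (L ∩ SecantVariety)
      P? y = L? y ×-dec map′ (det≈0⇒secant y) (secant⇒det≈0 y) (det y ≟ 0#)
      sized : HasSize (PG 5 (L ∩ SecantVariety)) n ⇔ (∑[ y ∈ 𝕍 6 ] 𝟙 (P? y) ≡ (Q Z.- 1ℤ) Z.* + n Z.+ 1ℤ)
      sized = PG-size⇔count P?
        (λ {u} {v} u≋v (u∈L , u∈S) → ∈-basis-resp M L-basis u≋v u∈L , det≈0⇒secant v (trans (det-cong {v} {u} (≋-sym u≋v)) (secant⇒det≈0 u u∈S)))
        (Equivalence.from (proj₂ L-basis 0ᵥ) (0ᵥ , λ j → sym (dot-0′ (λ i → M i j) (≋-refl {x = 0ᵥ}))) , det≈0⇒secant 0ᵥ det-0)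
        (λ a {v} (v∈L , v∈S) → let m , v≋ = Equivalence.to (proj₂ L-basis v) v∈L in
          Equivalence.from (proj₂ L-basis (a *ᵥ v)) (a *ᵥ m , λ j → trans (*-congˡ (v≋ j)) (sym (lc-scale M a m j))) ,
          det≈0⇒secant (a *ᵥ v) (trans (det-scale a v) (*0≈0 _ (secant⇒det≈0 v v∈S))))
        n
      counted : ∑[ y ∈ 𝕍 6 ] 𝟙 (P? y) ≡ I
      counted = begin
        ∑[ y ∈ 𝕍 6 ] 𝟙 (P? y)                            ≡⟨ ∑-cong (𝕍 6) (λ y → ≡.trans
                                                              (𝟙-cong (P? y) (L? y ×-dec (det y ≟ 0#)) (λ (l , s) → l , secant⇒det≈0 y s) (λ (l , d) → l , det≈0⇒secant y d))
                                                              (𝟙-× (L? y) (det y ≟ 0#))) ⟩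
        ∑[ y ∈ 𝕍 6 ] (𝟙 (L? y) Z.* 𝟙 (det y ≟ 0#))        ≡⟨ ∑-basis M L-basis (λ {u} {v} u≋v → 𝟙-cong (det u ≟ 0#) (det v ≟ 0#)
                                                              (trans (det-cong {v} {u} (≋-sym u≋v))) (trans (det-cong {u} {v} u≋v))) ⟨
        I                                                ∎

    cubic-points⇔ : ∀ n → HasSize (PG 3 (CubicSurface w)) n ⇔ (C ≡ (Q Z.- 1ℤ) Z.* + n Z.+ 1ℤ)
    cubic-points⇔ n = PG-size⇔count {P = CubicSurface w} (λ x → disc (form x) ≟ 0#)
      (λ {u} {v} u≋v → trans (disc-cong {form v} {form u} (lc-cong w (≋-sym u≋v))))
      (isSquare⇒disc≈0 (form 0ᵥ) (zero-isSquare λ j → dot-0′ (λ i → w i j) (≋-refl {x = 0ᵥ})))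
      (λ a {v} Δ≈0 → trans (disc-cong {form (a *ᵥ v)} {a *ᵥ form v} (lc-scale w a v)) (trans (disc-scale a (form v)) (*0≈0 _ Δ≈0)))
      n

    -- Substituting I = (q - 1) i + 1 and C = (q - 1) n + 1 into C + q² = q³ + q I gives (q - 1) n =
    -- (q - 1)(q² + i q + 1).
    secant⇔cubic : ∀ i → HasSize (PG 5 (L ∩ SecantVariety)) i ⇔ HasSize (PG 3 (CubicSurface w)) (q ℕ.^ 2 ℕ.+ i ℕ.* q ℕ.+ 1)
    secant⇔cubic i = mk⇔
      (λ s → Equivalence.from (cubic-points⇔ n) (to (Equivalence.to (secant-points⇔ i) s)))
      (λ s → Equivalence.from (secant-points⇔ i) (from (Equivalence.to (cubic-points⇔ n) s)))
      where
      open ℤ-Solver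
      n : ℕ
      n = q ℕ.^ 2 ℕ.+ i ℕ.* q ℕ.+ 1
      x c s k : Polynomial 4
      x = var 0F
      c = var 1F
      s = var 2F
      k = var 3F
      x² x³ : Polynomial 4
      x² = x :* (x :* con 1ℤ)
      x³ = x :* x²
      ρ : Vec ℤ 4
      ρ = Q ∷ᵥ C ∷ᵥ I ∷ᵥ + i ∷ᵥ []ᵥ
      +n≡ : + n ≡ (Q Z.^ 2 Z.+ + i Z.* Q) Z.+ 1ℤ
      +n≡ = ≡.trans (Z.pos-+ (q ℕ.^ 2 ℕ.+ i ℕ.* q) 1) (cong (Z._+ 1ℤ) (≡.trans (Z.pos-+ (q ℕ.^ 2) (i ℕ.* q))
        (cong₂ Z._+_ (≡.trans (Z.pos-* q (q ℕ.* 1)) (≡.trans (cong (Z._*_ (+ q)) (Z.pos-* q 1)) (≡.sym (cong (λ z → z Z.* (z Z.* 1ℤ)) Q≡+q))))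
          (≡.trans (Z.pos-* i q) (cong (Z._*_ (+ i)) (≡.sym Q≡+q))))))
      to : I ≡ (Q Z.- 1ℤ) Z.* + i Z.+ 1ℤ → C ≡ (Q Z.- 1ℤ) Z.* + n Z.+ 1ℤ
      to eq = begin
        C                                                          ≡⟨ identity ρ c ((c :+ x²) :- x²) ⟩
        (C Z.+ Q Z.^ 2) Z.- Q Z.^ 2                                ≡⟨ cong (Z._- Q Z.^ 2) (≡.trans C-I (cong (λ z → Q Z.^ 3 Z.+ Q Z.* z) eq)) ⟩
        (Q Z.^ 3 Z.+ Q Z.* ((Q Z.- 1ℤ) Z.* + i Z.+ 1ℤ)) Z.- Q Z.^ 2  ≡⟨ identity ρ ((x³ :+ x :* ((x :- con 1ℤ) :* k :+ con 1ℤ)) :- x²) ((x :- con 1ℤ) :* ((x² :+ k :* x) :+ con 1ℤ) :+ con 1ℤ) ⟩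
        (Q Z.- 1ℤ) Z.* ((Q Z.^ 2 Z.+ + i Z.* Q) Z.+ 1ℤ) Z.+ 1ℤ     ≡⟨ cong (λ z → (Q Z.- 1ℤ) Z.* z Z.+ 1ℤ) +n≡ ⟨
        (Q Z.- 1ℤ) Z.* + n Z.+ 1ℤ                                  ∎
      from : C ≡ (Q Z.- 1ℤ) Z.* + n Z.+ 1ℤ → I ≡ (Q Z.- 1ℤ) Z.* + i Z.+ 1ℤ
      from eq = cancel-Q _ _ (begin
        Q Z.* I                                                    ≡⟨ identity ρ (x :* s) ((x³ :+ x :* s) :- x³) ⟩
        (Q Z.^ 3 Z.+ Q Z.* I) Z.- Q Z.^ 3                          ≡⟨ cong (Z._- Q Z.^ 3) (≡.trans (≡.sym C-I) (cong (Z._+ Q Z.^ 2) (≡.trans eq (cong (λ z → (Q Z.- 1ℤ) Z.* z Z.+ 1ℤ) +n≡)))) ⟩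
        (((Q Z.- 1ℤ) Z.* ((Q Z.^ 2 Z.+ + i Z.* Q) Z.+ 1ℤ) Z.+ 1ℤ) Z.+ Q Z.^ 2) Z.- Q Z.^ 3
                                                                   ≡⟨ identity ρ ((((x :- con 1ℤ) :* ((x² :+ k :* x) :+ con 1ℤ) :+ con 1ℤ) :+ x²) :- x³) (x :* ((x :- con 1ℤ) :* k :+ con 1ℤ)) ⟩
        Q Z.* ((Q Z.- 1ℤ) Z.* + i Z.+ 1ℤ)                          ∎)

open import Data.List.Base using ([]; _∷_)
open import Data.Nat.Base using (_+_; _*_; _^_)

theorem4p31 : ∀ {c ℓ₁ ℓ₂ ℓ} (q : ℕ) → IsPrimePower q →
    (F : HeytingField c ℓ₁ ℓ₂) → let open HeytingField F using (Carrier) in let open ProjectiveGeometry F in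
    HasSize scalars q →
    (L : Pred (Vector Carrier 6) ℓ) → IsLine L →
    (f : Vector QuadraticForm 4) → IsBasis f (Web L) →
    (i : ℕ) → i ∈ (0 ∷ 1 ∷ 2 ∷ 3 ∷ q + 1 ∷ []) →
    HasSize (PG 5 (L ∩ SecantVariety)) i ⇔ HasSize (PG 3 (CubicSurface f)) (q ^ 2 + i * q + 1)
theorem4p31 q _ F size L (M , L-basis) f W-basis i _ = FiniteField.LineAndWeb.secant⇔cubic F size L M L-basis f W-basis i
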